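{- Let $q\ge5$ be a prime power with $q\not\equiv0\pmod3$. If $q\equiv1\pmod3$: $\Lambda_{\mathrm{RA},3_{\mathcal C}}=\Lambda_{\mathrm{RA},0_{\mathcal C}}=\Lambda_{\mathrm{IA},\overline{1_{\mathcal C}}}=1$; $\Pi_{3_{\mathcal C},\mathrm{RA}}=(q-1)/3$; $\Pi_{0_{\mathcal C},\mathrm{RA}}=2(q-1)/3$; $\Pi_{\overline{1_{\mathcal C}},\mathrm{IA}}=q+1$; and $\Lambda_{\mathrm{IA},3_{\mathcal C}}=\Pi_{3_{\mathcal C},\mathrm{IA}}=\Lambda_{\mathrm{IA},0_{\mathcal C}}=\Pi_{0_{\mathcal C},\mathrm{IA}}=\Lambda_{\mathrm{RA},\overline{1_{\mathcal C}}}=\Pi_{\overline{1_{\mathcal C}},\mathrm{RA}}=0$. If $q\equiv-1\pmod3$: $\Lambda_{\mathrm{IA},3_{\mathcal C}}=\Lambda_{\mathrm{IA},0_{\mathcal C}}=\Lambda_{\mathrm{RA},\overline{1_{\mathcal C}}}=1$; $\Pi_{3_{\mathcal C},\mathrm{IA}}=(q+1)/3$; $\Pi_{0_{\mathcal C},\mathrm{IA}}=2(q+1)/3$; $\Pi_{\overline{1_{\mathcal C}},\mathrm{RA}}=q-1$; and $\Lambda_{\mathrm{RA},3_{\mathcal C}}=\Pi_{3_{\mathcal C},\mathrm{RA}}=\Lambda_{\mathrm{RA},0_{\mathcal C}}=\Pi_{0_{\mathcal C},\mathrm{RA}}=\Lambda_{\mathrm{IA},\overline{1_{\mathcal C}}}=\Pi_{\overline{1_{\mathcal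 C}},\mathrm{IA}}=0$.
   Context: Let $\mathrm{PG}(3,q)$ have points $\mathbf{P}(x_0,x_1,x_2,x_3)$; put $P(t)=\mathbf{P}(t^3,t^2,t,1)$ ($t\in\mathbb{F}_q$), $P(\infty)=\mathbf{P}(1,0,0,0)$, $\mathcal{C}=\{P(t):t\in\mathbb{F}_q\cup\{\infty\}\}$ the twisted cubic, $G_q$ the group of projectivities fixing $\mathcal C$. Write $\boldsymbol{\pi}(c_0,c_1,c_2,c_3)$ for the plane $c_0x_0+c_1x_1+c_2x_2+c_3x_3=0$. The $\Gamma$-planes are the osculating planes $\boldsymbol{\pi}(1,-3t,3t^2,-t^3)$ ($t\in\mathbb{F}_q$) and $\boldsymbol{\pi}(0,0,0,1)$. A $d_{\mathcal C}$-plane ($d\in\{0,3\}$) contains exactly $d$ points of $\mathcal C$; a $\overline{1_{\mathcal C}}$-plane is a non-$\Gamma$-plane containing exactly one point of $\mathcal C$ (for $q\ge5$ each plane type is a $G_q$-orbit). An RA-line (real axis) is the intersection line of two distinct $\Gamma$-planes; an IA-line (imaginary axis) is the line of $\mathrm{PG}(3,q)$ that is the intersection of $\boldsymbol{\pi}(1,-3s,3s^2,-s^3)$ and $\boldsymbol{\pi}(1,-3s^q,3s^{2q},-s^{3q})$ for some $s\in\mathbb{F}_{q^2}\setminus\mathbb{F}_q$. Notation: $\Lambda_{\lambda,\pi}$ is the number of $\lambda$-lines in a $\pi$-plane; $\Pi_{\pi,\lambda}$ is the average, over all $\lambda$-lines, of the number of $\pi$-planes through the line. -}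

module Defs where

open import Level using (0ℓ)
open import Data.Nat using (ℕ; _<_) renaming (_*_ to _*ℕ_)
open import Data.Product using (Σ; _×_; _,_)
open import Data.Maybe using (Maybe; just; nothing)
open import Data.List using (List; length)
open import Data.List.Relation.Unary.All using (All)
open import Data.List.Relation.Unary.Any using (Any)
open import Data.List.Relation.Unary.AllPairs using (AllPairs)
open import Data.List.Relation.Unary.Unique.Propositional using (Unique)
open import Data.List.Membership.Propositional using (_∈_)
open import Relation.Nullary using (¬_)
open import Relation.Binary.PropositionalEquality using (_≡_)
open import Relation.Binary.Definitions using (DecidableEquality)
open import Algebra.Structures using (IsCommutativeRing)

Card : {A : Set} → (A → A → Set) → (A → Set) → ℕ → Set
Card {A} _~_ P n =
  Σ (List A) λ xs →
    (length xs ≡ n) ×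
    All P xs ×
    AllPairs (λ x y → ¬ (x ~ y)) xs ×
    (∀ x → P x → Any (λ y → x ~ y) xs)

record FiniteField (q : ℕ) : Set₁ where
  infixl 6 _+_
  infixl 7 _*_
  field
    Carrier : Set
    _+_ _*_ : Carrier → Carrier → Carrier
    -_ : Carrier → Carrier
    0# 1# : Carrier
    isCommutativeRing : IsCommutativeRing _≡_ _+_ _*_ -_ 0# 1#
    0≢1 : ¬ (0# ≡ 1#)
    inverse : ∀ x → ¬ (x ≡ 0#) → Σ Carrier λ y → x * y ≡ 1#
    _≟_ : DecidableEquality Carrier
    elements : List Carrier
    elements-unique : Unique elements
    elements-complete : ∀ x → x ∈ elements
    elements-length : length elements ≡ q

record Embedding {q r : ℕ} (F : FiniteField q) (K : FiniteField r) : Set where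
  private
    module F = FiniteField F
    module K = FiniteField K
  field
    ι : F.Carrier → K.Carrier
    ι-+ : ∀ a b → ι (a F.+ b) ≡ ι a K.+ ι b
    ι-* : ∀ a b → ι (a F.* b) ≡ ι a K.* ι b
    ι-1 : ι F.1# ≡ K.1#

record Quad (A : Set) : Set where
  constructor ⟨_,_,_,_⟩
  field
    x₀ x₁ x₂ x₃ : A

-- Geometry of PG(3,q) over F = F_q, with K = F_{q^2} ⊇ F (via ι),
-- used only for the definition of imaginary axes.

module Geometry {q : ℕ} (F : FiniteField q) (K : FiniteField (q *ℕ q))
                (E : Embedding F K) where

  private
    module F = FiniteField F
    module K = FiniteField K
    module E = Embedding E

  𝔽 : Set
  𝔽 = F.Carrier

  V : Set
  V = Quad 𝔽

  zeroV : V
  zeroV = ⟨ F.0# , F.0# , F.0# , F.0# ⟩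

  NonZeroV : V → Set
  NonZeroV x = ¬ (x ≡ zeroV)

  _•_ : 𝔽 → V → V
  k • ⟨ a , b , c , d ⟩ = ⟨ k F.* a , k F.* b , k F.* c , k F.* d ⟩

  Proportional : V → V → Set
  Proportional x y = Σ 𝔽 λ k → y ≡ k • x

  dot : V → V → 𝔽
  dot ⟨ c₀ , c₁ , c₂ , c₃ ⟩ ⟨ a₀ , a₁ , a₂ , a₃ ⟩ =
    c₀ F.* a₀ F.+ c₁ F.* a₁ F.+ c₂ F.* a₂ F.+ c₃ F.* a₃

  IsPoint : V → Set
  IsPoint = NonZeroV

  SamePoint : V → V → Set
  SamePoint = Proportional

  IsPlane : V → Set
  IsPlane = NonZeroV

  SamePlane : V → V → Set
  SamePlane = Proportional

  OnPlane : V → V → Set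
  OnPlane c x = dot c x ≡ F.0#

  Line : Set
  Line = V × V

  IsLine : Line → Set
  IsLine (a , b) = IsPlane a × IsPlane b × ¬ SamePlane a b

  OnLine : Line → V → Set
  OnLine (a , b) x = OnPlane a x × OnPlane b x

  SameLine : Line → Line → Set
  SameLine ℓ m = ∀ x → IsPoint x → (OnLine ℓ x → OnLine m x) × (OnLine m x → OnLine ℓ x)

  LineInPlane : Line → V → Set
  LineInPlane ℓ p = ∀ x → IsPoint x → OnLine ℓ x → OnPlane p x

  -- the twisted cubic; Maybe 𝔽 = F_q ∪ {∞} (nothing = ∞)
  three : 𝔽
  three = F.1# F.+ F.1# F.+ F.1#

  Pt : Maybe 𝔽 → V
  Pt (just t) = ⟨ t F.* t F.* t , t F.* t , t , F.1# ⟩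
  Pt nothing  = ⟨ F.1# , F.0# , F.0# , F.0# ⟩

  -- Γ-planes: osculating planes π(1,-3t,3t²,-t³) and π(0,0,0,1)
  Γ : Maybe 𝔽 → V
  Γ (just t) = ⟨ F.1# , F.- (three F.* t) , three F.* (t F.* t) , F.- (t F.* t F.* t) ⟩
  Γ nothing  = ⟨ F.0# , F.0# , F.0# , F.1# ⟩

  IsΓPlane : V → Set
  IsΓPlane c = IsPlane c × Σ (Maybe 𝔽) λ u → SamePlane c (Γ u)

  CPointsOn : V → ℕ → Set
  CPointsOn c n = Card (λ u v → SamePoint (Pt u) (Pt v)) (λ u → OnPlane c (Pt u)) n

  Plane[_]𝒞 : ℕ → V → Set
  Plane[ d ]𝒞 c = IsPlane c × CPointsOn c d

  Plane1̄𝒞 : V → Set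
  Plane1̄𝒞 c = IsPlane c × ¬ IsΓPlane c × CPointsOn c 1

  RA : Line → Set
  RA ℓ = IsLine ℓ × Σ (Maybe 𝔽) λ u → Σ (Maybe 𝔽) λ v →
           ¬ SamePlane (Γ u) (Γ v) × SameLine ℓ (Γ u , Γ v)

  -- IA-lines: lines of PG(3,q) whose points are exactly the F_q-points of
  -- π(1,-3s,3s²,-s³) ∩ π(1,-3s^q,3s^{2q},-s^{3q}), s ∈ F_{q²} ∖ F_q.
  -- (An F_q-point lies on the conjugate plane iff it lies on the first one.)
  threeK : K.Carrier
  threeK = K.1# K.+ K.1# K.+ K.1#

  ΓK : K.Carrier → Quad K.Carrier
  ΓK s = ⟨ K.1# , K.- (threeK K.* s) , threeK K.* (s K.* s) , K.- (s K.* s K.* s) ⟩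

  ιV : V → Quad K.Carrier
  ιV ⟨ a , b , c , d ⟩ = ⟨ E.ι a , E.ι b , E.ι c , E.ι d ⟩

  dotK : Quad K.Carrier → Quad K.Carrier → K.Carrier
  dotK ⟨ c₀ , c₁ , c₂ , c₃ ⟩ ⟨ a₀ , a₁ , a₂ , a₃ ⟩ =
    c₀ K.* a₀ K.+ c₁ K.* a₁ K.+ c₂ K.* a₂ K.+ c₃ K.* a₃

  IA : Line → Set
  IA ℓ = IsLine ℓ × Σ K.Carrier λ s → (∀ a → ¬ (E.ι a ≡ s)) ×
           (∀ x → IsPoint x → (OnLine ℓ x → dotK (ΓK s) (ιV x) ≡ K.0#)
                              × (dotK (ΓK s) (ιV x) ≡ K.0# → OnLine ℓ x))

  Λ : (Line → Set) → (V → Set) → ℕ → Set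
  Λ λ-line π-plane n =
    ∀ p → π-plane p → Card SameLine (λ ℓ → λ-line ℓ × LineInPlane ℓ p) n

  -- Π λ π num den : the average, over all λ-lines, of the number of
  -- π-planes through the line equals num/den, i.e. (number of incident
  -- pairs (λ-line, π-plane)) * den = num * (number of λ-lines), and there
  -- is at least one λ-line.
  Π : (Line → Set) → (V → Set) → ℕ → ℕ → Set
  Π λ-line π-plane num den =
    Σ ℕ λ nL → Σ ℕ λ nF →
      Card SameLine λ-line nL ×
      Card (λ (f g : Line × V) → SameLine (Data.Product.proj₁ f) (Data.Product.proj₁ g)
                                × SamePlane (Data.Product.proj₂ f) (Data.Product.proj₂ g))
           (λ f → λ-line (Data.Product.proj₁ f) × π-plane (Data.Product.proj₂ f)
                  × LineInPlane (Data.Product.proj₁ f) (Data.Product.proj₂ f))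
           nF ×
      (0 < nL) × (den *ℕ nF ≡ num *ℕ nL)

-- Planes correspond to binary cubics f up to a scalar, the points of 𝒞 on a plane being the roots of
-- f in P¹(F_q), and Γ-planes to the cubes of linear forms.  The planes through the axis attached to a
-- quadratic form h with distinct roots (in F_q for a real axis, conjugate in F_{q²} for an imaginary
-- one) are the cubics apolar to h.  A cubic f that is not a cube has, up to a scalar, exactly one
-- apolar quadratic, its Hessian; so its plane contains exactly one axis, real or imaginary as the
-- Hessian splits over F_q or is irreducible, unless the Hessian is a square, and then f has exactly
-- two roots.
--
-- The subgroup of PGL(2,q) fixing the roots of h is cyclic of order q ∓ 1, so it has an element of
-- order 3 iff 3 divides that number.  In that case this element permutes the roots of every f apolar to h, so
-- f has 0 or 3 roots.  Otherwise f has at most one root: the Hessian of L₁L₂(L₁ + L₂) is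
-- −(L₁² + L₁L₂ + L₂²) up to a square, so f with three roots forces h to split exactly when F_q
-- contains a cube root of unity, i.e. when 3 ∣ q − 1.  Each point of 𝒞 that is not a root of h lies on
-- exactly one nondegenerate plane through the axis, and double counting gives the numbers of planes.

module Submission where

open import Defs
open import Level using (0ℓ)
open import Algebra.Bundles using (CommutativeRing; RawRing)
import Algebra.Properties.Ring
open import Algebra.Solver.Ring.AlmostCommutativeRing using (AlmostCommutativeRing; fromCommutativeRing; _-Raw-AlmostCommutative⟶_)
open import Data.Nat.Base as ℕ using (ℕ; zero; suc; _≤_; _<_; z≤n; s≤s)
import Data.Nat.Properties as ℕ
open import Data.Nat.DivMod using (_%_; [m+kn]%n≡m%n)
open import Data.Nat.Divisibility using (_∣_)
open import Data.List using (List; []; _∷_; _++_; length; map; filter; cartesianProduct)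
open import Data.List.Properties using (length-++; length-map; length-filter; filter-reject; filter-notAll)
open import Data.List.Membership.Propositional using (_∈_; lose; find)
open import Data.List.Membership.Propositional.Properties
open import Data.List.Relation.Unary.All as All using (All; []; _∷_; all?)
import Data.List.Relation.Unary.All.Properties as Allₚ
open import Data.List.Relation.Unary.AllPairs as AllPairs using (AllPairs; []; _∷_)
import Data.List.Relation.Unary.AllPairs.Properties as AllPairsₚ
open import Data.List.Relation.Unary.Any as Any using (Any; here; there; any?)
import Data.List.Relation.Unary.Any.Properties as Anyₚ
open import Data.List.Relation.Unary.Unique.Propositional using (Unique)
import Data.List.Relation.Unary.Unique.Propositional.Properties as Uniqueₚ
open import Data.Maybe.Base using (Maybe; just; nothing)
open import Data.Maybe.Properties using (just-injective) renaming (≡-dec to Maybe-≡-dec)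
open import Data.Product using (Σ; ∃; _×_; _,_; proj₁; proj₂; swap)
open import Data.Product.Properties using (≡-dec)
open import Data.Sum using (_⊎_; inj₁; inj₂; [_,_]′)
open import Data.Sum.Properties using (inj₁-injective; inj₂-injective)
open import Data.Vec.N-ary using (N-ary; Eq; curryⁿ; curryⁿ-cong)
open import Function using (_∘_; id)
open import Relation.Binary.Definitions using (DecidableEquality)
open import Relation.Binary.PropositionalEquality
open import Relation.Nullary using (¬_; Dec; yes; no; contradiction)
open import Relation.Nullary.Decidable using (¬?; _×-dec_; _→-dec_; map′)
open import Relation.Unary using (Decidable)

-- The residue of q modulo 3 enters only through the polynomial x² - x + 1: counting orbits of x ↦
-- 1/(1 - x) shows that it has a root ρ in F_q iff q ≡ 1. The elements of order 3 are then written
-- down rather than deduced from cyclicity: for a real axis, the matrix with eigenvalues -ρ and ρ -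
-- 1 at the roots of h; for an imaginary axis, multiplication by an element of trace -1 and norm 1,
-- which exists by another count. Characteristic 2 is allowed, so irreducibility means absence of
-- roots, not a condition on a discriminant.
--
-- The double counting closes because an axis lies on as many nondegenerate planes as there are
-- points of the cubic that are not roots of h (q - 1 for a real axis, q + 1 for an imaginary one).
-- These planes carry one root on average: at most one means exactly one, and 0 or 3 means that a
-- third of them carry three.
--
-- The two congruence classes exchange the real and the imaginary axes, so one argument about two
-- families serves both. Every axis yields the same count, so the averages need no total number of
-- axes.

-- Counting in finite lists, and cardinalities up to a relation

module Counting where
  open import Data.Nat using (ℕ; zero; suc; _≤_; _<_; _+_; _*_; _∸_; z≤n; s≤s; _≟_)
  open import Data.Nat.Properties
  open import Data.Nat.ListAction using (sum)
  open import Data.Nat.Divisibility using (_∣_; ∣-refl; _∣0; ∣m∣n⇒∣m+n)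
  open import Algebra.Properties.CommutativeSemigroup +-commutativeSemigroup using (x∙yz≈y∙xz)

  private variable
    A B : Set

  count : {P : A → Set} → Decidable P → List A → ℕ
  count P? xs = length (filter P? xs)

  ∑ : List A → (A → ℕ) → ℕ
  ∑ xs f = sum (map f xs)

  count-split : {P : A → Set} (P? : Decidable P) (xs : List A) → count P? xs + count (¬? ∘ P?) xs ≡ length xs
  count-split P? [] = refl
  count-split P? (x ∷ xs) with P? x
  ... | yes _ = cong suc (count-split P? xs)
  ... | no _  = trans (+-suc _ _) (cong suc (count-split P? xs))

  length-cartesianProduct : (xs : List A) (ys : List B) → length (cartesianProduct xs ys) ≡ length xs * length ys
  length-cartesianProduct [] ys = refl
  length-cartesianProduct (x ∷ xs) ys = trans (length-++ (map (x ,_) ys))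
    (cong₂ _+_ (length-map (x ,_) ys) (length-cartesianProduct xs ys))

  unique-⊆⇒length≤ : {xs ys : List A} → Unique xs → (∀ {x} → x ∈ xs → x ∈ ys) → length xs ≤ length ys
  unique-⊆⇒length≤ {xs = []} _ _ = z≤n
  unique-⊆⇒length≤ {xs = x ∷ xs} (x∉ ∷ uniq) sub with ∈-∃++ (sub (here refl))
  ... | as , bs , refl = begin
    suc (length xs)              ≤⟨ s≤s (unique-⊆⇒length≤ uniq sub′) ⟩
    suc (length (as ++ bs))      ≡⟨ cong suc (length-++ as) ⟩
    suc (length as + length bs)  ≡⟨ +-suc (length as) _ ⟨
    length as + suc (length bs)  ≡⟨ length-++ as ⟨
    length (as ++ x ∷ bs)        ∎
    where
    open ≤-Reasoning
    sub′ : ∀ {y} → y ∈ xs → y ∈ as ++ bs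
    sub′ y∈ with ∈-++⁻ as (sub (there y∈))
    ... | inj₁ i          = ∈-++⁺ˡ i
    ... | inj₂ (here y≡x) = contradiction (sym y≡x) (All.lookup x∉ y∈)
    ... | inj₂ (there i)  = ∈-++⁺ʳ as i

  count-exactly : {P : A → Set} (P? : Decidable P) {xs ys : List A} → Unique xs → Unique ys →
    (∀ {x} → x ∈ ys → x ∈ xs × P x) → (∀ {x} → x ∈ xs → P x → x ∈ ys) →
    count P? xs ≡ length ys
  count-exactly P? uxs uys into onto = ≤-antisym
    (unique-⊆⇒length≤ (Uniqueₚ.filter⁺ P? uxs) λ i → let (j , p) = ∈-filter⁻ P? i in onto j p)
    (unique-⊆⇒length≤ uys λ i → let (j , p) = into i in ∈-filter⁺ P? j p)

  surjective-of-length : DecidableEquality B → {xs : List A} {ys : List B} (f : A → B) →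
    Unique xs → (∀ y → y ∈ ys) → (∀ {x x′} → f x ≡ f x′ → x ≡ x′) → length ys ≤ length xs →
    ∀ y → ∃ λ x → f x ≡ y
  surjective-of-length {A = A} _≟_ {xs} {ys} f uniq complete inj le y with any? (y ≟_) (map f xs)
  ... | yes i with ∈-map⁻ f i
  ...   | x , _ , y≡fx = x , sym y≡fx
  surjective-of-length {A = A} _≟_ {xs} {ys} f uniq complete inj le y | no y∉ =
    contradiction
      (unique-⊆⇒length≤ {xs = y ∷ map f xs} {ys = ys}
        (All.tabulate (λ j y≡ → y∉ (subst (_∈ map f xs) (sym y≡) j)) ∷ Uniqueₚ.map⁺ inj uniq)
        (λ _ → complete _))
      (<⇒≱ (s≤s (≤-trans le (≤-reflexive (sym (length-map f xs))))))

  module _ {R : A → B → Set} (R? : ∀ a b → Dec (R a b)) where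

    ∑-count-swap : ∀ as bs → ∑ as (λ a → count (R? a) bs) ≡ ∑ bs (λ b → count (λ a → R? a b) as)
    ∑-count-swap [] bs = sym (zeros bs)
      where
      zeros : ∀ bs → ∑ bs (λ b → count (λ a → R? a b) []) ≡ 0
      zeros []       = refl
      zeros (_ ∷ bs) = zeros bs
    ∑-count-swap (a ∷ as) bs = trans (cong (count (R? a) bs +_) (∑-count-swap as bs)) (step bs)
      where
      column : B → ℕ
      column b = count (λ a → R? a b) as
      step : ∀ bs → count (R? a) bs + ∑ bs column ≡ ∑ bs (λ b → count (λ a → R? a b) (a ∷ as))
      step [] = refl
      step (b ∷ bs) with R? a b | trans (x∙yz≈y∙xz (count (R? a) bs) (column b) (∑ bs column)) (cong (column b +_) (step bs))
      ... | yes _ | eq = cong suc eq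
      ... | no _  | eq = eq

  ∑-cong : (xs : List A) {f g : A → ℕ} → (∀ {x} → x ∈ xs → f x ≡ g x) → ∑ xs f ≡ ∑ xs g
  ∑-cong [] _ = refl
  ∑-cong (x ∷ xs) eq = cong₂ _+_ (eq (here refl)) (∑-cong xs (eq ∘ there))

  ∑-ones : (xs : List A) {f : A → ℕ} → (∀ {x} → x ∈ xs → f x ≡ 1) → ∑ xs f ≡ length xs
  ∑-ones [] _ = refl
  ∑-ones (x ∷ xs) one = cong₂ _+_ (one (here refl)) (∑-ones xs (one ∘ there))

  ∑-≤1 : (xs : List A) {f : A → ℕ} → (∀ {x} → x ∈ xs → f x ≤ 1) → ∑ xs f ≤ length xs
  ∑-≤1 [] _ = z≤n
  ∑-≤1 (x ∷ xs) le = +-mono-≤ (le (here refl)) (∑-≤1 xs (le ∘ there))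

  -- Turns "at most one root per plane" into "exactly one" once the total number of roots is known
  -- to equal the number of planes.
  ∑-≤1-tight : (xs : List A) {f : A → ℕ} → (∀ {x} → x ∈ xs → f x ≤ 1) → ∑ xs f ≡ length xs →
    ∀ {x} → x ∈ xs → f x ≡ 1
  ∑-≤1-tight (x ∷ xs) {f} le eq i with f x in fx≡ | le (here refl)
  ∑-≤1-tight (x ∷ xs) {f} le eq i | 0 | _ =
    contradiction (subst (_≤ length xs) eq (∑-≤1 xs (le ∘ there))) 1+n≰n
  ∑-≤1-tight (x ∷ xs) {f} le eq (here refl) | 1 | _ = fx≡
  ∑-≤1-tight (x ∷ xs) {f} le eq (there i) | 1 | _ = ∑-≤1-tight xs (le ∘ there) (suc-injective eq) i
  ∑-≤1-tight (x ∷ xs) {f} le eq i | suc (suc _) | s≤s ()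

  ∑-0or3 : (xs : List A) {f : A → ℕ} → (∀ {x} → x ∈ xs → f x ≡ 0 ⊎ f x ≡ 3) →
    ∑ xs f ≡ 3 * count (λ x → f x ≟ 3) xs
  ∑-0or3 [] _ = refl
  ∑-0or3 (x ∷ xs) {f} or with f x | f x ≟ 3 | or (here refl) | ∑-0or3 xs (or ∘ there)
  ... | _ | yes refl | _         | ih = trans (cong (3 +_) ih) (sym (*-suc 3 _))
  ... | _ | no ≢3    | inj₁ refl | ih = ih
  ... | _ | no ≢3    | inj₂ refl | ih = contradiction refl ≢3

  count-one : {P : A → Set} (P? : Decidable P) {R : A → A → Set} {xs : List A} → AllPairs (λ x y → ¬ R x y) xs →
    Any P xs → (∀ {x y} → x ∈ xs → y ∈ xs → P x → P y → R x y) → count P? xs ≡ 1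
  count-one {P = P} P? {xs = x ∷ xs} (sep ∷ seps) any same with P? x
  ... | yes px = cong suc (none xs sep (λ y∈ → same (here refl) (there y∈) px))
    where
    none : ∀ {S : _ → Set} ys → All (λ y → ¬ S y) ys → (∀ {y} → y ∈ ys → P y → S y) → count P? ys ≡ 0
    none [] _ _ = refl
    none (y ∷ ys) (¬s ∷ ¬ss) sm with P? y
    ... | yes py = contradiction (sm (here refl) py) ¬s
    ... | no _   = none ys ¬ss (sm ∘ there)
  count-one P? (sep ∷ seps) (here px) same | no ¬px = contradiction px ¬px
  count-one P? (sep ∷ seps) (there any) same | no ¬px =
    count-one P? seps any (λ i j → same (there i) (there j))

  module _ (_≟_ : DecidableEquality B) (f : A → B)
           (fibres : ∀ {x y z} → f x ≡ f y → f y ≡ f z → x ≡ y ⊎ y ≡ z ⊎ x ≡ z) where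

    private
      fibre≤2 : ∀ b {xs : List A} → Unique xs → All (λ x → f x ≡ b) xs → length xs ≤ 2
      fibre≤2 b {[]} _ _ = z≤n
      fibre≤2 b {_ ∷ []} _ _ = s≤s z≤n
      fibre≤2 b {_ ∷ _ ∷ []} _ _ = s≤s (s≤s z≤n)
      fibre≤2 b {x ∷ y ∷ z ∷ _} ((x≢y ∷ x≢z ∷ _) ∷ (y≢z ∷ _) ∷ _) (p ∷ p′ ∷ p″ ∷ _)
        with fibres (trans p (sym p′)) (trans p′ (sym p″))
      ... | inj₁ e        = contradiction e x≢y
      ... | inj₂ (inj₁ e) = contradiction e y≢z
      ... | inj₂ (inj₂ e) = contradiction e x≢z

    -- Induction on the codomain, removing the whole fibre over its head at each stage.
    fibres≤2⇒length≤ : ∀ {xs} ys → Unique xs → All (λ x → f x ∈ ys) xs → length xs ≤ 2 * length ys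
    fibres≤2⇒length≤ {[]} [] _ _ = z≤n
    fibres≤2⇒length≤ {_ ∷ _} [] _ (() ∷ _)
    fibres≤2⇒length≤ {xs} (y ∷ ys) uniq into = begin
      length xs                                     ≡⟨ count-split (λ x → f x ≟ y) xs ⟨
      count (λ x → f x ≟ y) xs + length rest         ≤⟨ +-mono-≤
        (fibre≤2 y (Uniqueₚ.filter⁺ (λ x → f x ≟ y) uniq) (Allₚ.all-filter (λ x → f x ≟ y) xs))
        (fibres≤2⇒length≤ ys (Uniqueₚ.filter⁺ (λ x → ¬? (f x ≟ y)) uniq) (All.tabulate into′)) ⟩
      2 + 2 * length ys                             ≡⟨ *-suc 2 (length ys) ⟨
      2 * length (y ∷ ys)                           ∎
      where
      open ≤-Reasoning
      rest : List A
      rest = filter (λ x → ¬? (f x ≟ y)) xs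
      into′ : ∀ {x} → x ∈ rest → f x ∈ ys
      into′ i with ∈-filter⁻ (λ x → ¬? (f x ≟ y)) i
      ... | j , fx≢y with All.lookup into j
      ...   | here fx≡y = contradiction fx≡y fx≢y
      ...   | there k   = k

  module _ (_≟_ : DecidableEquality A) (σ : A → A) where

    private
      Orbit : A → A → Set
      Orbit x y = y ∈ x ∷ σ x ∷ σ (σ x) ∷ []
      orbit? : ∀ x y → Dec (Orbit x y)
      orbit? x y = any? (y ≟_) _

    -- Orbits of three elements are removed one at a time. What remains is again closed under `σ`,
    -- because `σ` is undone by applying it twice more (`back`). The bound `n` drives the recursion,
    -- as the filtered list is not a structural part of the original.
    fixpoint-free-order-3 : ∀ n (xs : List A) → length xs ≤ n → Unique xs →
      (∀ {x} → x ∈ xs → σ x ∈ xs) → (∀ {x} → x ∈ xs → σ (σ (σ x)) ≡ x) →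
      (∀ {x} → x ∈ xs → σ x ≢ x) → 3 ∣ length xs
    fixpoint-free-order-3 _ [] _ _ _ _ _ = 3 ∣0
    fixpoint-free-order-3 (suc n) xs@(x ∷ xs′) (s≤s le) uniq closed cube free =
      subst (3 ∣_) (count-split (orbit? x) xs)
        (∣m∣n⇒∣m+n (subst (3 ∣_) (sym orbit-size) ∣-refl)
          (fixpoint-free-order-3 n rest rest≤ (Uniqueₚ.filter⁺ (¬? ∘ orbit? x) uniq)
            rest-closed (cube ∘ rest⊆) (free ∘ rest⊆)))
      where
      rest : List A
      rest = filter (¬? ∘ orbit? x) xs
      rest⊆ : ∀ {y} → y ∈ rest → y ∈ xs
      rest⊆ i = proj₁ (∈-filter⁻ (¬? ∘ orbit? x) i)
      x∈ : x ∈ xs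
      x∈ = here refl
      ≢₁ : σ x ≢ x
      ≢₁ = free x∈
      ≢₂ : σ (σ x) ≢ σ x
      ≢₂ = free (closed x∈)
      ≢₃ : x ≢ σ (σ x)
      ≢₃ e = free (closed (closed x∈)) (trans (cube x∈) e)
      orbit-size : count (orbit? x) xs ≡ 3
      orbit-size = count-exactly (orbit? x) uniq
        ((≢₁ ∘ sym ∷ ≢₃ ∷ []) ∷ (≢₂ ∘ sym ∷ []) ∷ [] ∷ [])
        (λ i → orbit⊆ i , i) (λ _ → id)
        where
        orbit⊆ : ∀ {y} → Orbit x y → y ∈ xs
        orbit⊆ (here refl)                 = x∈
        orbit⊆ (there (here refl))         = closed x∈
        orbit⊆ (there (there (here refl))) = closed (closed x∈)
      rest≤ : length rest ≤ n
      rest≤ = ≤-trans (≤-reflexive (cong length (filter-reject (¬? ∘ orbit? x) (λ ¬o → ¬o (here refl)))))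
        (≤-trans (Data.List.Properties.length-filter (¬? ∘ orbit? x) xs′) le)
      back : ∀ {y} → y ∈ xs → Orbit x (σ y) → Orbit x y
      back i (here e)                 = there (there (here (trans (sym (cube i)) (cong (σ ∘ σ) e))))
      back i (there (here e))         = here (trans (sym (cube i)) (trans (cong (σ ∘ σ) e) (cube x∈)))
      back i (there (there (here e))) = there (here (trans (sym (cube i)) (trans (cong (σ ∘ σ) e) (cong σ (cube x∈)))))
      rest-closed : ∀ {y} → y ∈ rest → σ y ∈ rest
      rest-closed i = let (j , ¬o) = ∈-filter⁻ (¬? ∘ orbit? x) i in
        ∈-filter⁺ (¬? ∘ orbit? x) (closed j) (¬o ∘ back j)

  witnesses : {P : A → Set} → Decidable P → List A → List (∃ P)
  witnesses P? [] = []
  witnesses P? (x ∷ xs) with P? x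
  ... | yes p = (x , p) ∷ witnesses P? xs
  ... | no _  = witnesses P? xs

  -- The stored proof may differ from the given one, so membership is claimed only for some proof of
  -- `P x`.
  ∈-witnesses : {P : A → Set} (P? : Decidable P) {xs : List A} {x : A} → x ∈ xs → P x → ∃ λ p → (x , p) ∈ witnesses P? xs
  ∈-witnesses P? {x ∷ xs} (here refl) p with P? x
  ... | yes p′ = p′ , here refl
  ... | no ¬p  = contradiction p ¬p
  ∈-witnesses P? {x ∷ xs} (there i) p with P? x | ∈-witnesses P? i p
  ... | yes _ | p′ , j = p′ , there j
  ... | no _  | p′ , j = p′ , j

  module _ {R : A → A → Set} (R? : ∀ x y → Dec (R x y)) (R-refl : ∀ x → R x x) where

    -- `Card` asks for pairwise inequivalent elements, whereas a list of axes names the same line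
    -- repeatedly, for instance by `(Γ u , Γ v)` and `(Γ v , Γ u)`.
    representatives : (xs : List A) → ∃ λ ys →
      (∀ {y} → y ∈ ys → y ∈ xs) × AllPairs (λ x y → ¬ R x y) ys × (∀ {x} → x ∈ xs → Any (R x) ys)
    representatives [] = [] , id , [] , λ ()
    representatives (x ∷ xs) with representatives xs
    ... | ys , sub , sep , cover with any? (R? x) ys
    ...   | yes r = ys , there ∘ sub , sep , λ { (here refl) → r ; (there i) → cover i }
    ...   | no ¬r = x ∷ ys , (λ { (here refl) → here refl ; (there i) → there (sub i) })
                  , Allₚ.¬Any⇒All¬ ys ¬r ∷ sep
                  , λ { (here refl) → here (R-refl x) ; (there i) → there (cover i) }

  module _ {R : A → A → Set} {P : A → Set} where

    Card-resp : {Q : A → Set} → ∀ {n} → (∀ x → P x → Q x) → (∀ x → Q x → P x) → Card R P n → Card R Q n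
    Card-resp to from (xs , len , all , sep , cover) =
      xs , len , All.map (to _) all , sep , λ x q → cover x (from x q)

    Card-empty : (∀ x → ¬ P x) → Card R P 0
    Card-empty none = [] , refl , [] , [] , λ x p → contradiction p (none x)

    Card-filter : {Q : A → Set} (Q? : Decidable Q) → (∀ {x y} → P x → P y → R x y → Q x → Q y) → ∀ {n} ((xs , _) : Card R P n) →
      Card R (λ x → P x × Q x) (count Q? xs)
    Card-filter Q? resp (xs , _ , all , sep , cover) =
      filter Q? xs , refl , All.zip (Allₚ.filter⁺ Q? all , Allₚ.all-filter Q? xs) ,
      AllPairsₚ.filter⁺ Q? sep ,
      λ x (p , q) → let (y , i , r) = find (cover x p) in
        lose (∈-filter⁺ Q? i (resp p (All.lookup all i) r q)) r

  module _ {R : A → A → Set} {S : B → B → Set} {T : A → B → Set}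
           (R-resp : ∀ {x y b} → R x y → T x b → T y b)
           {P : A → Set} {Q : B → Set} {num den : ℕ}
           (slice : ∀ a → P a → ∃ λ k → Card S (λ b → Q b × T a b) k × den * k ≡ num) where

    private
      _~_ : A × B → A × B → Set
      f ~ g = R (proj₁ f) (proj₁ g) × S (proj₂ f) (proj₂ g)
      Flag : A × B → Set
      Flag f = P (proj₁ f) × Q (proj₂ f) × T (proj₁ f) (proj₂ f)

      -- The clause `proj₁ f ∈ as` strengthens the induction: the flags over a new element are
      -- inequivalent to the earlier ones because their first components are.
      flags : ∀ as → All P as → AllPairs (λ x y → ¬ R x y) as →
        ∃ λ fs → den * length fs ≡ num * length as × All Flag fs ×
          All (λ f → proj₁ f ∈ as) fs × AllPairs (λ f g → ¬ (f ~ g)) fs ×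
          (∀ a b → P a → Q b → T a b → Any (R a) as → Any ((a , b) ~_) fs)
      flags [] _ _ = [] , trans (*-zeroʳ den) (sym (*-zeroʳ num)) , [] , [] , [] , λ _ _ _ _ _ ()
      flags (a ∷ as) (pa ∷ pas) (sep ∷ seps)
        with slice a pa | flags as pas seps
      ... | k , (bs , len , allb , sepb , coverb) , eqk | fs , eqf , allf , sub , sepf , coverf =
        map (a ,_) bs ++ fs , eq ,
        Allₚ.++⁺ (Allₚ.map⁺ (All.map (λ (q , t) → pa , q , t) allb)) allf ,
        Allₚ.++⁺ (Allₚ.map⁺ (All.tabulate λ _ → here refl)) (All.map there sub) ,
        AllPairsₚ.++⁺ (AllPairsₚ.map⁺ (AllPairs.map (λ ¬s (_ , s) → ¬s s) sepb)) sepf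
          (Allₚ.map⁺ (All.tabulate λ _ → All.map (λ i (r , _) → All.lookup sep i r) sub)) ,
        cover
        where
        eq : den * length (map (a ,_) bs ++ fs) ≡ num * suc (length as)
        eq = begin
          den * length (map (a ,_) bs ++ fs)             ≡⟨ cong (den *_) (length-++ (map (a ,_) bs)) ⟩
          den * (length (map (a ,_) bs) + length fs)     ≡⟨ cong (λ z → den * (z + length fs)) (trans (length-map _ bs) len) ⟩
          den * (k + length fs)                          ≡⟨ *-distribˡ-+ den k _ ⟩
          den * k + den * length fs                      ≡⟨ cong₂ _+_ eqk eqf ⟩
          num + num * length as                          ≡⟨ *-suc num _ ⟨
          num * suc (length as)                          ∎
          where open ≡-Reasoning
        cover : ∀ a′ b → P a′ → Q b → T a′ b → Any (R a′) (a ∷ as) → Any ((a′ , b) ~_) (map (a ,_) bs ++ fs)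
        cover a′ b p q t (here r) = Anyₚ.++⁺ˡ (Anyₚ.map⁺ (Any.map (r ,_) (coverb b (q , R-resp r t))))
        cover a′ b p q t (there i) = Anyₚ.++⁺ʳ (map (a ,_) bs) (coverf a′ b p q t i)

    -- Each slice is constrained only by `den * k ≡ num`; summing this over the `n` classes yields
    -- the average without any division.
    Card-flags : ∀ {n} → Card R P n → ∃ λ m → Card _~_ Flag m × den * m ≡ num * n
    Card-flags (as , refl , all , sep , cover) with flags as all sep
    ... | fs , eq , allf , _ , sepf , coverf =
      length fs , (fs , refl , allf , sepf , λ (a , b) (p , q , t) → coverf a b p q t (cover a p)) , eq

open Counting

-- A ring solver with integer coefficients

module RingSolver {q : ℕ} (F : FiniteField q) where
  open FiniteField F
  open import Data.Integer.Base as ℤ using (ℤ; +_; -[1+_]; +[1+_])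
  import Data.Integer.Properties as ℤ

  commutativeRing : CommutativeRing 0ℓ 0ℓ
  commutativeRing = record { isCommutativeRing = isCommutativeRing }

  private
    module R = CommutativeRing commutativeRing
    almost : AlmostCommutativeRing 0ℓ 0ℓ
    almost = fromCommutativeRing commutativeRing

  open import Algebra.Properties.Ring R.ring
    using (-‿involutive; -‿distribˡ-*; -‿distribʳ-*; -0#≈0#; -‿+-comm)
  open import Algebra.Properties.Semiring.Mult.TCOptimised R.semiring
    using (×1-homo-*; ×-homo-+; 1+×) renaming (_×_ to _·_)

  private
    open ≡-Reasoning

    ⟦_⟧ℤ : ℤ → Carrier
    ⟦ + n ⟧ℤ      = n · 1#
    ⟦ -[1+ n ] ⟧ℤ = - (suc n · 1#)

    neg-homo : ∀ i → ⟦ ℤ.- i ⟧ℤ ≡ - ⟦ i ⟧ℤ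
    neg-homo (+ 0)    = sym -0#≈0#
    neg-homo +[1+ n ] = refl
    neg-homo -[1+ n ] = sym (-‿involutive _)

    ⊖-homo : ∀ m n → ⟦ m ℤ.⊖ n ⟧ℤ ≡ m · 1# + - (n · 1#)
    ⊖-homo m zero = begin
      m · 1#            ≡⟨ R.+-identityʳ _ ⟨
      m · 1# + 0#       ≡⟨ cong (λ z → m · 1# + z) -0#≈0# ⟨
      m · 1# + - 0#     ∎
    ⊖-homo zero (suc n) = sym (R.+-identityˡ _)
    ⊖-homo (suc m) (suc n) = begin
      ⟦ suc m ℤ.⊖ suc n ⟧ℤ                       ≡⟨ cong ⟦_⟧ℤ (ℤ.[1+m]⊖[1+n]≡m⊖n m n) ⟩
      ⟦ m ℤ.⊖ n ⟧ℤ                               ≡⟨ ⊖-homo m n ⟩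
      m · 1# + - (n · 1#)                        ≡⟨ cong (_+ - (n · 1#)) (sym (R.+-identityʳ _)) ⟩
      m · 1# + 0# + - (n · 1#)                   ≡⟨ cong (λ z → m · 1# + z + - (n · 1#)) (sym (R.-‿inverseʳ 1#)) ⟩
      m · 1# + (1# + - 1#) + - (n · 1#)          ≡⟨ cong (_+ - (n · 1#)) (sym (R.+-assoc _ _ _)) ⟩
      m · 1# + 1# + - 1# + - (n · 1#)            ≡⟨ R.+-assoc _ _ _ ⟩
      m · 1# + 1# + (- 1# + - (n · 1#))          ≡⟨ cong₂ _+_ (trans (R.+-comm _ _) (sym (1+× m 1#)))
                                                      (trans (-‿+-comm _ _) (cong -_ (sym (1+× n 1#)))) ⟩
      suc m · 1# + - (suc n · 1#)                ∎

    +-homo : ∀ i j → ⟦ i ℤ.+ j ⟧ℤ ≡ ⟦ i ⟧ℤ + ⟦ j ⟧ℤ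
    +-homo (+ m)    (+ n)    = ×-homo-+ 1# m n
    +-homo (+ m)    -[1+ n ] = ⊖-homo m (suc n)
    +-homo -[1+ m ] (+ n)    = trans (⊖-homo n (suc m)) (R.+-comm _ _)
    +-homo -[1+ m ] -[1+ n ] = begin
      - (suc (suc (m ℕ.+ n)) · 1#)               ≡⟨ cong (λ k → - (k · 1#)) (ℕ.+-suc (suc m) n) ⟨
      - ((suc m ℕ.+ suc n) · 1#)                 ≡⟨ cong -_ (×-homo-+ 1# (suc m) (suc n)) ⟩
      - (suc m · 1# + suc n · 1#)                ≡⟨ -‿+-comm _ _ ⟨
      - (suc m · 1#) + - (suc n · 1#)            ∎

    *-homo-+ : ∀ m j → ⟦ + m ℤ.* j ⟧ℤ ≡ m · 1# * ⟦ j ⟧ℤ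
    *-homo-+ m (+ n)    = trans (cong ⟦_⟧ℤ (sym (ℤ.pos-* m n))) (×1-homo-* m n)
    *-homo-+ m -[1+ n ] = begin
      ⟦ + m ℤ.* (ℤ.- (+ suc n)) ⟧ℤ   ≡⟨ cong ⟦_⟧ℤ (ℤ.neg-distribʳ-* (+ m) (+ suc n)) ⟨
      ⟦ ℤ.- (+ m ℤ.* + suc n) ⟧ℤ     ≡⟨ neg-homo (+ m ℤ.* + suc n) ⟩
      - ⟦ + m ℤ.* + suc n ⟧ℤ         ≡⟨ cong -_ (*-homo-+ m (+ suc n)) ⟩
      - (m · 1# * suc n · 1#)        ≡⟨ -‿distribʳ-* _ _ ⟩
      m · 1# * - (suc n · 1#)        ∎

    *-homo : ∀ i j → ⟦ i ℤ.* j ⟧ℤ ≡ ⟦ i ⟧ℤ * ⟦ j ⟧ℤ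
    *-homo (+ m)    j = *-homo-+ m j
    *-homo -[1+ m ] j = begin
      ⟦ (ℤ.- (+ suc m)) ℤ.* j ⟧ℤ     ≡⟨ cong ⟦_⟧ℤ (ℤ.neg-distribˡ-* (+ suc m) j) ⟨
      ⟦ ℤ.- (+ suc m ℤ.* j) ⟧ℤ       ≡⟨ neg-homo (+ suc m ℤ.* j) ⟩
      - ⟦ + suc m ℤ.* j ⟧ℤ           ≡⟨ cong -_ (*-homo-+ (suc m) j) ⟩
      - (suc m · 1# * ⟦ j ⟧ℤ)        ≡⟨ -‿distribˡ-* _ _ ⟩
      - (suc m · 1#) * ⟦ j ⟧ℤ        ∎

    ℤ-rawRing : RawRing 0ℓ 0ℓ
    ℤ-rawRing = ℤ.+-*-rawRing

    morphism : ℤ-rawRing -Raw-AlmostCommutative⟶ almost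
    morphism = record
      { ⟦_⟧ = ⟦_⟧ℤ ; +-homo = +-homo ; *-homo = *-homo ; -‿homo = neg-homo
      ; 0-homo = refl ; 1-homo = refl }

    coeff≟ : ∀ i j → Maybe (⟦ i ⟧ℤ ≡ ⟦ j ⟧ℤ)
    coeff≟ i j with i ℤ.≟ j
    ... | yes i≡j = just (cong ⟦_⟧ℤ i≡j)
    ... | no _    = nothing

  open import Algebra.Solver.Ring ℤ-rawRing almost morphism coeff≟ public
    using (Polynomial; con; _:+_; _:*_; :-_; _:-_; _:=_)
  open import Algebra.Solver.Ring ℤ-rawRing almost morphism coeff≟
    using (normalise; ⟦_⟧; ⟦_⟧N; var; correct)
  open import Relation.Binary.Reflection (setoid Carrier) var ⟦_⟧ (λ p → ⟦ normalise p ⟧N) correct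
    using (close)

  -- The integer normal forms are compared as closed data, which is much
  -- cheaper than comparing their values in an abstract field.
  solve : ∀ n (f : N-ary n (Polynomial n) (Polynomial n × Polynomial n)) →
    normalise (proj₁ (close n f)) ≡ normalise (proj₂ (close n f)) →
    Eq n _≡_ (curryⁿ ⟦ proj₁ (close n f) ⟧) (curryⁿ ⟦ proj₂ (close n f) ⟧)
  solve n f eq = curryⁿ-cong _≡_ ⟦ proj₁ (close n f) ⟧ ⟦ proj₂ (close n f) ⟧ λ ρ →
    trans (sym (correct (proj₁ (close n f)) ρ))
      (trans (cong (λ p → ⟦ p ⟧N ρ) eq) (correct (proj₂ (close n f)) ρ))

  -- These constants evaluate by computation to `0#`, `1#`, `1# + 1# + 1#` and `1# + 1# + 1# + 1#`,
  -- so `:3` stands for `three` without any conversion.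
  :0 :1 :3 :4 : ∀ {n} → Polynomial n
  :0 = con (+ 0)
  :1 = con (+ 1)
  :3 = con (+ 3)
  :4 = con (+ 4)

-- Field arithmetic

module FieldProperties {q : ℕ} (F : FiniteField q) where
  open FiniteField F
  open RingSolver F public
  private module R = CommutativeRing commutativeRing

  infix 8 _⁻¹
  _⁻¹ : Carrier → Carrier
  x ⁻¹ with x ≟ 0#
  -- A default value, which lets inverses occur in terms without a proof argument; `*-inverse` asks
  -- for `x ≢ 0#`.
  ... | yes _  = 0#
  ... | no x≢0 = proj₁ (inverse x x≢0)

  *-inverse : ∀ {x} → x ≢ 0# → x * x ⁻¹ ≡ 1#
  *-inverse {x} x≢0 with x ≟ 0#
  ... | yes x≡0 = contradiction x≡0 x≢0
  ... | no x≢0′ = proj₂ (inverse x x≢0′)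

  -- Used with a ring identity l ≡ r + Σ kᵢ * eᵢ, where the kᵢ are the cofactors that witness
  -- membership of l − r in the ideal generated by the hypotheses eᵢ ≡ 0#.
  modulo₁ : ∀ {l r e} k → e ≡ 0# → l ≡ r + k * e → l ≡ r
  modulo₁ k refl eq = trans eq (trans (cong (λ z → _ + z) (R.zeroʳ k)) (R.+-identityʳ _))

  modulo₂ : ∀ {l r e e′} k k′ → e ≡ 0# → e′ ≡ 0# → l ≡ r + k * e + k′ * e′ → l ≡ r
  modulo₂ k k′ e e′ eq = modulo₁ k e (modulo₁ k′ e′ eq)

  ≡⇒-≡0 : ∀ {x y} → x ≡ y → x + - y ≡ 0#
  ≡⇒-≡0 refl = R.-‿inverseʳ _

  -≡0⇒≡ : ∀ {x y} → x + - y ≡ 0# → x ≡ y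
  -≡0⇒≡ {x} {y} e = modulo₁ 1# e (solve 2 (λ x y → x := y :+ :1 :* (x :+ :- y)) refl x y)

  *-cancel-≡0 : ∀ {k x} → k ≢ 0# → k * x ≡ 0# → x ≡ 0#
  *-cancel-≡0 {k} {x} k≢0 e = modulo₂ (k ⁻¹) (- x) e (≡⇒-≡0 (*-inverse k≢0))
    (solve 3 (λ k x i → x := :0 :+ i :* (k :* x) :+ (:- x) :* (k :* i :+ :- :1)) refl k x (k ⁻¹))

  *-cancel : ∀ {k x y} → k ≢ 0# → k * x ≡ k * y → x ≡ y
  *-cancel {k} {x} {y} k≢0 e = -≡0⇒≡ (*-cancel-≡0 k≢0 (trans
    (solve 3 (λ k x y → k :* (x :+ :- y) := k :* x :+ :- (k :* y)) refl k x y) (≡⇒-≡0 e)))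

  *-≡0 : ∀ x {y} → x * y ≡ 0# → x ≡ 0# ⊎ y ≡ 0#
  *-≡0 x e with x ≟ 0#
  ... | yes x≡0 = inj₁ x≡0
  ... | no x≢0  = inj₂ (*-cancel-≡0 x≢0 e)

  *-≢0 : ∀ {x y} → x ≢ 0# → y ≢ 0# → x * y ≢ 0#
  *-≢0 x≢0 y≢0 = y≢0 ∘ *-cancel-≡0 x≢0

  -‿≢0 : ∀ {x} → x ≢ 0# → - x ≢ 0#
  -‿≢0 {x} x≢0 e = x≢0 (modulo₁ (- 1#) e (solve 1 (λ x → x := :0 :+ (:- :1) :* (:- x)) refl x))

  ⁻¹-≢0 : ∀ {x} → x ≢ 0# → x ⁻¹ ≢ 0#
  ⁻¹-≢0 {x} x≢0 e = 0≢1 (trans (sym (R.zeroʳ x)) (trans (cong (x *_) (sym e)) (*-inverse x≢0)))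

  any-element? : {P : Carrier → Set} → (∀ x → Dec (P x)) → Dec (∃ P)
  any-element? P? = map′ (λ i → let (x , _ , p) = find i in x , p)
    (λ (x , p) → lose (elements-complete x) p) (any? P? elements)

  three : Carrier
  three = 1# + 1# + 1#

  -- Its roots are the negatives of the roots of x² + x + 1. This sign fits both uses: the fixed
  -- points of x ↦ 1/(1 - x), and the quadratic form in `hess-factors`.
  Φ : Carrier → Carrier
  Φ x = x * x + - x + 1#

-- Roots of x² - x + 1 and the residue of q modulo 3

module SixthRoots {q : ℕ} (F : FiniteField q) (3∤q : ¬ (q % 3 ≡ 0)) where
  open FiniteField F
  open FieldProperties F

  private
    -- σ permutes F ∖ {0, 1} with order 3, and its fixed points are the roots of Φ; hence
    -- q − 2 is congruent modulo 3 to the number of roots of Φ.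
    σ : Carrier → Carrier
    σ x = (1# + - x) ⁻¹

    Generic : Carrier → Set
    Generic x = x ≢ 0# × x ≢ 1# × Φ x ≢ 0#

    generic? : ∀ x → Dec (Generic x)
    generic? x = ¬? (x ≟ 0#) ×-dec ¬? (x ≟ 1#) ×-dec ¬? (Φ x ≟ 0#)

    σ-inverse : ∀ {x} → x ≢ 1# → (1# + - x) * σ x + - 1# ≡ 0#
    σ-inverse x≢1 = ≡⇒-≡0 (*-inverse (x≢1 ∘ sym ∘ -≡0⇒≡))

    σ-generic : ∀ {x} → Generic x → Generic (σ x)
    σ-generic {x} (x≢0 , x≢1 , Φ≢0) = ⁻¹-≢0 (x≢1 ∘ sym ∘ -≡0⇒≡) , ≢1 , Φσ≢0
      where
      ≢1 : σ x ≢ 1#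
      ≢1 e = x≢0 (modulo₂ (- 1#) (1# + - x) (σ-inverse x≢1) (≡⇒-≡0 e)
        (solve 2 (λ x s → x := :0 :+ (:- :1) :* ((:1 :+ :- x) :* s :+ :- :1)
            :+ (:1 :+ :- x) :* (s :+ :- :1)) refl x (σ x)))
      -- Because `(1 − x)² Φ (σ x) = Φ x`.
      Φσ≢0 : Φ (σ x) ≢ 0#
      Φσ≢0 e = Φ≢0 (modulo₂ ((1# + - x) * (1# + - x)) (- ((1# + - x) * σ x) + - x) e (σ-inverse x≢1)
        (solve 2 (λ x s → x :* x :+ :- x :+ :1 := :0
            :+ (:1 :+ :- x) :* (:1 :+ :- x) :* (s :* s :+ :- s :+ :1)
            :+ (:- ((:1 :+ :- x) :* s) :+ :- x) :* ((:1 :+ :- x) :* s :+ :- :1))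
          refl x (σ x)))

    -- `σ z` is the inverse of `1 − z` by definition, and `xz` shows that `x` is an inverse of
    -- `1 − z` too.
    σ³ : ∀ {x} → Generic x → σ (σ (σ x)) ≡ x
    σ³ {x} g@(_ , x≢1 , _) = *-cancel 1-z≢0 (-≡0⇒≡ (modulo₂ 1# 1# (σ-inverse z≢1) xz
        (solve 3 (λ x z w → (:1 :+ :- z) :* w :+ :- ((:1 :+ :- z) :* x) := :0
          :+ :1 :* ((:1 :+ :- z) :* w :+ :- :1)
          :+ :1 :* (:1 :+ :- ((:1 :+ :- z) :* x))) refl x z (σ z))))
      where
      y z : Carrier
      y = σ x
      z = σ y
      gy : Generic y
      gy = σ-generic g
      z≢1 : z ≢ 1#
      z≢1 = proj₁ (proj₂ (σ-generic gy))
      1-z≢0 : 1# + - z ≢ 0#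
      1-z≢0 = z≢1 ∘ sym ∘ -≡0⇒≡
      xz : 1# + - ((1# + - z) * x) ≡ 0#
      xz = modulo₂ (- z) (- (1# + - x)) (σ-inverse x≢1) (σ-inverse (proj₁ (proj₂ gy)))
        (solve 3 (λ x y z → :1 :+ :- ((:1 :+ :- z) :* x) := :0
          :+ (:- z) :* ((:1 :+ :- x) :* y :+ :- :1)
          :+ (:- (:1 :+ :- x)) :* ((:1 :+ :- y) :* z :+ :- :1)) refl x y z)

    σ-free : ∀ {x} → Generic x → σ x ≢ x
    σ-free {x} (_ , x≢1 , Φ≢0) e = Φ≢0 (modulo₂ (- 1#) (1# + - x) (σ-inverse x≢1) (≡⇒-≡0 e)
      (solve 2 (λ x s → x :* x :+ :- x :+ :1 := :0
        :+ (:- :1) :* ((:1 :+ :- x) :* s :+ :- :1)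
        :+ (:1 :+ :- x) :* (s :+ :- x)) refl x (σ x)))

    3∣generic : 3 ∣ count generic? elements
    3∣generic = fixpoint-free-order-3 _≟_ σ _ (filter generic? elements) ℕ.≤-refl
      (Uniqueₚ.filter⁺ generic? elements-unique)
      (λ i → ∈-filter⁺ generic? (elements-complete _) (σ-generic (gen i)))
      (σ³ ∘ gen) (σ-free ∘ gen)
      where
      gen : ∀ {x} → x ∈ filter generic? elements → Generic x
      gen i = proj₂ (∈-filter⁻ generic? {xs = elements} i)

    -- Applied with three lists of non-generic elements: 0, 1, -1 when 3 = 0; 0, 1, ρ, 1 - ρ when
    -- `Φ` has a root ρ; and 0, 1 when it has none. Their lengths are the residues 0, 1 and 2.
    q-mod-3 : ∀ {ys} → Unique ys → (∀ {x} → x ∈ ys → ¬ Generic x) → (∀ x → ¬ Generic x → x ∈ ys) →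
      q % 3 ≡ length ys % 3
    q-mod-3 {ys} uniq into onto = trans (cong (λ n → n % 3) q≡) ([m+kn]%n≡m%n (length ys) k 3)
      where
      open _∣_ 3∣generic renaming (quotient to k; equality to eq)
      special : count (λ x → ¬? (generic? x)) elements ≡ length ys
      special = count-exactly (λ x → ¬? (generic? x)) elements-unique uniq
        (λ i → elements-complete _ , into i) (λ {x} _ → onto x)
      q≡ : q ≡ length ys ℕ.+ k ℕ.* 3
      q≡ = trans (sym elements-length) (trans (sym (count-split generic? elements))
        (trans (cong₂ ℕ._+_ eq special) (ℕ.+-comm (k ℕ.* 3) (length ys))))

    not-generic : ∀ x → ¬ Generic x → x ≡ 0# ⊎ x ≡ 1# ⊎ Φ x ≡ 0#
    not-generic x ¬g with x ≟ 0# | x ≟ 1# | Φ x ≟ 0#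
    ... | yes e | _     | _     = inj₁ e
    ... | no _  | yes e | _     = inj₂ (inj₁ e)
    ... | no _  | no _  | yes e = inj₂ (inj₂ e)
    ... | no a  | no b  | no c  = contradiction (a , b , c) ¬g

    Φ0≢0 : Φ 0# ≢ 0#
    Φ0≢0 e = 0≢1 (trans (sym e) (solve 0 (:0 :* :0 :+ :- :0 :+ :1 := :1) refl))

    Φ1≢0 : Φ 1# ≢ 0#
    Φ1≢0 e = 0≢1 (trans (sym e) (solve 0 (:1 :* :1 :+ :- :1 :+ :1 := :1) refl))

  -- If 3 = 0 then `Φ x = (x + 1)²`, so -1 is the only root of `Φ` and q would be divisible by 3.
  three≢0 : three ≢ 0#
  three≢0 3≡0 = 3∤q (q-mod-3 {0# ∷ 1# ∷ - 1# ∷ []}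
    ((0≢1 ∷ (-‿≢0 (0≢1 ∘ sym) ∘ sym) ∷ []) ∷ (1≢-1 ∷ []) ∷ [] ∷ [])
    (λ { (here refl) (a , _) → a refl ; (there (here refl)) (_ , b , _) → b refl
       ; (there (there (here refl))) (_ , _ , c) → c (trans (solve 0 ((:- :1) :* (:- :1) :+ :- (:- :1) :+ :1 := :3) refl) 3≡0) })
    (λ x ¬g → [ here , [ there ∘ here , there ∘ there ∘ here ∘ root x ]′ ]′ (not-generic x ¬g)))
    where
    1≢-1 : 1# ≢ - 1#
    1≢-1 e = 0≢1 (modulo₂ (- 1#) 1# 3≡0 (≡⇒-≡0 e) (solve 0 (:0 := :1 :+ (:- :1) :* :3
      :+ :1 :* (:1 :+ :- (:- :1))) refl))
    root : ∀ x → Φ x ≡ 0# → x ≡ - 1#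
    root x e = -≡0⇒≡ ([ id , id ]′ (*-≡0 (x + - - 1#) (modulo₂ 1# x e 3≡0
      (solve 1 (λ x → (x :+ :- (:- :1)) :* (x :+ :- (:- :1)) := :0
        :+ :1 :* (x :* x :+ :- x :+ :1) :+ x :* :3) refl x))))

  sixth-root⇒q≡1 : ∀ {ρ} → Φ ρ ≡ 0# → q % 3 ≡ 1
  sixth-root⇒q≡1 {ρ} e = q-mod-3 {0# ∷ 1# ∷ ρ ∷ 1# + - ρ ∷ []}
    ((0≢1 ∷ (λ { refl → Φ0≢0 e }) ∷ (λ e′ → Φ0≢0 (trans (cong Φ e′) Φ1-ρ)) ∷ [])
      ∷ ((λ { refl → Φ1≢0 e }) ∷ (λ e′ → Φ1≢0 (trans (cong Φ e′) Φ1-ρ)) ∷ []) ∷ (ρ≢ ∷ []) ∷ [] ∷ [])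
    (λ { (here refl) (a , _) → a refl ; (there (here refl)) (_ , b , _) → b refl
       ; (there (there (here refl))) (_ , _ , c) → c e
       ; (there (there (there (here refl)))) (_ , _ , c) → c Φ1-ρ })
    (λ x ¬g → [ here , [ there ∘ here , there ∘ there ∘ root x ]′ ]′ (not-generic x ¬g))
    where
    Φ1-ρ : Φ (1# + - ρ) ≡ 0#
    Φ1-ρ = trans (solve 1 (λ r → (:1 :+ :- r) :* (:1 :+ :- r) :+ :- (:1 :+ :- r) :+ :1
      := r :* r :+ :- r :+ :1) refl ρ) e
    -- The discriminant of `Φ` is -3: `3 = 4 Φ ρ − (1 − 2ρ)²`.
    ρ≢ : ρ ≢ 1# + - ρ
    ρ≢ e′ = three≢0 (modulo₂ (1# + 1# + 1# + 1#) (1# + - (ρ + ρ)) e (≡⇒-≡0 e′)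
      (solve 1 (λ r → :3 := :0 :+ :4 :* (r :* r :+ :- r :+ :1)
        :+ (:1 :+ :- (r :+ r)) :* (r :+ :- (:1 :+ :- r))) refl ρ))
    root : ∀ x → Φ x ≡ 0# → x ∈ ρ ∷ 1# + - ρ ∷ []
    root x e′ with *-≡0 (x + - ρ) (modulo₂ 1# (- 1#) e′ e
      (solve 2 (λ x r → (x :+ :- r) :* (x :+ :- (:1 :+ :- r)) := :0
        :+ :1 :* (x :* x :+ :- x :+ :1) :+ (:- :1) :* (r :* r :+ :- r :+ :1)) refl x ρ))
    ... | inj₁ z = here (-≡0⇒≡ z)
    ... | inj₂ z = there (here (-≡0⇒≡ z))

  no-sixth-root⇒q≡2 : (∀ ρ → Φ ρ ≢ 0#) → q % 3 ≡ 2
  no-sixth-root⇒q≡2 none = q-mod-3 {0# ∷ 1# ∷ []} ((0≢1 ∷ []) ∷ [] ∷ [])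
    (λ { (here refl) (a , _) → a refl ; (there (here refl)) (_ , b , _) → b refl })
    (λ x ¬g → [ here , [ there ∘ here , (λ e → contradiction e (none x)) ]′ ]′ (not-generic x ¬g))

  q≡1⇒sixth-root : q % 3 ≡ 1 → ∃ λ ρ → Φ ρ ≡ 0#
  q≡1⇒sixth-root q≡1 with any-element? (λ x → Φ x ≟ 0#)
  ... | yes r = r
  ... | no ¬r = contradiction (trans (sym q≡1) (no-sixth-root⇒q≡2 λ ρ e → ¬r (ρ , e))) λ ()

  q≡2⇒no-sixth-root : q % 3 ≡ 2 → ∀ ρ → Φ ρ ≢ 0#
  q≡2⇒no-sixth-root q≡2 ρ e = contradiction (trans (sym q≡2) (sixth-root⇒q≡1 e)) λ ()

-- Irreducible quadratics and their norm forms

module Quadratics {q : ℕ} (F : FiniteField q) where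
  open FiniteField F
  open FieldProperties F

  -- Irreducibility of t² - c t + d, in a form that makes sense in every characteristic.
  Rootless : Carrier → Carrier → Set
  Rootless c d = ∀ t → t * t + - (c * t) + d ≢ 0#

  pairs : List (Carrier × Carrier)
  pairs = cartesianProduct elements elements

  pairs-unique : Unique pairs
  pairs-unique = Uniqueₚ.cartesianProduct⁺ elements-unique elements-unique

  pairs-complete : ∀ z → z ∈ pairs
  pairs-complete (x , y) = ∈-cartesianProduct⁺ (elements-complete x) (elements-complete y)

  pairs-length : length pairs ≡ q ℕ.* q
  pairs-length = trans (length-cartesianProduct elements elements) (cong₂ ℕ._*_ elements-length elements-length)

  _≟²_ : DecidableEquality (Carrier × Carrier)
  _≟²_ = ≡-dec _≟_ _≟_

  -- trace and norm of x + y ε, where ε² = c ε − d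
  module Norm (c d : Carrier) (rootless : Rootless c d) where

    tr nm : Carrier × Carrier → Carrier
    tr (x , y) = x + x + c * y
    nm (x , y) = x * x + c * (x * y) + d * (y * y)

    conj : Carrier × Carrier → Carrier × Carrier
    conj (x , y) = x + c * y , - y

    -- For `y ≠ 0` the norm is `y²` times the value of t² - c t + d at `− x / y`.
    nm-anisotropic : ∀ x y → nm (x , y) ≡ 0# → x ≡ 0# × y ≡ 0#
    nm-anisotropic x y e with y ≟ 0#
    ... | yes refl = [ id , id ]′ (*-≡0 x (modulo₁ 1# e
      (solve 3 (λ x c d → x :* x := :0 :+ :1 :* (x :* x :+ c :* (x :* :0) :+ d :* (:0 :* :0))) refl x c d))) , refl
    ... | no y≢0 = contradiction (*-cancel-≡0 (*-≢0 y≢0 y≢0) (modulo₂ 1# (x * x * (y * y ⁻¹ + 1#) + c * x * y) e (≡⇒-≡0 (*-inverse y≢0))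
      (solve 5 (λ x y i c d → y :* y :* ((:- (x :* i)) :* (:- (x :* i)) :+ :- (c :* (:- (x :* i))) :+ d)
        := :0 :+ :1 :* (x :* x :+ c :* (x :* y) :+ d :* (y :* y))
          :+ (x :* x :* (y :* i :+ :1) :+ c :* x :* y) :* (y :* i :+ :- :1)) refl x y (y ⁻¹) c d)))
      (rootless (- (x * y ⁻¹)))

    -- An element of F[ε] goes to its characteristic polynomial, a pair of elements of F to the
    -- polynomial with these two roots; a polynomial t² - a t + b is recorded as `(a , b)`.
    split : (Carrier × Carrier) ⊎ (Carrier × Carrier) → Carrier × Carrier
    split (inj₁ z)       = tr z , nm z
    split (inj₂ (u , v)) = u + v , u * v

    private
      -- In F[ε] one has `(z − z′)(z − conj z′) = z² − tr z′ z + nm z′ = δ z − η`, where δ and η are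
      -- the differences of the traces and of the norms. Taking norms gives the identity used here.
      norm-norm : ∀ z z′ → split (inj₁ z) ≡ split (inj₁ z′) → z ≡ z′ ⊎ z ≡ conj z′
      norm-norm z@(x , y) z′@(x′ , y′) e =
        [ (λ e₁ → inj₁ (let (a , b) = nm-anisotropic _ _ e₁ in cong₂ _,_ (-≡0⇒≡ a) (-≡0⇒≡ b)))
        , (λ e₂ → inj₂ (let (a , b) = nm-anisotropic _ _ e₂ in cong₂ _,_ (-≡0⇒≡ a) (-≡0⇒≡ b))) ]′
        (*-≡0 (nm (x + - x′ , y + - y′)) {nm (x + - (x′ + c * y′) , y + - (- y′))}
          (modulo₂ ((tr z + - tr z′) * nm z + - ((nm z + - nm z′) * tr z)) (nm z + - nm z′)
            (≡⇒-≡0 (cong proj₁ e)) (≡⇒-≡0 (cong proj₂ e))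
            (solve 6 (λ x y x′ y′ c d →
              let n a b = a :* a :+ c :* (a :* b) :+ d :* (b :* b)
                  t a b = a :+ a :+ c :* b
              in n (x :+ :- x′) (y :+ :- y′) :* n (x :+ :- (x′ :+ c :* y′)) (y :+ :- (:- y′))
                := :0 :+ ((t x y :+ :- t x′ y′) :* n x y :+ :- ((n x y :+ :- n x′ y′) :* t x y)) :* (t x y :+ :- t x′ y′)
                  :+ (n x y :+ :- n x′ y′) :* (n x y :+ :- n x′ y′)) refl x y x′ y′ c d)))

      split-split : ∀ w w′ → split (inj₂ w) ≡ split (inj₂ w′) → w ≡ w′ ⊎ w ≡ swap w′
      split-split (u , v) (u′ , v′) e =
        [ (λ a → inj₁ (cong₂ _,_ (-≡0⇒≡ a) (modulo₂ 1# (- 1#) (≡⇒-≡0 (cong proj₁ e)) a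
          (solve 4 (λ u v u′ v′ → v := v′ :+ :1 :* (u :+ v :+ :- (u′ :+ v′)) :+ (:- :1) :* (u :+ :- u′)) refl u v u′ v′))))
        , (λ a → inj₂ (cong₂ _,_ (-≡0⇒≡ a) (modulo₂ 1# (- 1#) (≡⇒-≡0 (cong proj₁ e)) a
          (solve 4 (λ u v u′ v′ → v := u′ :+ :1 :* (u :+ v :+ :- (u′ :+ v′)) :+ (:- :1) :* (u :+ :- v′)) refl u v u′ v′)))) ]′
        (*-≡0 (u + - u′) {u + - v′} (modulo₂ u (- 1#) (≡⇒-≡0 (cong proj₁ e)) (≡⇒-≡0 (cong proj₂ e))
          (solve 4 (λ u v u′ v′ → (u :+ :- u′) :* (u :+ :- v′) := :0 :+ u :* (u :+ v :+ :- (u′ :+ v′))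
            :+ (:- :1) :* (u :* v :+ :- (u′ :* v′))) refl u v u′ v′)))

      -- The norm of `z − u` is the characteristic polynomial of `z` evaluated at `u`, hence zero.
      -- So `z = u` lies in F, and comparing traces gives `v = u`.
      norm-split : ∀ z w → split (inj₁ z) ≡ split (inj₂ w) → z ≡ (proj₁ w , 0#) × w ≡ (proj₁ w , proj₁ w)
      norm-split (x , y) (u , v) e =
        let (a , b) = nm-anisotropic (x + - u) y (modulo₂ (- u) 1# (≡⇒-≡0 (cong proj₁ e)) (≡⇒-≡0 (cong proj₂ e))
              (solve 6 (λ x y u v c d →
                let n a b = a :* a :+ c :* (a :* b) :+ d :* (b :* b)
                in n (x :+ :- u) y := :0 :+ (:- u) :* (x :+ x :+ c :* y :+ :- (u :+ v)) :+ :1 :* (n x y :+ :- (u :* v)))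
                refl x y u v c d))
            v≡u = modulo₂ 1# c (modulo₂ (- 1#) (1# + 1#) (≡⇒-≡0 (cong proj₁ e)) a
              (solve 5 (λ x y u v c → v :+ :- u :+ :- (c :* y) := :0 :+ (:- :1) :* (x :+ x :+ c :* y :+ :- (u :+ v))
                :+ (:1 :+ :1) :* (x :+ :- u)) refl x y u v c)) b
              (solve 4 (λ u v c y → v := u :+ :1 :* (v :+ :- u :+ :- (c :* y)) :+ c :* y) refl u v c y)
        in cong₂ _,_ (-≡0⇒≡ a) b , cong (u ,_) v≡u

      norm-splits : ∀ z w w′ → split (inj₁ z) ≡ split (inj₂ w) → split (inj₁ z) ≡ split (inj₂ w′) → w ≡ w′
      norm-splits z w w′ e e′ =
        let (p , r) = norm-split z w e
            (p′ , r′) = norm-split z w′ e′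
            u≡ = cong proj₁ (trans (sym p) p′)
        in trans r (trans (cong₂ _,_ u≡ u≡) (sym r′))

      conj² : ∀ {z z′ z″} → z ≡ conj z′ → z′ ≡ conj z″ → z ≡ z″
      conj² {z″ = x , y} refl refl = cong₂ _,_
        (solve 3 (λ x y c → x :+ c :* y :+ c :* (:- y) := x) refl x y c)
        (solve 1 (λ y → :- (:- y) := y) refl y)

      -- A fibre lies in a conjugate pair, in a swapped pair, or, for a polynomial with double root
      -- u, consists of `(u , 0#)` on the left and `(u , u)` on the right.
      fibres : ∀ {a b c} → split a ≡ split b → split b ≡ split c → a ≡ b ⊎ b ≡ c ⊎ a ≡ c
      fibres {inj₁ a} {inj₁ b} {inj₁ c} e e′ =
        [ inj₁ ∘ cong inj₁ , (λ p → [ inj₂ ∘ inj₁ ∘ cong inj₁ , (λ p′ → inj₂ (inj₂ (cong inj₁ (conj² p p′)))) ]′ (norm-norm b c e′)) ]′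
        (norm-norm a b e)
      fibres {inj₂ a} {inj₂ b} {inj₂ c} e e′ =
        [ inj₁ ∘ cong inj₂ , (λ p → [ inj₂ ∘ inj₁ ∘ cong inj₂ , (λ p′ → inj₂ (inj₂ (cong inj₂ (trans p (cong swap p′))))) ]′ (split-split b c e′)) ]′
        (split-split a b e)
      fibres {inj₁ a} {inj₁ b} {inj₂ c} e e′ = inj₁ (cong inj₁ (trans (proj₁ (norm-split a c (trans e e′))) (sym (proj₁ (norm-split b c e′)))))
      fibres {inj₁ a} {inj₂ b} {inj₁ c} e e′ = inj₂ (inj₂ (cong inj₁ (trans (proj₁ (norm-split a b e)) (sym (proj₁ (norm-split c b (sym e′)))))))
      fibres {inj₂ a} {inj₁ b} {inj₁ c} e e′ = inj₂ (inj₁ (cong inj₁ (trans (proj₁ (norm-split b a (sym e))) (sym (proj₁ (norm-split c a (sym (trans e e′))))))))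
      fibres {inj₂ a} {inj₂ b} {inj₁ c} e e′ = inj₁ (cong inj₂ (norm-splits c a b (sym (trans e e′)) (sym e′)))
      fibres {inj₂ a} {inj₁ b} {inj₂ c} e e′ = inj₂ (inj₂ (cong inj₂ (norm-splits b a c (sym e) e′)))
      fibres {inj₁ a} {inj₂ b} {inj₂ c} e e′ = inj₂ (inj₁ (cong inj₂ (norm-splits a b c e (trans e e′))))

      sources : List ((Carrier × Carrier) ⊎ (Carrier × Carrier))
      sources = map inj₁ pairs ++ map inj₂ pairs

      sources-unique : Unique sources
      sources-unique = Uniqueₚ.++⁺ (Uniqueₚ.map⁺ inj₁-injective pairs-unique) (Uniqueₚ.map⁺ inj₂-injective pairs-unique)
        λ (i , j) → disjoint (∈-map⁻ inj₁ i) (∈-map⁻ inj₂ j)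
        where
        disjoint : ∀ {w} → (∃ λ z → z ∈ pairs × w ≡ inj₁ z) → (∃ λ z → z ∈ pairs × w ≡ inj₂ z) → _
        disjoint (_ , _ , refl) (_ , _ , ())

      sources-length : length sources ≡ 2 ℕ.* length pairs
      sources-length = trans (length-++ (map inj₁ pairs))
        (cong₂ ℕ._+_ (length-map inj₁ pairs) (trans (length-map inj₂ pairs) (sym (ℕ.+-identityʳ _))))

    -- The map split has fibres of size at most 2 and its domain is exactly twice as large as
    -- its codomain.  Hence a monic quadratic t² − a t + b that does not split
    -- over F is the characteristic polynomial of some x + y ε.
    split-surjective : ∀ ab → ∃ λ z → split z ≡ ab
    split-surjective ab with any? (λ z → split z ≟² ab) sources
    ... | yes i = let (z , _ , p) = Data.List.Membership.Propositional.find i in z , p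
    ... | no ¬i = contradiction (fibres≤2⇒length≤ _≟²_ split fibres others sources-unique (All.tabulate hits))
      (ℕ.<⇒≱ (ℕ.<-≤-trans (ℕ.*-monoʳ-< 2 (filter-notAll (λ w → ¬? (w ≟² ab)) pairs (lose (pairs-complete ab) λ ≢ → ≢ refl)))
        (ℕ.≤-reflexive (sym sources-length))))
      where
      others : List (Carrier × Carrier)
      others = filter (λ w → ¬? (w ≟² ab)) pairs
      hits : ∀ {z} → z ∈ sources → split z ∈ others
      hits i = ∈-filter⁺ (λ w → ¬? (w ≟² ab)) (pairs-complete _) λ e → ¬i (lose i e)

-- The field with q² elements over the field with q elements

module QuadraticExtension {q : ℕ} (F : FiniteField q) (K : FiniteField (q ℕ.* q)) (E : Embedding F K) (1<q : 1 < q) where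
  private
    module F where
      open FiniteField F public
      open FieldProperties F public
      open Quadratics F public
    module R = CommutativeRing F.commutativeRing
  open FiniteField K
  open FieldProperties K
  open Embedding E
  private
    module S = CommutativeRing commutativeRing
    module P = Algebra.Properties.Ring S.ring

  ι-0 : ι F.0# ≡ 0#
  ι-0 = P.+-identityˡ-unique _ _ (trans (sym (ι-+ _ _)) (cong ι (R.+-identityˡ F.0#)))

  ι-neg : ∀ x → ι (F.- x) ≡ - ι x
  ι-neg x = P.+-inverseʳ-unique _ _ (trans (sym (ι-+ x (F.- x))) (trans (cong ι (R.-‿inverseʳ x)) ι-0))

  ι-≡0 : ∀ {x} → ι x ≡ 0# → x ≡ F.0#
  ι-≡0 {x} e with x F.≟ F.0#
  ... | yes x≡0 = x≡0
  ... | no x≢0  = contradiction (trans (sym (S.zeroˡ _)) (trans (cong (_* ι (x F.⁻¹)) (sym e))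
    (trans (sym (ι-* _ _)) (trans (cong ι (F.*-inverse x≢0)) ι-1)))) 0≢1

  Imaginary : Carrier → Set
  Imaginary s = ∀ a → ¬ (ι a ≡ s)

  ∃-imaginary : ∃ Imaginary
  ∃-imaginary with any-element? (λ s → ¬? (F.any-element? (λ a → ι a ≟ s)))
  ... | yes (s , n) = s , λ a e → n (a , e)
  ... | no none = contradiction
    (unique-⊆⇒length≤ elements-unique λ {s} _ → in-image s (F.any-element? (λ a → ι a ≟ s)))
    (ℕ.<⇒≱ (subst₂ _<_ (sym (trans (length-map ι F.elements) F.elements-length)) (sym elements-length) (q<q*q 1<q)))
    where
    q<q*q : ∀ {q} → 1 < q → q < q ℕ.* q
    q<q*q {suc q} 1<q = subst (_< suc q ℕ.* suc q) (ℕ.*-identityʳ (suc q)) (ℕ.*-monoʳ-< (suc q) 1<q)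
    in-image : ∀ s → Dec (∃ λ a → ι a ≡ s) → s ∈ map ι F.elements
    in-image s (yes (a , refl)) = ∈-map⁺ ι (F.elements-complete a)
    in-image s (no n) = contradiction (s , n) none

  independent : ∀ {s} → Imaginary s → ∀ x y → ι x + s * ι y ≡ 0# → x ≡ F.0# × y ≡ F.0#
  independent {s} im x y e with y F.≟ F.0#
  ... | yes refl = ι-≡0 (modulo₂ 1# (- s) e ι-0
    (solve 3 (λ x y s → x := :0 :+ :1 :* (x :+ s :* y) :+ (:- s) :* y) refl (ι x) (ι F.0#) s)) , refl
  ... | no y≢0 = contradiction (-≡0⇒≡ (*-cancel-≡0 (λ z → y≢0 (ι-≡0 z)) (modulo₂ (- 1#) (- ι x) e
      (≡⇒-≡0 (trans (sym (ι-* _ _)) (trans (cong ι (F.*-inverse y≢0)) ι-1)))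
      (trans (cong (λ z → ι y * (z + - s)) (trans (ι-neg _) (cong -_ (ι-* x (y F.⁻¹)))))
        (solve 4 (λ x y i s → y :* (:- (x :* i) :+ :- s) := :0 :+ (:- :1) :* (x :+ s :* y) :+ (:- x) :* (y :* i :+ :- :1))
          refl (ι x) (ι y) (ι (y F.⁻¹)) s)))))
    (im (F.- (x F.* y F.⁻¹)))

  module _ (s : Carrier) where

    Root : F.Carrier → F.Carrier → Set
    Root c d = s * s + - (ι c * s) + ι d ≡ 0#

    -- The q² combinations `ι x + s * ι y` are distinct and hence fill K; `s * s` is one of them.
    imaginary⇒root : Imaginary s → ∃ λ c → ∃ λ d → Root c d
    imaginary⇒root im = c , F.- x , trans (cong (λ z → s * s + - (ι c * s) + z) (ι-neg x))
        (modulo₁ (- 1#) (≡⇒-≡0 (proj₂ onto))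
          (solve 3 (λ x y s → s :* s :+ :- (y :* s) :+ :- x := :0 :+ (:- :1) :* (x :+ s :* y :+ :- (s :* s))) refl (ι x) (ι c) s))
      where
      combination : F.Carrier × F.Carrier → Carrier
      combination (x , y) = ι x + s * ι y
      combination-injective : ∀ {z w} → combination z ≡ combination w → z ≡ w
      combination-injective {x , y} {x′ , y′} e =
        let (a , b) = independent im (x F.+ F.- x′) (y F.+ F.- y′)
              (trans (cong₂ (λ z w → z + s * w) (minus x x′) (minus y y′))
                (modulo₁ 1# (≡⇒-≡0 e) (solve 5 (λ x y x′ y′ s → x :+ :- x′ :+ s :* (y :+ :- y′)
                  := :0 :+ :1 :* (x :+ s :* y :+ :- (x′ :+ s :* y′))) refl (ι x) (ι y) (ι x′) (ι y′) s)))
        in cong₂ _,_ (F.-≡0⇒≡ a) (F.-≡0⇒≡ b)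
        where
        minus : ∀ a b → ι (a F.+ F.- b) ≡ ι a + - ι b
        minus a b = trans (ι-+ a (F.- b)) (cong (λ z → ι a + z) (ι-neg b))
      onto : ∃ λ z → combination z ≡ s * s
      onto = surjective-of-length _≟_ combination F.pairs-unique elements-complete combination-injective
        (ℕ.≤-reflexive (trans elements-length (sym F.pairs-length))) (s * s)
      x c : F.Carrier
      x = proj₁ (proj₁ onto)
      c = proj₂ (proj₁ onto)

    private
      ι-quadratic : ∀ c d t → ι (t F.* t F.+ F.- (c F.* t) F.+ d) ≡ ι t * ι t + - (ι c * ι t) + ι d
      ι-quadratic c d t = trans (ι-+ _ d) (cong (_+ ι d) (trans (ι-+ (t F.* t) _)
        (cong₂ _+_ (ι-* t t) (trans (ι-neg _) (cong -_ (ι-* c t))))))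

    -- With f = t² - c t + d, the difference f(s) - f(t) is `(s − t)(s − (c − t))`, so a root `t` in
    -- F would put `s` in F.
    imaginary⇒rootless : Imaginary s → ∀ {c d} → Root c d → F.Rootless c d
    imaginary⇒rootless im {c} {d} root t e =
      [ (λ z → im t (sym (-≡0⇒≡ z)))
      , (λ z → im (c F.+ F.- t) (trans (trans (ι-+ c _) (cong (λ w → ι c + w) (ι-neg t))) (sym (-≡0⇒≡ z)))) ]′
      (*-≡0 (s + - ι t) {s + - (ι c + - ι t)} (modulo₂ 1# (- 1#) root (trans (sym (ι-quadratic c d t)) (trans (cong ι e) ι-0))
        (solve 4 (λ s t c d → (s :+ :- t) :* (s :+ :- (c :+ :- t)) := :0 :+ :1 :* (s :* s :+ :- (c :* s) :+ d)
          :+ (:- :1) :* (t :* t :+ :- (c :* t) :+ d)) refl s (ι t) (ι c) (ι d))))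

    rootless⇒imaginary : ∀ {c d} → F.Rootless c d → Root c d → Imaginary s
    rootless⇒imaginary {c} {d} rootless root t refl = rootless t (ι-≡0 (trans (ι-quadratic c d t) root))

  private module _ (θ : Carrier) (im : Imaginary θ) (c d : F.Carrier) (θ-root : Root θ c d) where
    open F.Norm c d (imaginary⇒rootless θ im θ-root)

    root-in-extension : ∀ {a b} → F.Rootless a b → (∃ λ z → split z ≡ (a , b)) → ∃ λ s → Root s a b
    root-in-extension rootless (inj₂ (u , v) , refl) = contradiction
      (F.solve 2 (λ u v → u F.:* u F.:+ F.:- ((u F.:+ v) F.:* u) F.:+ u F.:* v F.:= F.:0) refl u v) (rootless u)
    root-in-extension _ (inj₁ (x , y) , refl) = ι x + θ * ι y , trans
      (cong₂ (λ z w → (ι x + θ * ι y) * (ι x + θ * ι y) + - (z * (ι x + θ * ι y)) + w)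
        (trans (ι-+ _ _) (cong₂ _+_ (ι-+ x x) (ι-* c y)))
        (trans (ι-+ _ _) (cong₂ _+_ (trans (ι-+ _ _) (cong₂ _+_ (ι-* x x) (trans (ι-* c _) (cong (λ z → ι c * z) (ι-* x y)))))
          (trans (ι-* d _) (cong (λ z → ι d * z) (ι-* y y))))))
      (modulo₁ (ι y * ι y) θ-root
        (solve 5 (λ x y c d t → (x :+ t :* y) :* (x :+ t :* y) :+ :- ((x :+ x :+ c :* y) :* (x :+ t :* y))
            :+ (x :* x :+ c :* (x :* y) :+ d :* (y :* y))
          := :0 :+ y :* y :* (t :* t :+ :- (c :* t) :+ d)) refl (ι x) (ι y) (ι c) (ι d) θ))

    rootless⇒root-in-extension : ∀ {a b} → F.Rootless a b → ∃ λ s → Root s a b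
    rootless⇒root-in-extension {a} {b} rootless = root-in-extension rootless (split-surjective (a , b))

  -- One imaginary element `θ` is fixed, and K is compared with F[θ]: `split-surjective` provides x
  -- and y such that t² - a t + b is the characteristic polynomial of `ι x + θ * ι y`. This makes
  -- every irreducible quadratic over F give an imaginary axis.
  rootless⇒root : ∀ {a b} → F.Rootless a b → ∃ λ s → Root s a b
  rootless⇒root = rootless⇒root-in-extension θ (proj₂ ∃-imaginary) (proj₁ c) (proj₁ (proj₂ c)) (proj₂ (proj₂ c))
    where
    θ : Carrier
    θ = proj₁ ∃-imaginary
    c : ∃ λ c → ∃ λ d → Root θ c d
    c = imaginary⇒root θ (proj₂ ∃-imaginary)

-- Binary forms and planes of PG(3,q)

module Incidence {q : ℕ} (F : FiniteField q) (K : FiniteField (q ℕ.* q)) (E : Embedding F K)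
                 (three≢0 : FieldProperties.three F ≢ FiniteField.0# F) (1<q : 1 ℕ.< q) where
  open FiniteField F
  open FieldProperties F
  open Quadratics F
  open Geometry F K E hiding (three)
  private module R = CommutativeRing commutativeRing

  Pair : Set
  Pair = 𝔽 × 𝔽

  ν : Pair → V
  ν (x , y) = ⟨ x * x * x , x * x * y , x * y * y , y * y * y ⟩

  val : V → Pair → 𝔽
  val c P = dot c (ν P)

  det : Pair → Pair → 𝔽
  det (x , y) (t , w) = x * w + - (y * t)

  γ : Pair → V
  γ (t , w) = ⟨ w * w * w , - (three * (w * w * t)) , three * (w * t * t) , - (t * t * t) ⟩

  scale : 𝔽 → Pair → Pair
  scale k (x , y) = k * x , k * y

  -- The sign at ∞ makes Γ u ≡ γ (hom u) exact, not just up to a scalar.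
  hom : Maybe 𝔽 → Pair
  hom (just t) = t , 1#
  hom nothing  = - 1# , 0#

  Quadratic : Set
  Quadratic = 𝔽 × 𝔽 × 𝔽

  qval : Quadratic → Pair → 𝔽
  qval (h₀ , h₁ , h₂) (x , y) = h₀ * (x * x) + h₁ * (x * y) + h₂ * (y * y)

  lval : Pair → Pair → 𝔽
  lval (m₀ , m₁) (x , y) = m₀ * x + m₁ * y

  -- If h has roots r, r′ (possibly conjugate), these two points span the line in which the
  -- planes (X − r Y)³ and (X − r′ Y)³ meet.
  axis₁ axis₂ : Quadratic → V
  axis₁ (h₀ , h₁ , h₂) = ⟨ three * h₂ , - h₁ , h₀ , 0# ⟩
  axis₂ (h₀ , h₁ , h₂) = ⟨ 0# , h₂ , - h₁ , three * h₀ ⟩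

  Apolar : Quadratic → V → Set
  Apolar h c = OnPlane c (axis₁ h) × OnPlane c (axis₂ h)

  -- One quarter of the classical Hessian determinant of the binary cubic with coefficients c₀, c₁,
  -- c₂, c₃ (without binomial factors); cancelling the 4 keeps it meaningful in characteristic 2.
  hess : V → Quadratic
  hess ⟨ c₀ , c₁ , c₂ , c₃ ⟩ =
    three * (c₀ * c₂) + - (c₁ * c₁) , three * (three * (c₀ * c₃)) + - (c₁ * c₂) , three * (c₁ * c₃) + - (c₂ * c₂)

  zeroQ : Quadratic
  zeroQ = 0# , 0# , 0#

  mul₁ : Pair → Pair → Quadratic
  mul₁ (t , w) (m₀ , m₁) = w * m₀ , w * m₁ + - (t * m₀) , - (t * m₁)

  mul₂ : Pair → Quadratic → V
  mul₂ (t , w) (g₀ , g₁ , g₂) = ⟨ w * g₀ , w * g₁ + - (t * g₀) , w * g₂ + - (t * g₁) , - (t * g₂) ⟩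

  -- The product of the two linear forms that vanish at the given points; this is the form h of a
  -- real axis.
  chord : Pair → Pair → Quadratic
  chord (t , w) (t′ , w′) = w * w′ , - (w * t′ + t * w′) , t * t′

  module Syntax where
    module _ {n : ℕ} where
      :det : (x y t w : Polynomial n) → Polynomial n
      :det x y t w = x :* w :+ :- (y :* t)
      :dot : (c₀ c₁ c₂ c₃ x₀ x₁ x₂ x₃ : Polynomial n) → Polynomial n
      :dot c₀ c₁ c₂ c₃ x₀ x₁ x₂ x₃ = c₀ :* x₀ :+ c₁ :* x₁ :+ c₂ :* x₂ :+ c₃ :* x₃
      :val : (c₀ c₁ c₂ c₃ x y : Polynomial n) → Polynomial n
      :val c₀ c₁ c₂ c₃ x y = :dot c₀ c₁ c₂ c₃ (x :* x :* x) (x :* x :* y) (x :* y :* y) (y :* y :* y)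
      :qval : (h₀ h₁ h₂ x y : Polynomial n) → Polynomial n
      :qval h₀ h₁ h₂ x y = h₀ :* (x :* x) :+ h₁ :* (x :* y) :+ h₂ :* (y :* y)
      :a₁ :a₂ : (c₀ c₁ c₂ c₃ h₀ h₁ h₂ : Polynomial n) → Polynomial n
      :a₁ c₀ c₁ c₂ c₃ h₀ h₁ h₂ = :dot c₀ c₁ c₂ c₃ (:3 :* h₂) (:- h₁) h₀ :0
      :a₂ c₀ c₁ c₂ c₃ h₀ h₁ h₂ = :dot c₀ c₁ c₂ c₃ :0 h₂ (:- h₁) (:3 :* h₀)
      :H₀ :H₁ :H₂ : (c₀ c₁ c₂ c₃ : Polynomial n) → Polynomial n
      :H₀ c₀ c₁ c₂ c₃ = :3 :* (c₀ :* c₂) :+ :- (c₁ :* c₁)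
      :H₁ c₀ c₁ c₂ c₃ = :3 :* (:3 :* (c₀ :* c₃)) :+ :- (c₁ :* c₂)
      :H₂ c₀ c₁ c₂ c₃ = :3 :* (c₁ :* c₃) :+ :- (c₂ :* c₂)

  open Syntax

  quad-≡ : ∀ {a b c d a′ b′ c′ d′ : 𝔽} → a ≡ a′ → b ≡ b′ → c ≡ c′ → d ≡ d′ → ⟨ a , b , c , d ⟩ ≡ ⟨ a′ , b′ , c′ , d′ ⟩
  quad-≡ refl refl refl refl = refl

  _≟V_ : DecidableEquality V
  ⟨ a , b , c , d ⟩ ≟V ⟨ a′ , b′ , c′ , d′ ⟩ = map′ (λ (p , r , s , t) → quad-≡ p r s t)
    (λ { refl → refl , refl , refl , refl }) (a ≟ a′ ×-dec b ≟ b′ ×-dec c ≟ c′ ×-dec d ≟ d′)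

  •-• : ∀ k l c → k • (l • c) ≡ (k * l) • c
  •-• k l ⟨ a , b , c , d ⟩ = quad-≡ (sym (R.*-assoc k l a)) (sym (R.*-assoc k l b)) (sym (R.*-assoc k l c)) (sym (R.*-assoc k l d))

  1•_ : ∀ c → 1# • c ≡ c
  1• ⟨ a , b , c , d ⟩ = quad-≡ (R.*-identityˡ a) (R.*-identityˡ b) (R.*-identityˡ c) (R.*-identityˡ d)

  0• : ∀ c → 0# • c ≡ zeroV
  0• ⟨ a , b , c , d ⟩ = quad-≡ (R.zeroˡ a) (R.zeroˡ b) (R.zeroˡ c) (R.zeroˡ d)

  dot-• : ∀ k c x → dot (k • c) x ≡ k * dot c x
  dot-• k ⟨ c₀ , c₁ , c₂ , c₃ ⟩ ⟨ x₀ , x₁ , x₂ , x₃ ⟩ =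
    solve 9 (λ k c₀ c₁ c₂ c₃ x₀ x₁ x₂ x₃ → :dot (k :* c₀) (k :* c₁) (k :* c₂) (k :* c₃) x₀ x₁ x₂ x₃
      := k :* :dot c₀ c₁ c₂ c₃ x₀ x₁ x₂ x₃) refl k c₀ c₁ c₂ c₃ x₀ x₁ x₂ x₃

  •-invert : ∀ {k c d} → k ≢ 0# → d ≡ k • c → c ≡ (k ⁻¹) • d
  •-invert {k} {c} k≢0 refl = sym (trans (•-• _ k c) (trans (cong (_• c) (trans (R.*-comm _ k) (*-inverse k≢0))) (1• c)))

  Proportional-scalar≢0 : ∀ {c d} → NonZeroV d → ((k , _) : Proportional c d) → k ≢ 0#
  Proportional-scalar≢0 {c} d≢0 (k , refl) refl = d≢0 (0• c)

  Proportional-refl : ∀ c → Proportional c c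
  Proportional-refl c = 1# , sym (1• c)

  Proportional-sym : ∀ {c d} → NonZeroV d → Proportional c d → Proportional d c
  Proportional-sym d≢0 p@(k , e) = k ⁻¹ , •-invert (Proportional-scalar≢0 d≢0 p) e

  Proportional-OnPlane : ∀ {c d} x → Proportional c d → OnPlane c x → OnPlane d x
  Proportional-OnPlane x (k , refl) e = trans (dot-• k _ x) (trans (cong (k *_) e) (R.zeroʳ k))

  val-hom : ∀ c u → ∃ λ ε → ε ≢ 0# × val c (hom u) ≡ ε * dot c (Pt u)
  val-hom ⟨ c₀ , c₁ , c₂ , c₃ ⟩ (just t) = 1# , 0≢1 ∘ sym ,
    solve 5 (λ c₀ c₁ c₂ c₃ t → :val c₀ c₁ c₂ c₃ t :1 := :1 :* :dot c₀ c₁ c₂ c₃ (t :* t :* t) (t :* t) t :1) refl c₀ c₁ c₂ c₃ t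
  val-hom ⟨ c₀ , c₁ , c₂ , c₃ ⟩ nothing = - 1# , -‿≢0 (0≢1 ∘ sym) ,
    solve 4 (λ c₀ c₁ c₂ c₃ → :val c₀ c₁ c₂ c₃ (:- :1) :0 := (:- :1) :* :dot c₀ c₁ c₂ c₃ :1 :0 :0 :0) refl c₀ c₁ c₂ c₃

  Γ-hom : ∀ u → Γ u ≡ γ (hom u)
  Γ-hom (just t) = quad-≡ (solve 0 (:1 := :1 :* :1 :* :1) refl)
    (solve 1 (λ t → :- (:3 :* t) := :- (:3 :* (:1 :* :1 :* t))) refl t)
    (solve 1 (λ t → :3 :* (t :* t) := :3 :* (:1 :* t :* t)) refl t) refl
  Γ-hom nothing = quad-≡ (solve 0 (:0 := :0 :* :0 :* :0) refl)
    (solve 0 (:0 := :- (:3 :* (:0 :* :0 :* (:- :1)))) refl)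
    (solve 0 (:0 := :3 :* (:0 :* (:- :1) :* (:- :1))) refl)
    (solve 0 (:1 := :- ((:- :1) :* (:- :1) :* (:- :1))) refl)

  val-γ : ∀ P R → val (γ P) R ≡ det R P * det R P * det R P
  val-γ (t , w) (x , y) = solve 4 (λ t w x y →
    :val (w :* w :* w) (:- (:3 :* (w :* w :* t))) (:3 :* (w :* t :* t)) (:- (t :* t :* t)) x y
    := :det x y t w :* :det x y t w :* :det x y t w) refl t w x y

  val-scale : ∀ c k P → val c (scale k P) ≡ k * k * k * val c P
  val-scale ⟨ c₀ , c₁ , c₂ , c₃ ⟩ k (x , y) = solve 7 (λ c₀ c₁ c₂ c₃ k x y →
    :val c₀ c₁ c₂ c₃ (k :* x) (k :* y) := k :* k :* k :* :val c₀ c₁ c₂ c₃ x y) refl c₀ c₁ c₂ c₃ k x y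

  det-hom : ∀ u v → det (hom u) (hom v) ≡ 0# → u ≡ v
  det-hom (just t) (just s) e = cong just (modulo₁ 1# e (solve 2 (λ t s → t := s :+ :1 :* (t :* :1 :+ :- (:1 :* s))) refl t s))
  det-hom (just t) nothing  e = contradiction (trans (sym e) (solve 1 (λ t → t :* :0 :+ :- (:1 :* (:- :1)) := :1) refl t)) 0≢1
  det-hom nothing  (just s) e = contradiction (trans (sym e) (solve 1 (λ s → (:- :1) :* :1 :+ :- (:0 :* s) := :- :1) refl s)) (-‿≢0 (0≢1 ∘ sym) ∘ sym)
  det-hom nothing  nothing  e = refl

  det-self : ∀ P → det P P ≡ 0#
  det-self (x , y) = solve 2 (λ x y → x :* y :+ :- (y :* x) := :0) refl x y

  hom-surjective : ∀ P → P ≢ (0# , 0#) → ∃ λ u → ∃ λ k → k ≢ 0# × P ≡ scale k (hom u)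
  hom-surjective (x , y) P≢0 with y ≟ 0#
  ... | no y≢0 = just (x * y ⁻¹) , y , y≢0 , cong₂ _,_
    (modulo₁ (- x) (≡⇒-≡0 (*-inverse y≢0)) (solve 3 (λ x y i → x := y :* (x :* i) :+ (:- x) :* (y :* i :+ :- :1)) refl x y (y ⁻¹)))
    (sym (R.*-identityʳ y))
  ... | yes refl = nothing , - x , -‿≢0 (λ { refl → P≢0 refl }) , cong₂ _,_
    (solve 1 (λ x → x := :- x :* (:- :1)) refl x) (sym (R.zeroʳ (- x)))

  linear-root : ∀ m → m ≢ (0# , 0#) → ∃ λ v → ∃ λ k → k ≢ 0# × (∀ R → lval m R ≡ k * det R (hom v)) × m ≡ (k * proj₂ (hom v) , - (k * proj₁ (hom v)))
  linear-root (m₀ , m₁) m≢0 = v , k , k≢0 , (λ R → trans (cong (λ m → lval m R) m≡) (at (hom v) R)) , m≡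
    where
    -- The linear form m vanishes at `(− m₁ , m₀)`.
    P≢0 : (- m₁ , m₀) ≢ (0# , 0#)
    P≢0 e = m≢0 (cong₂ _,_ (cong proj₂ e) (modulo₁ (- 1#) (cong proj₁ e) (solve 1 (λ m → m := :0 :+ (:- :1) :* (:- m)) refl m₁)))
    v : Maybe 𝔽
    v = proj₁ (hom-surjective _ P≢0)
    k : 𝔽
    k = proj₁ (proj₂ (hom-surjective _ P≢0))
    k≢0 : k ≢ 0#
    k≢0 = proj₁ (proj₂ (proj₂ (hom-surjective _ P≢0)))
    P≡ : (- m₁ , m₀) ≡ scale k (hom v)
    P≡ = proj₂ (proj₂ (proj₂ (hom-surjective _ P≢0)))
    m≡ : (m₀ , m₁) ≡ (k * proj₂ (hom v) , - (k * proj₁ (hom v)))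
    m≡ = cong₂ _,_ (cong proj₂ P≡) (trans (solve 1 (λ m → m := :- (:- m)) refl m₁) (cong -_ (cong proj₁ P≡)))
    at : ∀ P R → lval (k * proj₂ P , - (k * proj₁ P)) R ≡ k * det R P
    at (t , w) (x , y) = solve 5 (λ k t w x y → k :* w :* x :+ :- (k :* t) :* y := k :* :det x y t w) refl k t w x y

  -- Apolar quadratic forms

  hess-apolar : ∀ c → Apolar (hess c) c
  hess-apolar ⟨ c₀ , c₁ , c₂ , c₃ ⟩ =
    solve 4 (λ c₀ c₁ c₂ c₃ → :a₁ c₀ c₁ c₂ c₃ (:H₀ c₀ c₁ c₂ c₃) (:H₁ c₀ c₁ c₂ c₃) (:H₂ c₀ c₁ c₂ c₃) := :0) refl c₀ c₁ c₂ c₃ ,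
    solve 4 (λ c₀ c₁ c₂ c₃ → :a₂ c₀ c₁ c₂ c₃ (:H₀ c₀ c₁ c₂ c₃) (:H₁ c₀ c₁ c₂ c₃) (:H₂ c₀ c₁ c₂ c₃) := :0) refl c₀ c₁ c₂ c₃

  -- The coefficient triples of apolar h are orthogonal to two vectors with cross product hess c.
  apolar⇒∝-hess : ∀ {h c} → Apolar h c → let (h₀ , h₁ , h₂) = h ; (H₀ , H₁ , H₂) = hess c in
    h₀ * H₁ ≡ h₁ * H₀ × h₁ * H₂ ≡ h₂ * H₁ × h₀ * H₂ ≡ h₂ * H₀
  apolar⇒∝-hess {h₀ , h₁ , h₂} {⟨ c₀ , c₁ , c₂ , c₃ ⟩} (e₁ , e₂) =
    modulo₂ (- c₁) (three * c₀) e₁ e₂ (solve 7 (λ h₀ h₁ h₂ c₀ c₁ c₂ c₃ → h₀ :* :H₁ c₀ c₁ c₂ c₃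
      := h₁ :* :H₀ c₀ c₁ c₂ c₃ :+ (:- c₁) :* :a₁ c₀ c₁ c₂ c₃ h₀ h₁ h₂ :+ :3 :* c₀ :* :a₂ c₀ c₁ c₂ c₃ h₀ h₁ h₂) refl h₀ h₁ h₂ c₀ c₁ c₂ c₃) ,
    modulo₂ (- (three * c₃)) c₂ e₁ e₂ (solve 7 (λ h₀ h₁ h₂ c₀ c₁ c₂ c₃ → h₁ :* :H₂ c₀ c₁ c₂ c₃
      := h₂ :* :H₁ c₀ c₁ c₂ c₃ :+ (:- (:3 :* c₃)) :* :a₁ c₀ c₁ c₂ c₃ h₀ h₁ h₂ :+ c₂ :* :a₂ c₀ c₁ c₂ c₃ h₀ h₁ h₂) refl h₀ h₁ h₂ c₀ c₁ c₂ c₃) ,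
    modulo₂ (- c₂) c₁ e₁ e₂ (solve 7 (λ h₀ h₁ h₂ c₀ c₁ c₂ c₃ → h₀ :* :H₂ c₀ c₁ c₂ c₃
      := h₂ :* :H₀ c₀ c₁ c₂ c₃ :+ (:- c₂) :* :a₁ c₀ c₁ c₂ c₃ h₀ h₁ h₂ :+ c₁ :* :a₂ c₀ c₁ c₂ c₃ h₀ h₁ h₂) refl h₀ h₁ h₂ c₀ c₁ c₂ c₃)

  -- Proportionality of the coefficient triples, cross-multiplied at two points so that no case
  -- distinction on vanishing coefficients arises.
  apolar⇒qval-∝ : ∀ {h c} → Apolar h c → ∀ R S → qval h R * qval (hess c) S ≡ qval h S * qval (hess c) R
  apolar⇒qval-∝ {h} {c} ap (x , y) (x′ , y′) =
    let (p , r , s) = apolar⇒∝-hess {h} {c} ap ; (h₀ , h₁ , h₂) = h ; (H₀ , H₁ , H₂) = hess c in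
    modulo₂ (x * x * (x′ * y′) + - (x * y * (x′ * x′))) (x * y * (y′ * y′) + - (y * y * (x′ * y′))) (≡⇒-≡0 p) (≡⇒-≡0 r)
      (modulo₁ (x * x * (y′ * y′) + - (y * y * (x′ * x′))) (≡⇒-≡0 s)
        (solve 10 (λ h₀ h₁ h₂ H₀ H₁ H₂ x y x′ y′ → :qval h₀ h₁ h₂ x y :* :qval H₀ H₁ H₂ x′ y′
          := :qval h₀ h₁ h₂ x′ y′ :* :qval H₀ H₁ H₂ x y
            :+ (x :* x :* (x′ :* y′) :+ :- (x :* y :* (x′ :* x′))) :* (h₀ :* H₁ :+ :- (h₁ :* H₀))
            :+ (x :* y :* (y′ :* y′) :+ :- (y :* y :* (x′ :* y′))) :* (h₁ :* H₂ :+ :- (h₂ :* H₁))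
            :+ (x :* x :* (y′ :* y′) :+ :- (y :* y :* (x′ :* x′))) :* (h₀ :* H₂ :+ :- (h₂ :* H₀)))
          refl h₀ h₁ h₂ H₀ H₁ H₂ x y x′ y′))

  qval-nonzero : ∀ h → h ≢ zeroQ → ∃ λ R → qval h R ≢ 0#
  qval-nonzero h@(h₀ , h₁ , h₂) h≢0 with h₀ ≟ 0# | h₂ ≟ 0#
  ... | no h₀≢0 | _ = (1# , 0#) , h₀≢0 ∘ trans (sym
    (solve 3 (λ h₀ h₁ h₂ → :qval h₀ h₁ h₂ :1 :0 := h₀) refl h₀ h₁ h₂))
  ... | yes _ | no h₂≢0 = (0# , 1#) , h₂≢0 ∘ trans (sym
    (solve 3 (λ h₀ h₁ h₂ → :qval h₀ h₁ h₂ :0 :1 := h₂) refl h₀ h₁ h₂))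
  ... | yes refl | yes refl = (1# , 1#) , λ e → h≢0 (cong (λ z → 0# , z , 0#) (trans (sym
    (solve 1 (λ h₁ → :qval :0 h₁ :0 :1 :1 := h₁) refl h₁)) e))

  chord-val : ∀ P Q R → qval (chord P Q) R ≡ det R P * det R Q
  chord-val (t , w) (t′ , w′) (x , y) = solve 6 (λ t w t′ w′ x y →
    :qval (w :* w′) (:- (w :* t′ :+ t :* w′)) (t :* t′) x y := :det x y t w :* :det x y t′ w′) refl t w t′ w′ x y

  axis₁-γ : ∀ h t w → dot (γ (t , w)) (axis₁ h) ≡ three * w * qval h (t , w)
  axis₁-γ (h₀ , h₁ , h₂) t w = solve 5 (λ h₀ h₁ h₂ t w →
    :a₁ (w :* w :* w) (:- (:3 :* (w :* w :* t))) (:3 :* (w :* t :* t)) (:- (t :* t :* t)) h₀ h₁ h₂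
    := :3 :* w :* :qval h₀ h₁ h₂ t w) refl h₀ h₁ h₂ t w

  axis₂-γ : ∀ h t w → dot (γ (t , w)) (axis₂ h) ≡ - (three * t) * qval h (t , w)
  axis₂-γ (h₀ , h₁ , h₂) t w = solve 5 (λ h₀ h₁ h₂ t w →
    :a₂ (w :* w :* w) (:- (:3 :* (w :* w :* t))) (:3 :* (w :* t :* t)) (:- (t :* t :* t)) h₀ h₁ h₂
    := :- (:3 :* t) :* :qval h₀ h₁ h₂ t w) refl h₀ h₁ h₂ t w

  root⇒apolar-γ : ∀ {h P} → qval h P ≡ 0# → Apolar h (γ P)
  root⇒apolar-γ {h} {t , w} e =
    trans (axis₁-γ h t w) (trans (cong (three * w *_) e) (R.zeroʳ _)) ,
    trans (axis₂-γ h t w) (trans (cong (- (three * t) *_) e) (R.zeroʳ _))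

  -- The pairings with the two spanning points are `3 w` and `−3 t` times the value of h. At a
  -- finite point `w = 1` makes the first one decisive, at infinity `t = −1` the second.
  apolar-γ⇒root : ∀ {h} u → Apolar h (γ (hom u)) → qval h (hom u) ≡ 0#
  apolar-γ⇒root {h} (just t) (e , _) = *-cancel-≡0 (*-≢0 three≢0 (0≢1 ∘ sym)) (trans (sym (axis₁-γ h t 1#)) e)
  apolar-γ⇒root {h} nothing (_ , e) = *-cancel-≡0 (-‿≢0 (*-≢0 three≢0 (-‿≢0 (0≢1 ∘ sym)))) (trans (sym (axis₂-γ h (- 1#) 0#)) e)

  apolar-• : ∀ {h} k {c} → Apolar h c → Apolar h (k • c)
  apolar-• {h} k {c} (e₁ , e₂) = Proportional-OnPlane (axis₁ h) (k , refl) e₁ , Proportional-OnPlane (axis₂ h) (k , refl) e₂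

  hess-cube : ∀ k P → hess (k • γ P) ≡ zeroQ
  hess-cube k (t , w) = cong₂ _,_
    (solve 3 (λ k t w → :H₀ (k :* (w :* w :* w)) (k :* (:- (:3 :* (w :* w :* t)))) (k :* (:3 :* (w :* t :* t))) (k :* (:- (t :* t :* t))) := :0) refl k t w)
    (cong₂ _,_
    (solve 3 (λ k t w → :H₁ (k :* (w :* w :* w)) (k :* (:- (:3 :* (w :* w :* t)))) (k :* (:3 :* (w :* t :* t))) (k :* (:- (t :* t :* t))) := :0) refl k t w)
    (solve 3 (λ k t w → :H₂ (k :* (w :* w :* w)) (k :* (:- (:3 :* (w :* w :* t)))) (k :* (:3 :* (w :* t :* t))) (k :* (:- (t :* t :* t))) := :0) refl k t w))

  -- For `c₀ ≠ 0` the cube is completed: c₁ forces `t = − c₁ / (3 c₀)`, and the vanishing of the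
  -- first two Hessian coefficients determines c₂ and c₃. For `c₀ = 0` the Hessian forces c₁ and
  -- then c₂ to vanish, which leaves the Γ-plane at infinity.
  hess≡0⇒cube : ∀ c → NonZeroV c → hess c ≡ zeroQ → ∃ λ u → ∃ λ k → k ≢ 0# × c ≡ k • Γ u
  hess≡0⇒cube ⟨ c₀ , c₁ , c₂ , c₃ ⟩ c≢0 h≡0 with c₀ ≟ 0#
  ... | yes refl = nothing , c₃ , (λ { refl → c≢0 (quad-≡ refl c₁≡0 c₂≡0 refl) }) ,
      quad-≡ (sym (R.zeroʳ c₃)) (trans c₁≡0 (sym (R.zeroʳ c₃))) (trans c₂≡0 (sym (R.zeroʳ c₃))) (sym (R.*-identityʳ c₃))
    where
    c₁≡0 : c₁ ≡ 0#
    c₁≡0 = [ id , id ]′ (*-≡0 c₁ (modulo₁ (- 1#) (cong proj₁ h≡0)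
      (solve 2 (λ c₁ c₂ → c₁ :* c₁ := :0 :+ (:- :1) :* (:3 :* (:0 :* c₂) :+ :- (c₁ :* c₁))) refl c₁ c₂)))
    c₂≡0 : c₂ ≡ 0#
    c₂≡0 = [ id , id ]′ (*-≡0 c₂ (modulo₂ (three * c₃) (- 1#) c₁≡0 (cong (proj₂ ∘ proj₂) h≡0)
      (solve 3 (λ c₁ c₂ c₃ → c₂ :* c₂ := :0 :+ :3 :* c₃ :* c₁ :+ (:- :1) :* (:3 :* (c₁ :* c₃) :+ :- (c₂ :* c₂))) refl c₁ c₂ c₃)))
  ... | no c₀≢0 = just t , c₀ , c₀≢0 , quad-≡ (sym (R.*-identityʳ c₀)) c₁≡ c₂≡ c₃≡
    where
    3c₀≢0 : three * c₀ ≢ 0#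
    3c₀≢0 = *-≢0 three≢0 c₀≢0
    t : 𝔽
    t = - (c₁ * (three * c₀) ⁻¹)
    c₁≡ : c₁ ≡ c₀ * (- (three * t))
    c₁≡ = modulo₁ (- c₁) (≡⇒-≡0 (*-inverse 3c₀≢0)) (solve 3 (λ c₀ c₁ i →
      c₁ := c₀ :* (:- (:3 :* (:- (c₁ :* i)))) :+ (:- c₁) :* (:3 :* c₀ :* i :+ :- :1)) refl c₀ c₁ ((three * c₀) ⁻¹))
    c₂≡ : c₂ ≡ c₀ * (three * (t * t))
    c₂≡ = *-cancel 3c₀≢0 (modulo₂ 1# (c₁ + c₀ * - (three * t)) (cong proj₁ h≡0) (≡⇒-≡0 c₁≡)
      (solve 4 (λ c₀ c₁ c₂ t → :3 :* c₀ :* c₂ := :3 :* c₀ :* (c₀ :* (:3 :* (t :* t)))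
        :+ :1 :* (:3 :* (c₀ :* c₂) :+ :- (c₁ :* c₁)) :+ (c₁ :+ c₀ :* :- (:3 :* t)) :* (c₁ :+ :- (c₀ :* (:- (:3 :* t))))) refl c₀ c₁ c₂ t))
    c₃≡ : c₃ ≡ c₀ * (- (t * t * t))
    c₃≡ = *-cancel (*-≢0 three≢0 3c₀≢0) (modulo₂ 1# c₂ (cong (proj₁ ∘ proj₂) h≡0) (≡⇒-≡0 c₁≡)
      (trans (modulo₁ (c₀ * - (three * t)) (≡⇒-≡0 c₂≡) (solve 4 (λ c₀ c₂ c₃ t → :3 :* (:3 :* c₀) :* c₃ :=
          :3 :* (:3 :* c₀) :* (c₀ :* (:- (t :* t :* t))) :+ (:3 :* (:3 :* (c₀ :* c₃)) :+ :- (c₀ :* (:- (:3 :* t)) :* c₂))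
          :+ c₀ :* :- (:3 :* t) :* (c₂ :+ :- (c₀ :* (:3 :* (t :* t))))) refl c₀ c₂ c₃ t))
        (solve 5 (λ c₀ c₁ c₂ c₃ t → :3 :* (:3 :* c₀) :* (c₀ :* (:- (t :* t :* t))) :+ (:3 :* (:3 :* (c₀ :* c₃)) :+ :- (c₀ :* (:- (:3 :* t)) :* c₂))
          := :3 :* (:3 :* c₀) :* (c₀ :* (:- (t :* t :* t))) :+ :1 :* (:3 :* (:3 :* (c₀ :* c₃)) :+ :- (c₁ :* c₂))
            :+ c₂ :* (c₁ :+ :- (c₀ :* (:- (:3 :* t))))) refl c₀ c₁ c₂ c₃ t)))

  -- Roots of cubic forms

  Root : V → Maybe 𝔽 → Set
  Root c u = val c (hom u) ≡ 0#

  mul₁-val : ∀ P m R → qval (mul₁ P m) R ≡ det R P * lval m R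
  mul₁-val (t , w) (m₀ , m₁) (x , y) = solve 6 (λ t w m₀ m₁ x y →
    :qval (w :* m₀) (w :* m₁ :+ :- (t :* m₀)) (:- (t :* m₁)) x y := :det x y t w :* (m₀ :* x :+ m₁ :* y)) refl t w m₀ m₁ x y

  mul₂-val : ∀ P g R → val (mul₂ P g) R ≡ det R P * qval g R
  mul₂-val (t , w) (g₀ , g₁ , g₂) (x , y) = solve 7 (λ t w g₀ g₁ g₂ x y →
    :val (w :* g₀) (w :* g₁ :+ :- (t :* g₀)) (w :* g₂ :+ :- (t :* g₁)) (:- (t :* g₂)) x y
    := :det x y t w :* :qval g₀ g₁ g₂ x y) refl t w g₀ g₁ g₂ x y

  -- Synthetic division by X - t Y, or by Y at infinity; the vanishing value is the remainder.
  factor₁ : ∀ h u → qval h (hom u) ≡ 0# → ∃ λ m → h ≡ mul₁ (hom u) m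
  factor₁ (h₀ , h₁ , h₂) (just t) e = (h₀ , h₁ + t * h₀) , cong₂ _,_ (sym (R.*-identityˡ h₀)) (cong₂ _,_
    (solve 3 (λ h₀ h₁ t → h₁ := :1 :* (h₁ :+ t :* h₀) :+ :- (t :* h₀)) refl h₀ h₁ t)
    (modulo₁ 1# e (solve 4 (λ h₀ h₁ h₂ t → h₂ := :- (t :* (h₁ :+ t :* h₀)) :+ :1 :* :qval h₀ h₁ h₂ t :1) refl h₀ h₁ h₂ t)))
  factor₁ (h₀ , h₁ , h₂) nothing e = (h₁ , h₂) , cong₂ _,_
    (modulo₁ 1# e (solve 3 (λ h₀ h₁ h₂ → h₀ := :0 :* h₁ :+ :1 :* :qval h₀ h₁ h₂ (:- :1) :0) refl h₀ h₁ h₂)) (cong₂ _,_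
    (solve 2 (λ h₁ h₂ → h₁ := :0 :* h₂ :+ :- ((:- :1) :* h₁)) refl h₁ h₂)
    (solve 1 (λ h₂ → h₂ := :- ((:- :1) :* h₂)) refl h₂))

  factor₂ : ∀ c u → Root c u → ∃ λ g → c ≡ mul₂ (hom u) g
  factor₂ ⟨ c₀ , c₁ , c₂ , c₃ ⟩ (just t) e = (c₀ , c₁ + t * c₀ , c₂ + t * (c₁ + t * c₀)) , quad-≡ (sym (R.*-identityˡ c₀))
    (solve 3 (λ c₀ c₁ t → c₁ := :1 :* (c₁ :+ t :* c₀) :+ :- (t :* c₀)) refl c₀ c₁ t)
    (solve 4 (λ c₀ c₁ c₂ t → c₂ := :1 :* (c₂ :+ t :* (c₁ :+ t :* c₀)) :+ :- (t :* (c₁ :+ t :* c₀))) refl c₀ c₁ c₂ t)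
    (modulo₁ 1# e (solve 5 (λ c₀ c₁ c₂ c₃ t → c₃ := :- (t :* (c₂ :+ t :* (c₁ :+ t :* c₀))) :+ :1 :* :val c₀ c₁ c₂ c₃ t :1) refl c₀ c₁ c₂ c₃ t))
  factor₂ ⟨ c₀ , c₁ , c₂ , c₃ ⟩ nothing e = (c₁ , c₂ , c₃) , quad-≡
    (modulo₁ (- 1#) e (solve 4 (λ c₀ c₁ c₂ c₃ → c₀ := :0 :* c₁ :+ (:- :1) :* :val c₀ c₁ c₂ c₃ (:- :1) :0) refl c₀ c₁ c₂ c₃))
    (solve 2 (λ c₁ c₂ → c₁ := :0 :* c₂ :+ :- ((:- :1) :* c₁)) refl c₁ c₂)
    (solve 2 (λ c₂ c₃ → c₂ := :0 :* c₃ :+ :- ((:- :1) :* c₂)) refl c₂ c₃)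
    (solve 1 (λ c₃ → c₃ := :- ((:- :1) :* c₃)) refl c₃)

  mul-zero : ∀ P Q → mul₂ P (mul₁ Q (0# , 0#)) ≡ zeroV
  mul-zero (t , w) (t′ , w′) = quad-≡
    (solve 2 (λ w w′ → w :* (w′ :* :0) := :0) refl w w′)
    (solve 4 (λ t w t′ w′ → w :* (w′ :* :0 :+ :- (t′ :* :0)) :+ :- (t :* (w′ :* :0)) := :0) refl t w t′ w′)
    (solve 4 (λ t w t′ w′ → w :* (:- (t′ :* :0)) :+ :- (t :* (w′ :* :0 :+ :- (t′ :* :0))) := :0) refl t w t′ w′)
    (solve 2 (λ t t′ → :- (t :* (:- (t′ :* :0))) := :0) refl t t′)

  det-hom≢0 : ∀ {u v} → u ≢ v → det (hom u) (hom v) ≢ 0#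
  det-hom≢0 u≢v = u≢v ∘ det-hom _ _

  two-roots⇒factors : ∀ {c u v} → u ≢ v → Root c u → Root c v → ∃ λ m → c ≡ mul₂ (hom u) (mul₁ (hom v) m)
  two-roots⇒factors {c} {u} {v} u≢v e e′ =
    let (g , c≡) = factor₂ c u e
        (m , g≡) = factor₁ g v (*-cancel-≡0 (det-hom≢0 (u≢v ∘ sym))
          (trans (sym (mul₂-val (hom u) g (hom v))) (trans (cong (λ c → val c (hom v)) (sym c≡)) e′)))
    in m , trans c≡ (cong (mul₂ (hom u)) g≡)

  third-factor : ∀ {c u v m} → NonZeroV c → c ≡ mul₂ (hom u) (mul₁ (hom v) m) →
    ∃ λ w → ∃ λ k → k ≢ 0# × (∀ R → lval m R ≡ k * det R (hom w)) × m ≡ (k * proj₂ (hom w) , - (k * proj₁ (hom w)))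
  third-factor {u = u} {v} {m} c≢0 refl = linear-root m λ { refl → c≢0 (mul-zero (hom u) (hom v)) }

  factors-root : ∀ {c u v m w k} → c ≡ mul₂ (hom u) (mul₁ (hom v) m) → k ≢ 0# → (∀ R → lval m R ≡ k * det R (hom w)) →
    ∀ x → Root c x → x ≡ u ⊎ x ≡ v ⊎ x ≡ w
  factors-root {u = u} {v} {m} {w} {k} refl k≢0 m≡ x e =
    [ inj₁ ∘ det-hom x u
    , (λ e′ → [ inj₂ ∘ inj₁ ∘ det-hom x v
              , (λ e″ → inj₂ (inj₂ (det-hom x w (*-cancel-≡0 k≢0 (trans (sym (m≡ (hom x))) e″))))) ]′
        (*-≡0 (det (hom x) (hom v)) (trans (sym (mul₁-val (hom v) m (hom x))) e′))) ]′
    (*-≡0 (det (hom x) (hom u)) (trans (sym (mul₂-val (hom u) (mul₁ (hom v) m) (hom x))) e))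

  third-root : ∀ {c u v} → NonZeroV c → u ≢ v → Root c u → Root c v → ∃ λ w → ∀ x → Root c x → x ≡ u ⊎ x ≡ v ⊎ x ≡ w
  third-root {c} {u} {v} c≢0 u≢v e e′ =
    let (m , c≡) = two-roots⇒factors {c} u≢v e e′
        (w , k , k≢0 , m≡ , _) = third-factor {u = u} {v} c≢0 c≡
    in w , factors-root {c} c≡ k≢0 m≡

  -- With `D = det P Q`, the third linear form satisfies `D · lval m = r − s`. When neither
  -- `lval m P` nor `lval m Q` vanishes, the cubic is therefore proportional to `s r (r − s)`, the
  -- form L₁L₂(L₁ + L₂) with L₁ = -s and L₂ = r.
  hess-factors : ∀ P Q m X → let s = lval m Q * det X P ; r = lval m P * det X Q in
    qval (hess (mul₂ P (mul₁ Q m))) X ≡ - (s * s + - (s * r) + r * r)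
  hess-factors (t , w) (t′ , w′) (m₀ , m₁) (x , y) = solve 8 (λ t w t′ w′ m₀ m₁ x y →
    let g₀ = w′ :* m₀
        g₁ = w′ :* m₁ :+ :- (t′ :* m₀)
        g₂ = :- (t′ :* m₁)
        c₀ = w :* g₀
        c₁ = w :* g₁ :+ :- (t :* g₀)
        c₂ = w :* g₂ :+ :- (t :* g₁)
        c₃ = :- (t :* g₂)
        s = (m₀ :* t′ :+ m₁ :* w′) :* :det x y t w
        r = (m₀ :* t :+ m₁ :* w) :* :det x y t′ w′
    in :qval (:H₀ c₀ c₁ c₂ c₃) (:H₁ c₀ c₁ c₂ c₃) (:H₂ c₀ c₁ c₂ c₃) x y := :- (s :* s :+ :- (s :* r) :+ r :* r)) refl t w t′ w′ m₀ m₁ x y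

  -- For `r ≠ 0` the form equals `r² Φ (s / r)`.
  no-sixth-root⇒anisotropic : (∀ ρ → Φ ρ ≢ 0#) → ∀ s r → s * s + - (s * r) + r * r ≡ 0# → s ≡ 0# × r ≡ 0#
  no-sixth-root⇒anisotropic none s r e with r ≟ 0#
  ... | yes refl = [ id , id ]′ (*-≡0 s (modulo₁ 1# e
    (solve 1 (λ s → s :* s := :0 :+ :1 :* (s :* s :+ :- (s :* :0) :+ :0 :* :0)) refl s))) , refl
  ... | no r≢0 = contradiction (*-cancel-≡0 (*-≢0 r≢0 r≢0) (modulo₂ 1# (s * s * (r * r ⁻¹ + 1#) + - (s * r)) e (≡⇒-≡0 (*-inverse r≢0))
    (solve 3 (λ s r i → r :* r :* (s :* i :* (s :* i) :+ :- (s :* i) :+ :1) := :0 :+ :1 :* (s :* s :+ :- (s :* r) :+ r :* r)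
      :+ (s :* s :* (r :* i :+ :1) :+ :- (s :* r)) :* (r :* i :+ :- :1)) refl s r (r ⁻¹)))) (none (s * r ⁻¹))

  module _ {c : V} (c≢0 : NonZeroV c) {u v : Maybe 𝔽} (u≢v : u ≢ v) (root-u : Root c u) (root-v : Root c v) where
    private
      P Q : Pair
      P = hom u
      Q = hom v
      factors : ∃ λ m → c ≡ mul₂ P (mul₁ Q m)
      factors = two-roots⇒factors {c} u≢v root-u root-v
      m : Pair
      m = proj₁ factors

      hess-val : ∀ X → let s = lval m Q * det X P ; r = lval m P * det X Q in
        qval (hess c) X ≡ - (s * s + - (s * r) + r * r)
      hess-val X = trans (cong (λ c → qval (hess c) X) (proj₂ factors)) (hess-factors P Q m X)

      some-value≢0 : lval m Q ≡ 0# → lval m P ≢ 0#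
      some-value≢0 e e′ = let (w , k , k≢0 , m≡ , _) = third-factor {u = u} {v} c≢0 (proj₂ factors) in u≢v (trans
        (det-hom u w (*-cancel-≡0 k≢0 (trans (sym (m≡ P)) e′)))
        (sym (det-hom v w (*-cancel-≡0 k≢0 (trans (sym (m≡ Q)) e)))))

    -- By anisotropy a zero of the Hessian is a common zero of s and r. If `lval m Q ≠ 0` it can
    -- only be `u`; otherwise `lval m P ≠ 0` and it can only be `v`.
    no-sixth-root⇒hess-one-root : (∀ ρ → Φ ρ ≢ 0#) → ∀ {a b} → qval (hess c) (hom a) ≡ 0# → qval (hess c) (hom b) ≡ 0# → a ≡ b
    no-sixth-root⇒hess-one-root none {a} {b} ea eb = go (lval m Q ≟ 0#) (zeros a ea) (zeros b eb)
      where
      zeros : ∀ a → qval (hess c) (hom a) ≡ 0# → lval m Q * det (hom a) P ≡ 0# × lval m P * det (hom a) Q ≡ 0#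
      zeros a e = no-sixth-root⇒anisotropic none _ _ (modulo₁ (- 1#) (trans (sym (hess-val (hom a))) e)
        (solve 1 (λ z → z := :0 :+ (:- :1) :* (:- z)) refl _))
      go : Dec (lval m Q ≡ 0#) → lval m Q * det (hom a) P ≡ 0# × lval m P * det (hom a) Q ≡ 0# →
           lval m Q * det (hom b) P ≡ 0# × lval m P * det (hom b) Q ≡ 0# → a ≡ b
      go (no m≢0) (e , _) (e′ , _) = trans (det-hom a u (*-cancel-≡0 m≢0 e)) (sym (det-hom b u (*-cancel-≡0 m≢0 e′)))
      go (yes z) (_ , e) (_ , e′) = trans (det-hom a v (*-cancel-≡0 (some-value≢0 z) e)) (sym (det-hom b v (*-cancel-≡0 (some-value≢0 z) e′)))

    -- The point `X = a P − b Q` solves `s = ρ r`, where the Hessian takes the value `− r² Φ ρ`.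
    -- Indeed `det X P = b D` and `det X Q = a D` for `D = det P Q`, which dictates the choice of a
    -- and b.
    sixth-root⇒hess-root : ∀ {ρ} → Φ ρ ≡ 0# → ∃ λ X → X ≢ (0# , 0#) × qval (hess c) X ≡ 0#
    sixth-root⇒hess-root {ρ} Φρ = X , X≢0 , trans (hess-val X) (modulo₁ (- (r * r)) Φρ
        (trans (cong (λ s → - (s * s + - (s * r) + r * r)) s≡) (solve 2 (λ ρ r →
          :- (ρ :* r :* (ρ :* r) :+ :- (ρ :* r :* r) :+ r :* r) := :0 :+ (:- (r :* r)) :* (ρ :* ρ :+ :- ρ :+ :1)) refl ρ r)))
      where
      ρ≢0 : ρ ≢ 0#
      ρ≢0 refl = 0≢1 (trans (sym Φρ) (solve 0 (:0 :* :0 :+ :- :0 :+ :1 := :1) refl))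
      a b : 𝔽
      a = lval m Q
      b = ρ * lval m P
      X : Pair
      X = a * proj₁ P + - (b * proj₁ Q) , a * proj₂ P + - (b * proj₂ Q)
      det-XP : det X P ≡ b * det P Q
      det-XP = solve 6 (λ a b x y t w → :det (a :* x :+ :- (b :* t)) (a :* y :+ :- (b :* w)) x y
        := b :* :det x y t w) refl a b (proj₁ P) (proj₂ P) (proj₁ Q) (proj₂ Q)
      det-XQ : det X Q ≡ a * det P Q
      det-XQ = solve 6 (λ a b x y t w → :det (a :* x :+ :- (b :* t)) (a :* y :+ :- (b :* w)) t w
        := a :* :det x y t w) refl a b (proj₁ P) (proj₂ P) (proj₁ Q) (proj₂ Q)
      r : 𝔽
      r = lval m P * det X Q
      s≡ : lval m Q * det X P ≡ ρ * r
      s≡ = trans (cong (lval m Q *_) det-XP) (trans (solve 4 (λ a ρ p d → a :* (ρ :* p :* d) := ρ :* (p :* (a :* d))) refl a ρ (lval m P) (det P Q))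
        (cong (λ z → ρ * (lval m P * z)) (sym det-XQ)))
      X≢0 : X ≢ (0# , 0#)
      X≢0 e = some-value≢0
        (*-cancel-≡0 (det-hom≢0 u≢v) (trans (R.*-comm _ a) (trans (sym det-XQ) (trans (cong (λ X → det X Q) e) (det-zero Q)))))
        (*-cancel-≡0 ρ≢0 (*-cancel-≡0 (det-hom≢0 u≢v) (trans (R.*-comm _ b) (trans (sym det-XP) (trans (cong (λ X → det X P) e) (det-zero P))))))
        where
        det-zero : ∀ P → det (0# , 0#) P ≡ 0#
        det-zero (t , w) = solve 2 (λ t w → :0 :* w :+ :- (:0 :* t) := :0) refl t w

  -- The symmetry of order 3 of the cubics apolar to a quadratic form

  module _ {h : Quadratic} {c : V} (ap : Apolar h c) {r s : 𝔽} (s≢0 : s ≢ 0#)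
           (trace : r + r + s * proj₁ (proj₂ h) + 1# ≡ 0#)
           (norm : r * r + r * s * proj₁ (proj₂ h) + s * s * (proj₁ h * proj₂ (proj₂ h)) + - 1# ≡ 0#) where
    private
      -- M generates the order-3 subgroup of the stabiliser of h in SL(2,q); it is self-adjoint
      -- for the symmetric trilinear form T of c, so M³ = 1 makes it preserve c.
      M : Pair → Pair
      M (x , y) = let (h₀ , h₁ , h₂) = h in r * x + - (s * (h₂ * y)) , s * (h₀ * x) + (r + s * h₁) * y

      -- Three times the polarisation of the cubic, which avoids denominators.
      T : Pair → Pair → Pair → 𝔽
      T (x , y) (x′ , y′) (x″ , y″) = let ⟨ c₀ , c₁ , c₂ , c₃ ⟩ = c in
        three * (c₀ * (x * x′ * x″)) + c₁ * (x * x′ * y″ + x * y′ * x″ + y * x′ * x″)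
        + c₂ * (x * y′ * y″ + y * x′ * y″ + y * y′ * x″) + three * (c₃ * (y * y′ * y″))

      :T : ∀ {n} → (c₀ c₁ c₂ c₃ x y x′ y′ x″ y″ : Polynomial n) → Polynomial n
      :T c₀ c₁ c₂ c₃ x y x′ y′ x″ y″ =
        :3 :* (c₀ :* (x :* x′ :* x″)) :+ c₁ :* (x :* x′ :* y″ :+ x :* y′ :* x″ :+ y :* x′ :* x″)
        :+ c₂ :* (x :* y′ :* y″ :+ y :* x′ :* y″ :+ y :* y′ :* x″) :+ :3 :* (c₃ :* (y :* y′ :* y″))

      T-diagonal : ∀ X → T X X X ≡ three * val c X
      T-diagonal (x , y) = let ⟨ c₀ , c₁ , c₂ , c₃ ⟩ = c in solve 6 (λ c₀ c₁ c₂ c₃ x y →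
        :T c₀ c₁ c₂ c₃ x y x y x y := :3 :* :val c₀ c₁ c₂ c₃ x y) refl c₀ c₁ c₂ c₃ x y

      T-sym : ∀ X Y Z → T X Y Z ≡ T Z Y X
      T-sym (x , y) (x′ , y′) (x″ , y″) = let ⟨ c₀ , c₁ , c₂ , c₃ ⟩ = c in solve 10 (λ c₀ c₁ c₂ c₃ x y x′ y′ x″ y″ →
        :T c₀ c₁ c₂ c₃ x y x′ y′ x″ y″ := :T c₀ c₁ c₂ c₃ x″ y″ x′ y′ x y) refl c₀ c₁ c₂ c₃ x y x′ y′ x″ y″

      -- The two sides differ by `s * det X Y` times `x″ a₁ + y″ a₂`, where a₁ and a₂ are the
      -- pairings of c with `axis₁ h` and `axis₂ h`. Apolarity says that both vanish.
      T-selfadjoint : ∀ X Y Z → T (M X) Y Z ≡ T X (M Y) Z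
      T-selfadjoint (x , y) (x′ , y′) (x″ , y″) = let ⟨ c₀ , c₁ , c₂ , c₃ ⟩ = c ; (h₀ , h₁ , h₂) = h in
        modulo₂ (s * x″ * (x * y′ + - (y * x′))) (s * y″ * (x * y′ + - (y * x′))) (proj₁ ap) (proj₂ ap)
        (solve 15 (λ c₀ c₁ c₂ c₃ h₀ h₁ h₂ r s x y x′ y′ x″ y″ →
          :T c₀ c₁ c₂ c₃ (r :* x :+ :- (s :* (h₂ :* y))) (s :* (h₀ :* x) :+ (r :+ s :* h₁) :* y) x′ y′ x″ y″
          := :T c₀ c₁ c₂ c₃ x y (r :* x′ :+ :- (s :* (h₂ :* y′))) (s :* (h₀ :* x′) :+ (r :+ s :* h₁) :* y′) x″ y″
            :+ s :* x″ :* (x :* y′ :+ :- (y :* x′)) :* :a₁ c₀ c₁ c₂ c₃ h₀ h₁ h₂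
            :+ s :* y″ :* (x :* y′ :+ :- (y :* x′)) :* :a₂ c₀ c₁ c₂ c₃ h₀ h₁ h₂)
          refl c₀ c₁ c₂ c₃ h₀ h₁ h₂ r s x y x′ y′ x″ y″)

      third : Pair → Pair
      third (x , y) = let (x′ , y′) = M (x , y) in - (x + x′) , - (y + y′)

      -- Cayley-Hamilton: `trace` and `norm` say that M has trace -1 and determinant 1, so M² + M +
      -- 1 = 0.
      M² : ∀ X → M (M X) ≡ third X
      M² (x , y) = let (h₀ , h₁ , h₂) = h in cong₂ _,_
        (modulo₂ (r * x + - (s * (h₂ * y))) (- x) trace norm (solve 7 (λ h₀ h₁ h₂ r s x y →
          r :* (r :* x :+ :- (s :* (h₂ :* y))) :+ :- (s :* (h₂ :* (s :* (h₀ :* x) :+ (r :+ s :* h₁) :* y)))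
          := :- (x :+ (r :* x :+ :- (s :* (h₂ :* y))))
            :+ (r :* x :+ :- (s :* (h₂ :* y))) :* (r :+ r :+ s :* h₁ :+ :1)
            :+ (:- x) :* (r :* r :+ r :* s :* h₁ :+ s :* s :* (h₀ :* h₂) :+ :- :1)) refl h₀ h₁ h₂ r s x y))
        (modulo₂ (s * (h₀ * x) + (r + s * h₁) * y) (- y) trace norm (solve 7 (λ h₀ h₁ h₂ r s x y →
          s :* (h₀ :* (r :* x :+ :- (s :* (h₂ :* y)))) :+ (r :+ s :* h₁) :* (s :* (h₀ :* x) :+ (r :+ s :* h₁) :* y)
          := :- (y :+ (s :* (h₀ :* x) :+ (r :+ s :* h₁) :* y))
            :+ (s :* (h₀ :* x) :+ (r :+ s :* h₁) :* y) :* (r :+ r :+ s :* h₁ :+ :1)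
            :+ (:- y) :* (r :* r :+ r :* s :* h₁ :+ s :* s :* (h₀ :* h₂) :+ :- :1)) refl h₀ h₁ h₂ r s x y))

      M-third : ∀ X → M (third X) ≡ X
      M-third (x , y) = let (h₀ , h₁ , h₂) = h in cong₂ _,_
        (modulo₁ (- 1#) (≡⇒-≡0 (cong proj₁ (M² (x , y)))) (solve 7 (λ h₀ h₁ h₂ r s x y →
          let x′ = r :* x :+ :- (s :* (h₂ :* y))
              y′ = s :* (h₀ :* x) :+ (r :+ s :* h₁) :* y
          in r :* (:- (x :+ x′)) :+ :- (s :* (h₂ :* (:- (y :+ y′))))
            := x :+ (:- :1) :* (r :* x′ :+ :- (s :* (h₂ :* y′)) :+ :- (:- (x :+ x′)))) refl h₀ h₁ h₂ r s x y))
        (modulo₁ (- 1#) (≡⇒-≡0 (cong proj₂ (M² (x , y)))) (solve 7 (λ h₀ h₁ h₂ r s x y →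
          let x′ = r :* x :+ :- (s :* (h₂ :* y))
              y′ = s :* (h₀ :* x) :+ (r :+ s :* h₁) :* y
          in s :* (h₀ :* (:- (x :+ x′))) :+ (r :+ s :* h₁) :* (:- (y :+ y′))
            := y :+ (:- :1) :* (s :* (h₀ :* x′) :+ (r :+ s :* h₁) :* y′ :+ :- (:- (y :+ y′)))) refl h₀ h₁ h₂ r s x y))

      T-M : ∀ X → T (M X) (M X) (M X) ≡ T X X X
      T-M X = begin
        T (M X) (M X) (M X)      ≡⟨ T-selfadjoint X (M X) (M X) ⟩
        T X (M (M X)) (M X)      ≡⟨ T-sym X (M (M X)) (M X) ⟩
        T (M X) (M (M X)) X      ≡⟨ T-selfadjoint X (M (M X)) X ⟩
        T X (M (M (M X))) X      ≡⟨ cong (λ Y → T X Y X) (trans (cong M (M² X)) (M-third X)) ⟩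
        T X X X                  ∎
        where open ≡-Reasoning

      M-root : ∀ X → val c X ≡ 0# → val c (M X) ≡ 0#
      M-root X e = *-cancel-≡0 three≢0 (trans (sym (T-diagonal (M X))) (trans (T-M X)
        (trans (T-diagonal X) (trans (cong (three *_) e) (R.zeroʳ _)))))

      -- As `s ≠ 0`, the fixed points of M on the projective line are exactly the roots of h.
      det-M : ∀ X → det X (M X) ≡ s * qval h X
      det-M (x , y) = let (h₀ , h₁ , h₂) = h in solve 7 (λ h₀ h₁ h₂ r s x y →
        :det x y (r :* x :+ :- (s :* (h₂ :* y))) (s :* (h₀ :* x) :+ (r :+ s :* h₁) :* y) := s :* :qval h₀ h₁ h₂ x y) refl h₀ h₁ h₂ r s x y

      det-third : ∀ X → det X (third X) ≡ - det X (M X)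
      det-third (x , y) = let (x′ , y′) = M (x , y) in
        solve 4 (λ x y x′ y′ → :det x y (:- (x :+ x′)) (:- (y :+ y′)) := :- :det x y x′ y′) refl x y x′ y′

      det-M-third : ∀ X → det (M X) (third X) ≡ det X (M X)
      det-M-third (x , y) = let (x′ , y′) = M (x , y) in
        solve 4 (λ x y x′ y′ → :det x′ y′ (:- (x :+ x′)) (:- (y :+ y′)) := :det x y x′ y′) refl x y x′ y′

      det-scale : ∀ k l P Q → det P Q ≡ 0# → det (scale k P) (scale l Q) ≡ 0#
      det-scale k l (x , y) (t , w) e = modulo₁ (k * l) e
        (solve 6 (λ k l x y t w → :det (k :* x) (k :* y) (l :* t) (l :* w) := :0 :+ k :* l :* :det x y t w) refl k l x y t w)

    -- The roots are the orbit X, M X, M² X; the determinants of pairs of these are `s * qval h X`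
    -- up to sign, so the three points are distinct.
    one-root⇒three-roots : ∀ {u} → Root c u → qval h (hom u) ≢ 0# →
      ∃ λ v → ∃ λ w → Root c v × Root c w × u ≢ v × u ≢ w × v ≢ w
    one-root⇒three-roots {u} e h≢0 = v , w , root-v , root-w
      , distinct (1# , scale-1 X) (k , Y≡) det₁ , distinct (1# , scale-1 X) (l , Z≡) det₂ , distinct (k , Y≡) (l , Z≡) det₃
      where
      X Y Z : Pair
      X = hom u
      Y = M X
      Z = third X
      det₁ : det X Y ≢ 0#
      det₁ z = *-≢0 s≢0 h≢0 (trans (sym (det-M X)) z)
      det₂ : det X Z ≢ 0#
      det₂ z = -‿≢0 det₁ (trans (sym (det-third X)) z)
      det₃ : det Y Z ≢ 0#
      det₃ z = det₁ (trans (sym (det-M-third X)) z)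
      det-zeroʳ : ∀ {P} Q → Q ≡ (0# , 0#) → det P Q ≡ 0#
      det-zeroʳ {x , y} _ refl = solve 2 (λ x y → x :* :0 :+ :- (y :* :0) := :0) refl x y
      scale-1 : ∀ P → P ≡ scale 1# P
      scale-1 (x , y) = cong₂ _,_ (sym (R.*-identityˡ x)) (sym (R.*-identityˡ y))
      pointY : ∃ λ v → ∃ λ k → k ≢ 0# × Y ≡ scale k (hom v)
      pointY = hom-surjective Y (det₁ ∘ det-zeroʳ Y)
      pointZ : ∃ λ v → ∃ λ k → k ≢ 0# × Z ≡ scale k (hom v)
      pointZ = hom-surjective Z (det₂ ∘ det-zeroʳ Z)
      v w : Maybe 𝔽
      v = proj₁ pointY
      w = proj₁ pointZ
      k l : 𝔽
      k = proj₁ (proj₂ pointY)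
      l = proj₁ (proj₂ pointZ)
      Y≡ : Y ≡ scale k (hom v)
      Y≡ = proj₂ (proj₂ (proj₂ pointY))
      Z≡ : Z ≡ scale l (hom w)
      Z≡ = proj₂ (proj₂ (proj₂ pointZ))
      root-scale : ∀ {Y k} v → k ≢ 0# → Y ≡ scale k (hom v) → val c Y ≡ 0# → Root c v
      root-scale {k = k} v k≢0 refl e = *-cancel-≡0 (*-≢0 (*-≢0 k≢0 k≢0) k≢0) (trans (sym (val-scale c k (hom v))) e)
      root-v : Root c v
      root-v = root-scale v (proj₁ (proj₂ (proj₂ pointY))) Y≡ (M-root X e)
      root-w : Root c w
      root-w = root-scale w (proj₁ (proj₂ (proj₂ pointZ))) Z≡
        (subst (λ Z → val c Z ≡ 0#) (M² X) (M-root Y (M-root X e)))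
      distinct : ∀ {P Q a b} → (∃ λ k → P ≡ scale k (hom a)) → (∃ λ l → Q ≡ scale l (hom b)) → det P Q ≢ 0# → a ≢ b
      distinct (k , refl) (l , refl) d refl = d (det-scale k l _ _ (det-self _))

  -- Pairing c with the two spanning points for the square of a linear form gives the partial
  -- derivatives of the cubic at `P`. Both vanish, so `u` is a double root. The remaining root
  -- differs from `u`, since a triple root would make the Hessian zero.
  double-root : ∀ {c u} → NonZeroV c → hess c ≢ zeroQ → Apolar (chord (hom u) (hom u)) c →
    ∃ λ v → u ≢ v × Root c u × Root c v × (∀ x → Root c x → x ≡ u ⊎ x ≡ v)
  double-root {c} {u} c≢0 hess≢0 ap@(e₁ , e₂) = v , u≢v , root-u , root-v , roots
    where
    P : Pair
    P = hom u
    euler : ∀ c P → three * val c P ≡ proj₁ P * dot c (axis₁ (chord P P)) + proj₂ P * dot c (axis₂ (chord P P))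
    euler ⟨ c₀ , c₁ , c₂ , c₃ ⟩ (t , w) = solve 6 (λ c₀ c₁ c₂ c₃ t w → :3 :* :val c₀ c₁ c₂ c₃ t w
      := t :* :a₁ c₀ c₁ c₂ c₃ (w :* w) (:- (w :* t :+ t :* w)) (t :* t) :+ w :* :a₂ c₀ c₁ c₂ c₃ (w :* w) (:- (w :* t :+ t :* w)) (t :* t))
      refl c₀ c₁ c₂ c₃ t w
    root-u : Root c u
    root-u = *-cancel-≡0 three≢0 (trans (euler c P) (trans (cong₂ (λ a b → proj₁ P * a + proj₂ P * b) e₁ e₂)
      (solve 2 (λ t w → t :* :0 :+ w :* :0 := :0) refl (proj₁ P) (proj₂ P))))
    g : Quadratic
    g = proj₁ (factor₂ c u root-u)
    c≡g : c ≡ mul₂ P g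
    c≡g = proj₂ (factor₂ c u root-u)
    derivative₁ : ∀ P g → dot (mul₂ P g) (axis₁ (chord P P)) ≡ proj₂ P * qval g P
    derivative₁ (t , w) (g₀ , g₁ , g₂) = solve 5 (λ t w g₀ g₁ g₂ →
      :a₁ (w :* g₀) (w :* g₁ :+ :- (t :* g₀)) (w :* g₂ :+ :- (t :* g₁)) (:- (t :* g₂)) (w :* w) (:- (w :* t :+ t :* w)) (t :* t)
      := w :* :qval g₀ g₁ g₂ t w) refl t w g₀ g₁ g₂
    derivative₂ : ∀ P g → dot (mul₂ P g) (axis₂ (chord P P)) ≡ - proj₁ P * qval g P
    derivative₂ (t , w) (g₀ , g₁ , g₂) = solve 5 (λ t w g₀ g₁ g₂ →
      :a₂ (w :* g₀) (w :* g₁ :+ :- (t :* g₀)) (w :* g₂ :+ :- (t :* g₁)) (:- (t :* g₂)) (w :* w) (:- (w :* t :+ t :* w)) (t :* t)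
      := :- t :* :qval g₀ g₁ g₂ t w) refl t w g₀ g₁ g₂
    g-root : ∀ u → let P = hom u in proj₂ P * qval g P ≡ 0# → - proj₁ P * qval g P ≡ 0# → qval g P ≡ 0#
    g-root (just t) e _ = *-cancel-≡0 (0≢1 ∘ sym) e
    g-root nothing _ e = *-cancel-≡0 (-‿≢0 (-‿≢0 (0≢1 ∘ sym))) e
    factor : ∃ λ m → g ≡ mul₁ P m
    factor = factor₁ g u (g-root u
      (trans (sym (derivative₁ P g)) (trans (cong (λ c → dot c (axis₁ (chord P P))) (sym c≡g)) e₁))
      (trans (sym (derivative₂ P g)) (trans (cong (λ c → dot c (axis₂ (chord P P))) (sym c≡g)) e₂)))
    m : Pair
    m = proj₁ factor
    c≡m : c ≡ mul₂ P (mul₁ P m)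
    c≡m = trans c≡g (cong (mul₂ P) (proj₂ factor))
    line : ∃ λ w → ∃ λ k → k ≢ 0# × (∀ R → lval m R ≡ k * det R (hom w)) × m ≡ (k * proj₂ (hom w) , - (k * proj₁ (hom w)))
    line = third-factor {u = u} {u} c≢0 c≡m
    v : Maybe 𝔽
    v = proj₁ line
    k : 𝔽
    k = proj₁ (proj₂ line)
    m-val : ∀ R → lval m R ≡ k * det R (hom v)
    m-val = proj₁ (proj₂ (proj₂ (proj₂ line)))
    root-v : Root c v
    root-v = trans (cong (λ c → val c (hom v)) c≡m) (trans (mul₂-val P (mul₁ P m) (hom v))
      (trans (cong (det (hom v) P *_) (trans (mul₁-val P m (hom v))
        (trans (cong (det (hom v) P *_) (trans (m-val (hom v)) (trans (cong (k *_) (det-self (hom v))) (R.zeroʳ k)))) (R.zeroʳ _)))) (R.zeroʳ _)))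
    roots : ∀ x → Root c x → x ≡ u ⊎ x ≡ v
    roots x e = [ inj₁ , id ]′ (factors-root {c} c≡m (proj₁ (proj₂ (proj₂ line))) m-val x e)
    cube : ∀ P k → mul₂ P (mul₁ P (k * proj₂ P , - (k * proj₁ P))) ≡ k • γ P
    cube (t , w) k = quad-≡
      (solve 3 (λ t w k → w :* (w :* (k :* w)) := k :* (w :* w :* w)) refl t w k)
      (solve 3 (λ t w k → w :* (w :* (:- (k :* t)) :+ :- (t :* (k :* w))) :+ :- (t :* (w :* (k :* w))) := k :* (:- (:3 :* (w :* w :* t)))) refl t w k)
      (solve 3 (λ t w k → w :* (:- (t :* (:- (k :* t)))) :+ :- (t :* (w :* (:- (k :* t)) :+ :- (t :* (k :* w)))) := k :* (:3 :* (w :* t :* t))) refl t w k)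
      (solve 3 (λ t w k → :- (t :* (:- (t :* (:- (k :* t))))) := k :* (:- (t :* t :* t))) refl t w k)
    u≢v : u ≢ v
    u≢v u≡v = hess≢0 (trans (cong hess (trans c≡m (trans (cong (λ m → mul₂ P (mul₁ P m))
      (trans (proj₂ (proj₂ (proj₂ (proj₂ line)))) (cong (λ Q → k * proj₂ Q , - (k * proj₁ Q)) (cong hom (sym u≡v))))) (cube P k)))) (hess-cube k P))

  -- Writes an apolar cubic as a combination of the cubes `γ P` and `γ Q`. The coefficients are
  -- forced by evaluating at `Q` and at `P`, where the other cube takes the value `− D³` or `D³`;
  -- multiplying by `D³` clears denominators.
  chord-span : ∀ {c} P Q → Apolar (chord P Q) c → let D = det P Q ; D³ = D * D * D in
    ∀ x → D³ * dot c x ≡ - val c Q * dot (γ P) x + val c P * dot (γ Q) x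
  chord-span {⟨ c₀ , c₁ , c₂ , c₃ ⟩} (t , w) (t′ , w′) (e₁ , e₂) ⟨ x₀ , x₁ , x₂ , x₃ ⟩ = modulo₂ k₁ k₂ e₁ e₂
    (solve 12 (λ c₀ c₁ c₂ c₃ t w t′ w′ x₀ x₁ x₂ x₃ →
      let D = :det t w t′ w′
          D³ = D :* D :* D
          h₀ = w :* w′
          h₁ = :- (w :* t′ :+ t :* w′)
          h₂ = t :* t′
          N = t :* t :* (w′ :* w′) :+ :- (w :* w :* (t′ :* t′))
      in D³ :* :dot c₀ c₁ c₂ c₃ x₀ x₁ x₂ x₃ :=
        :- :val c₀ c₁ c₂ c₃ t′ w′ :* :dot (w :* w :* w) (:- (:3 :* (w :* w :* t))) (:3 :* (w :* t :* t)) (:- (t :* t :* t)) x₀ x₁ x₂ x₃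
        :+ :val c₀ c₁ c₂ c₃ t w :* :dot (w′ :* w′ :* w′) (:- (:3 :* (w′ :* w′ :* t′))) (:3 :* (w′ :* t′ :* t′)) (:- (t′ :* t′ :* t′)) x₀ x₁ x₂ x₃
        :+ (:- (w :* w′ :* D :* x₀) :+ N :* x₁ :+ :- (t :* t′ :* D :* x₂)) :* :a₁ c₀ c₁ c₂ c₃ h₀ h₁ h₂
        :+ (:- (w :* w′ :* D :* x₁) :+ N :* x₂ :+ :- (t :* t′ :* D :* x₃)) :* :a₂ c₀ c₁ c₂ c₃ h₀ h₁ h₂)
      refl c₀ c₁ c₂ c₃ t w t′ w′ x₀ x₁ x₂ x₃)
    where
    D N k₁ k₂ : 𝔽
    D = det (t , w) (t′ , w′)
    N = t * t * (w′ * w′) + - (w * w * (t′ * t′))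
    k₁ = - (w * w′ * D * x₀) + N * x₁ + - (t * t′ * D * x₂)
    k₂ = - (w * w′ * D * x₁) + N * x₂ + - (t * t′ * D * x₃)

  -- Counting the points of the cubic on a plane

  _≟P_ : DecidableEquality (Maybe 𝔽)
  _≟P_ = Maybe-≡-dec _≟_

  points : List (Maybe 𝔽)
  points = nothing ∷ map just elements

  points-unique : Unique points
  points-unique = Allₚ.map⁺ (All.tabulate λ _ ()) ∷ Uniqueₚ.map⁺ just-injective elements-unique

  points-complete : ∀ u → u ∈ points
  points-complete nothing  = here refl
  points-complete (just t) = there (∈-map⁺ just (elements-complete t))

  points-length : length points ≡ suc q
  points-length = cong suc (trans (length-map just elements) elements-length)

  root? : ∀ c u → Dec (Root c u)
  root? c u = val c (hom u) ≟ 0#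

  #roots : V → ℕ
  #roots c = count (root? c) points

  #roots-exactly : ∀ c {ys} → Unique ys → (∀ {x} → x ∈ ys → Root c x) → (∀ x → Root c x → x ∈ ys) → #roots c ≡ length ys
  #roots-exactly c uniq into onto = count-exactly (root? c) points-unique uniq
    (λ i → points-complete _ , into i) (λ {x} _ → onto x)

  none⇒#roots≡0 : ∀ c → (∀ u → ¬ Root c u) → #roots c ≡ 0
  none⇒#roots≡0 c none = #roots-exactly c [] (λ ()) λ u r → contradiction r (none u)

  one⇒#roots≡1 : ∀ c {u} → Root c u → (∀ x → Root c x → x ≡ u) → #roots c ≡ 1
  one⇒#roots≡1 c {u} r only = #roots-exactly c {u ∷ []} ([] ∷ []) (λ { (here refl) → r }) (λ x → here ∘ only x)

  OnPlane⇒Root : ∀ c u → OnPlane c (Pt u) → Root c u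
  OnPlane⇒Root c u e = let (ε , _ , eq) = val-hom c u in trans eq (trans (cong (ε *_) e) (R.zeroʳ ε))

  Root⇒OnPlane : ∀ c u → Root c u → OnPlane c (Pt u)
  Root⇒OnPlane c u e = let (ε , ε≢0 , eq) = val-hom c u in *-cancel-≡0 ε≢0 (trans (sym eq) e)

  Pt-injective : ∀ u v → SamePoint (Pt u) (Pt v) → u ≡ v
  Pt-injective (just t) (just s) (k , e) = cong just (sym (trans (cong Quad.x₂ e)
    (trans (cong (_* t) (trans (sym (R.*-identityʳ k)) (sym (cong Quad.x₃ e)))) (R.*-identityˡ t))))
  Pt-injective (just t) nothing (k , e) = contradiction
    (trans (sym (R.zeroˡ _)) (trans (cong (_* (t * t * t)) (trans (cong Quad.x₃ e) (R.*-identityʳ k))) (sym (cong Quad.x₀ e)))) 0≢1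
  Pt-injective nothing (just s) (k , e) = contradiction (sym (trans (cong Quad.x₃ e) (R.zeroʳ k))) 0≢1
  Pt-injective nothing nothing _ = refl

  CPointsOn⇒#roots : ∀ {c n} → CPointsOn c n → #roots c ≡ n
  CPointsOn⇒#roots {c} (us , refl , all , sep , cover) = #roots-exactly c
    (AllPairs.map (λ { {u} ¬same refl → ¬same (Proportional-refl (Pt u)) }) sep)
    (λ {u} i → OnPlane⇒Root c u (All.lookup all i))
    (λ u r → Any.map (λ {v} → Pt-injective u v) (cover u (Root⇒OnPlane c u r)))

  #roots⇒CPointsOn : ∀ c → CPointsOn c (#roots c)
  #roots⇒CPointsOn c = filter (root? c) points , refl ,
    All.tabulate (λ {u} i → Root⇒OnPlane c u (proj₂ (∈-filter⁻ (root? c) {xs = points} i))) ,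
    AllPairs.map (λ {u} {v} u≢v same → u≢v (Pt-injective u v same)) (Uniqueₚ.filter⁺ (root? c) points-unique) ,
    λ u e → lose (∈-filter⁺ (root? c) (points-complete u) (OnPlane⇒Root c u e)) (Proportional-refl (Pt u))

  -- Degenerate planes

  Γ≢0 : ∀ u → NonZeroV (Γ u)
  Γ≢0 (just t) e = 0≢1 (sym (cong Quad.x₀ e))
  Γ≢0 nothing e  = 0≢1 (sym (cong Quad.x₃ e))

  Γ-root : ∀ u v → Root (Γ u) v → v ≡ u
  Γ-root u v e = det-hom v u ([ (λ e → [ id , id ]′ (*-≡0 (det (hom v) (hom u)) e)) , id ]′
    (*-≡0 (det (hom v) (hom u) * det (hom v) (hom u))
      (trans (sym (val-γ (hom u) (hom v))) (trans (cong (λ c → val c (hom v)) (sym (Γ-hom u))) e))))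

  Γ-self-root : ∀ u → Root (Γ u) u
  Γ-self-root u = trans (cong (λ c → val c (hom u)) (Γ-hom u)) (trans (val-γ (hom u) (hom u))
    (trans (cong (λ d → d * d * d) (det-self (hom u))) (R.zeroʳ (0# * 0#))))

  hess-multiple-of-Γ : ∀ {c} k u → c ≡ k • Γ u → hess c ≡ zeroQ
  hess-multiple-of-Γ k u refl = trans (cong (λ c → hess (k • c)) (Γ-hom u)) (hess-cube k (hom u))

  IsΓPlane⇒hess≡0 : ∀ {c} → IsΓPlane c → hess c ≡ zeroQ
  IsΓPlane⇒hess≡0 (_ , u , p@(k , e)) = hess-multiple-of-Γ (k ⁻¹) u (•-invert (Proportional-scalar≢0 (Γ≢0 u) p) e)

  hess≡0⇒IsΓPlane : ∀ {c} → NonZeroV c → hess c ≡ zeroQ → IsΓPlane c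
  hess≡0⇒IsΓPlane {c} c≢0 h≡0 = let (u , k , k≢0 , e) = hess≡0⇒cube c c≢0 h≡0 in
    c≢0 , u , (k ⁻¹ , •-invert k≢0 e)

  hess≡0⇒#roots≡1 : ∀ {c} → NonZeroV c → hess c ≡ zeroQ → #roots c ≡ 1
  hess≡0⇒#roots≡1 {c} c≢0 h≡0 = let (u , k , k≢0 , e) = hess≡0⇒cube c c≢0 h≡0 in
    one⇒#roots≡1 c {u}
      (trans (cong (λ c → val c (hom u)) e) (trans (dot-• k (Γ u) _) (trans (cong (k *_) (Γ-self-root u)) (R.zeroʳ k))))
      (λ x r → Γ-root u x (*-cancel-≡0 k≢0 (trans (sym (dot-• k (Γ u) _)) (trans (cong (λ c → val c (hom x)) (sym e)) r))))

  Nondegenerate : V → Set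
  Nondegenerate c = NonZeroV c × hess c ≢ zeroQ

  #roots≤3 : ∀ {c} → NonZeroV c → ∀ {us} → Unique us → (∀ {u} → u ∈ us → Root c u) → length us ≤ 3
  #roots≤3 c≢0 {[]} _ _ = z≤n
  #roots≤3 c≢0 {_ ∷ []} _ _ = s≤s z≤n
  #roots≤3 c≢0 {_ ∷ _ ∷ []} _ _ = s≤s (s≤s z≤n)
  #roots≤3 c≢0 {_ ∷ _ ∷ _ ∷ []} _ _ = s≤s (s≤s (s≤s z≤n))
  #roots≤3 {c} c≢0 {u ∷ v ∷ x ∷ y ∷ _} ((u≢v ∷ u≢x ∷ u≢y ∷ _) ∷ (v≢x ∷ v≢y ∷ _) ∷ (x≢y ∷ _) ∷ _) root =
    let (w , only) = third-root c≢0 u≢v (root (here refl)) (root (there (here refl)))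
        is-w : ∀ z → u ≢ z → v ≢ z → Root c z → z ≡ w
        is-w z u≢z v≢z r = [ (λ e → contradiction (sym e) u≢z) , [ (λ e → contradiction (sym e) v≢z) , id ]′ ]′ (only z r)
    in contradiction (trans (is-w x u≢x v≢x (root (there (there (here refl)))))
                       (sym (is-w y u≢y v≢y (root (there (there (there (here refl)))))))) x≢y

  three⇒#roots≡3 : ∀ {c u v w} → NonZeroV c → Root c u → Root c v → Root c w → u ≢ v → u ≢ w → v ≢ w → #roots c ≡ 3
  three⇒#roots≡3 {c} {u} {v} {w} c≢0 ru rv rw u≢v u≢w v≢w = ℕ.≤-antisym
    (#roots≤3 c≢0 (Uniqueₚ.filter⁺ (root? c) points-unique) λ i → proj₂ (∈-filter⁻ (root? c) {xs = points} i))
    (unique-⊆⇒length≤ {xs = u ∷ v ∷ w ∷ []} ((u≢v ∷ u≢w ∷ []) ∷ (v≢w ∷ []) ∷ [] ∷ [])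
      λ { (here refl) → ∈-filter⁺ (root? c) (points-complete u) ru
        ; (there (here refl)) → ∈-filter⁺ (root? c) (points-complete v) rv
        ; (there (there (here refl))) → ∈-filter⁺ (root? c) (points-complete w) rw })

  -- The axis in a nondegenerate plane

  monic : 𝔽 → 𝔽 → Quadratic
  monic a b = 1# , - a , b

  HasRealAxis HasImaginaryAxis : V → Set
  HasRealAxis c      = ∃ λ u → ∃ λ v → u ≢ v × Apolar (chord (hom u) (hom v)) c
  HasImaginaryAxis c = ∃ λ a → ∃ λ b → Rootless a b × Apolar (monic a b) c

  apolar-scale : ∀ {h h′ c} k → k ≢ 0# → h ≡ (k * proj₁ h′ , k * proj₁ (proj₂ h′) , k * proj₂ (proj₂ h′)) → Apolar h c → Apolar h′ c
  apolar-scale {h′ = h₀ , h₁ , h₂} {⟨ c₀ , c₁ , c₂ , c₃ ⟩} k k≢0 refl (e₁ , e₂) =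
    *-cancel-≡0 k≢0 (trans (solve 8 (λ c₀ c₁ c₂ c₃ h₀ h₁ h₂ k → k :* :a₁ c₀ c₁ c₂ c₃ h₀ h₁ h₂
      := :a₁ c₀ c₁ c₂ c₃ (k :* h₀) (k :* h₁) (k :* h₂)) refl c₀ c₁ c₂ c₃ h₀ h₁ h₂ k) e₁) ,
    *-cancel-≡0 k≢0 (trans (solve 8 (λ c₀ c₁ c₂ c₃ h₀ h₁ h₂ k → k :* :a₂ c₀ c₁ c₂ c₃ h₀ h₁ h₂
      := :a₂ c₀ c₁ c₂ c₃ (k :* h₀) (k :* h₁) (k :* h₂)) refl c₀ c₁ c₂ c₃ h₀ h₁ h₂ k) e₂)

  private
    split-hessian : ∀ {c} → Nondegenerate c → ∀ u → qval (hess c) (hom u) ≡ 0# → HasRealAxis c ⊎ #roots c ≡ 2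
    split-hessian {c} (c≢0 , h≢0) u e = go (u ≟P v)
      where
      P : Pair
      P = hom u
      m : Pair
      m = proj₁ (factor₁ (hess c) u e)
      h≡ : hess c ≡ mul₁ P m
      h≡ = proj₂ (factor₁ (hess c) u e)
      m≢0 : m ≢ (0# , 0#)
      m≢0 m≡0 = h≢0 (trans h≡ (trans (cong (mul₁ P) m≡0) (cong₂ _,_ (R.zeroʳ _) (cong₂ _,_
        (solve 2 (λ t w → w :* :0 :+ :- (t :* :0) := :0) refl (proj₁ P) (proj₂ P))
        (solve 1 (λ t → :- (t :* :0) := :0) refl (proj₁ P))))))
      line : ∃ λ v → ∃ λ k → k ≢ 0# × (∀ R → lval m R ≡ k * det R (hom v)) × m ≡ (k * proj₂ (hom v) , - (k * proj₁ (hom v)))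
      line = linear-root m m≢0
      v : Maybe 𝔽
      v = proj₁ line
      k : 𝔽
      k = proj₁ (proj₂ line)
      mul-chord : ∀ P Q k → let (h₀ , h₁ , h₂) = chord P Q in mul₁ P (k * proj₂ Q , - (k * proj₁ Q)) ≡ (k * h₀ , k * h₁ , k * h₂)
      mul-chord (t , w) (t′ , w′) k = cong₂ _,_ (solve 3 (λ k w w′ → w :* (k :* w′) := k :* (w :* w′)) refl k w w′) (cong₂ _,_
        (solve 5 (λ k t w t′ w′ → w :* (:- (k :* t′)) :+ :- (t :* (k :* w′)) := k :* (:- (w :* t′ :+ t :* w′))) refl k t w t′ w′)
        (solve 3 (λ k t t′ → :- (t :* (:- (k :* t′))) := k :* (t :* t′)) refl k t t′))
      apolar : Apolar (chord P (hom v)) c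
      apolar = apolar-scale {h = hess c} {c = c} k (proj₁ (proj₂ (proj₂ line)))
        (trans h≡ (trans (cong (mul₁ P) (proj₂ (proj₂ (proj₂ (proj₂ line))))) (mul-chord P (hom v) k))) (hess-apolar c)
      go : Dec (u ≡ v) → HasRealAxis c ⊎ #roots c ≡ 2
      go (no u≢v)  = inj₁ (u , v , u≢v , apolar)
      go (yes u≡v) =
        let (v′ , u≢v′ , ru , rv , only) = double-root {c} {u} c≢0 h≢0 (subst (λ v → Apolar (chord P (hom v)) c) (sym u≡v) apolar)
        in inj₂ (#roots-exactly c {u ∷ v′ ∷ []} ((u≢v′ ∷ []) ∷ [] ∷ [])
          (λ { (here refl) → ru ; (there (here refl)) → rv })
          (λ x r → [ here , there ∘ here ]′ (only x r)))

    irreducible-hessian : ∀ {c} → Nondegenerate c → (∀ u → qval (hess c) (hom u) ≢ 0#) → HasImaginaryAxis c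
    irreducible-hessian {c} _ none = a , b , rootless , apolar-scale {h = hess c} {c = c} h₀ h₀≢0
        (cong₂ _,_ (sym (R.*-identityʳ h₀)) (cong₂ _,_
          (modulo₁ (- h₁) (≡⇒-≡0 (*-inverse h₀≢0)) (solve 3 (λ h₀ h₁ i → h₁ := h₀ :* (:- (:- (h₁ :* i))) :+ (:- h₁) :* (h₀ :* i :+ :- :1)) refl h₀ h₁ (h₀ ⁻¹)))
          (modulo₁ (- h₂) (≡⇒-≡0 (*-inverse h₀≢0)) (solve 3 (λ h₀ h₂ i → h₂ := h₀ :* (h₂ :* i) :+ (:- h₂) :* (h₀ :* i :+ :- :1)) refl h₀ h₂ (h₀ ⁻¹)))))
        (hess-apolar c)
      where
      h₀ h₁ h₂ a b : 𝔽
      h₀ = proj₁ (hess c)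
      h₁ = proj₁ (proj₂ (hess c))
      h₂ = proj₂ (proj₂ (hess c))
      a = - (h₁ * h₀ ⁻¹)
      b = h₂ * h₀ ⁻¹
      h₀≢0 : h₀ ≢ 0#
      h₀≢0 e = none nothing (trans (solve 3 (λ h₀ h₁ h₂ → :qval h₀ h₁ h₂ (:- :1) :0 := h₀) refl h₀ h₁ h₂) e)
      rootless : Rootless a b
      rootless t e = none (just t) (modulo₂ h₀ (- (h₁ * t + h₂)) e (≡⇒-≡0 (*-inverse h₀≢0))
        (solve 5 (λ h₀ h₁ h₂ t i → :qval h₀ h₁ h₂ t :1 := :0 :+ h₀ :* (t :* t :+ :- ((:- (h₁ :* i)) :* t) :+ h₂ :* i)
          :+ (:- (h₁ :* t :+ h₂)) :* (h₀ :* i :+ :- :1)) refl h₀ h₁ h₂ t (h₀ ⁻¹)))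

  axis-in-plane : ∀ {c} → Nondegenerate c → HasRealAxis c ⊎ HasImaginaryAxis c ⊎ #roots c ≡ 2
  axis-in-plane {c} nd = go (any? (λ u → qval (hess c) (hom u) ≟ 0#) points)
    where
    go : Dec (Any (λ u → qval (hess c) (hom u) ≡ 0#) points) → HasRealAxis c ⊎ HasImaginaryAxis c ⊎ #roots c ≡ 2
    go (yes i) = let (u , _ , e) = find i in [ inj₁ , inj₂ ∘ inj₂ ]′ (split-hessian nd u e)
    go (no ¬i) = inj₂ (inj₁ (irreducible-hessian nd λ u e → ¬i (lose (points-complete u) e)))

  -- Pencils of planes

  infixl 6 _⊞_
  _⊞_ : V → V → V
  ⟨ a , b , c , d ⟩ ⊞ ⟨ a′ , b′ , c′ , d′ ⟩ = ⟨ a + a′ , b + b′ , c + c′ , d + d′ ⟩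

  dot-combination : ∀ α β a b x → dot (α • a ⊞ β • b) x ≡ α * dot a x + β * dot b x
  dot-combination α β ⟨ a₀ , a₁ , a₂ , a₃ ⟩ ⟨ b₀ , b₁ , b₂ , b₃ ⟩ ⟨ x₀ , x₁ , x₂ , x₃ ⟩ =
    solve 14 (λ α β a₀ a₁ a₂ a₃ b₀ b₁ b₂ b₃ x₀ x₁ x₂ x₃ →
      :dot (α :* a₀ :+ β :* b₀) (α :* a₁ :+ β :* b₁) (α :* a₂ :+ β :* b₂) (α :* a₃ :+ β :* b₃) x₀ x₁ x₂ x₃
      := α :* :dot a₀ a₁ a₂ a₃ x₀ x₁ x₂ x₃ :+ β :* :dot b₀ b₁ b₂ b₃ x₀ x₁ x₂ x₃) refl α β a₀ a₁ a₂ a₃ b₀ b₁ b₂ b₃ x₀ x₁ x₂ x₃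

  dot-ext : ∀ {c d} → (∀ x → dot c x ≡ dot d x) → c ≡ d
  dot-ext {c} {d} e = quad-≡
    (trans (sym (p₀ c)) (trans (e _) (p₀ d))) (trans (sym (p₁ c)) (trans (e _) (p₁ d)))
    (trans (sym (p₂ c)) (trans (e _) (p₂ d))) (trans (sym (p₃ c)) (trans (e _) (p₃ d)))
    where
    p₀ : ∀ c → dot c ⟨ 1# , 0# , 0# , 0# ⟩ ≡ Quad.x₀ c
    p₀ ⟨ c₀ , c₁ , c₂ , c₃ ⟩ = solve 4 (λ c₀ c₁ c₂ c₃ → :dot c₀ c₁ c₂ c₃ :1 :0 :0 :0 := c₀) refl c₀ c₁ c₂ c₃
    p₁ : ∀ c → dot c ⟨ 0# , 1# , 0# , 0# ⟩ ≡ Quad.x₁ c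
    p₁ ⟨ c₀ , c₁ , c₂ , c₃ ⟩ = solve 4 (λ c₀ c₁ c₂ c₃ → :dot c₀ c₁ c₂ c₃ :0 :1 :0 :0 := c₁) refl c₀ c₁ c₂ c₃
    p₂ : ∀ c → dot c ⟨ 0# , 0# , 1# , 0# ⟩ ≡ Quad.x₂ c
    p₂ ⟨ c₀ , c₁ , c₂ , c₃ ⟩ = solve 4 (λ c₀ c₁ c₂ c₃ → :dot c₀ c₁ c₂ c₃ :0 :0 :1 :0 := c₂) refl c₀ c₁ c₂ c₃
    p₃ : ∀ c → dot c ⟨ 0# , 0# , 0# , 1# ⟩ ≡ Quad.x₃ c
    p₃ ⟨ c₀ , c₁ , c₂ , c₃ ⟩ = solve 4 (λ c₀ c₁ c₂ c₃ → :dot c₀ c₁ c₂ c₃ :0 :0 :0 :1 := c₃) refl c₀ c₁ c₂ c₃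

  combination-zero : ∀ {a b} → 0# • a ⊞ 0# • b ≡ zeroV
  combination-zero {⟨ a₀ , a₁ , a₂ , a₃ ⟩} {⟨ b₀ , b₁ , b₂ , b₃ ⟩} = quad-≡ (z a₀ b₀) (z a₁ b₁) (z a₂ b₂) (z a₃ b₃)
    where
    z : ∀ a b → 0# * a + 0# * b ≡ 0#
    z = solve 2 (λ a b → :0 :* a :+ :0 :* b := :0) refl

  combination-minus : ∀ α β α′ β′ {a b} → α • a ⊞ β • b ≡ α′ • a ⊞ β′ • b → (α + - α′) • a ⊞ (β + - β′) • b ≡ zeroV
  combination-minus α β α′ β′ {⟨ a₀ , a₁ , a₂ , a₃ ⟩} {⟨ b₀ , b₁ , b₂ , b₃ ⟩} e =
    quad-≡ (z a₀ b₀ (cong Quad.x₀ e)) (z a₁ b₁ (cong Quad.x₁ e)) (z a₂ b₂ (cong Quad.x₂ e)) (z a₃ b₃ (cong Quad.x₃ e))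
    where
    z : ∀ a b → α * a + β * b ≡ α′ * a + β′ * b → (α + - α′) * a + (β + - β′) * b ≡ 0#
    z a b e = modulo₁ 1# (≡⇒-≡0 e) (solve 6 (λ α β α′ β′ a b →
      (α :+ :- α′) :* a :+ (β :+ :- β′) :* b := :0 :+ :1 :* (α :* a :+ β :* b :+ :- (α′ :* a :+ β′ :* b))) refl α β α′ β′ a b)

  •-combination : ∀ k α β {a b} → k • (α • a ⊞ β • b) ≡ (k * α) • a ⊞ (k * β) • b
  •-combination k α β {⟨ a₀ , a₁ , a₂ , a₃ ⟩} {⟨ b₀ , b₁ , b₂ , b₃ ⟩} = quad-≡ (z a₀ b₀) (z a₁ b₁) (z a₂ b₂) (z a₃ b₃)
    where
    z : ∀ a b → k * (α * a + β * b) ≡ k * α * a + k * β * b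
    z = solve 5 (λ k α β a b → k :* (α :* a :+ β :* b) := k :* α :* a :+ k :* β :* b) refl k α β

  left-combination : ∀ {a b} → 1# • a ⊞ 0# • b ≡ a
  left-combination {⟨ a₀ , a₁ , a₂ , a₃ ⟩} {⟨ b₀ , b₁ , b₂ , b₃ ⟩} = quad-≡ (z a₀ b₀) (z a₁ b₁) (z a₂ b₂) (z a₃ b₃)
    where
    z : ∀ a b → 1# * a + 0# * b ≡ a
    z = solve 2 (λ a b → :1 :* a :+ :0 :* b := a) refl

  right-combination : ∀ {a b} → 0# • a ⊞ 1# • b ≡ b
  right-combination {⟨ a₀ , a₁ , a₂ , a₃ ⟩} {⟨ b₀ , b₁ , b₂ , b₃ ⟩} = quad-≡ (z a₀ b₀) (z a₁ b₁) (z a₂ b₂) (z a₃ b₃)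
    where
    z : ∀ a b → 0# * a + 1# * b ≡ b
    z = solve 2 (λ a b → :0 :* a :+ :1 :* b := b) refl

  -- The nondegenerate planes through the axis of h; apolarity expresses the incidence, as
  -- `inPlane⇒apolar` and `apolar⇒inPlane` show.
  Good : Quadratic → V → Set
  Good h p = Nondegenerate p × Apolar h p

  -- Such a plane is a multiple of some `Γ w`, and a cube is apolar to h only if its root is a root
  -- of h.
  degenerate⇒base-root : ∀ {h p} → NonZeroV p → Apolar h p → hess p ≡ zeroQ →
    ∃ λ w → Root p w × (∀ x → Root p x → x ≡ w) × qval h (hom w) ≡ 0#
  degenerate⇒base-root {h} {p} p≢0 ap hess≡0 = w
    , trans (cong (λ c → val c (hom w)) e) (trans (dot-• k (Γ w) _) (trans (cong (k *_) (Γ-self-root w)) (R.zeroʳ k)))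
    , (λ x r → Γ-root w x (*-cancel-≡0 k≢0 (trans (sym (dot-• k (Γ w) _)) (trans (cong (λ c → val c (hom x)) (sym e)) r))))
    , apolar-γ⇒root {h} w (subst (Apolar h) (trans (sym (•-invert k≢0 e)) (Γ-hom w)) (apolar-• {h} (k ⁻¹) {p} ap))
    where
    cube : ∃ λ u → ∃ λ k → k ≢ 0# × p ≡ k • Γ u
    cube = hess≡0⇒cube p p≢0 hess≡0
    w : Maybe 𝔽
    w = proj₁ cube
    k : 𝔽
    k = proj₁ (proj₂ cube)
    k≢0 : k ≢ 0#
    k≢0 = proj₁ (proj₂ (proj₂ cube))
    e : p ≡ k • Γ w
    e = proj₂ (proj₂ (proj₂ cube))

  -- The planes through the axis of h as the projective line on a basis `a`, `b`; the axis is the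
  -- meet of these two planes. The interface does not distinguish real from imaginary axes. By
  -- `base-point-free`, a point of the cubic on the axis can only come from a root of h.
  record Pencil (h : Quadratic) : Set where
    field
      a b : V
      apolar-a : Apolar h a
      apolar-b : Apolar h b
      independent : ∀ {α β} → α • a ⊞ β • b ≡ zeroV → α ≡ 0# × β ≡ 0#
      span : ∀ {p} → Apolar h p → ∃ λ α → ∃ λ β → p ≡ α • a ⊞ β • b
      base-point-free : ∀ x → Root a x → Root b x → qval h (hom x) ≡ 0#

    injective : ∀ {α β α′ β′} → α • a ⊞ β • b ≡ α′ • a ⊞ β′ • b → α ≡ α′ × β ≡ β′
    injective e = let (p , r) = independent (combination-minus _ _ _ _ e) in -≡0⇒≡ p , -≡0⇒≡ r

    combination≢0 : ∀ {α β} → α ≢ 0# ⊎ β ≢ 0# → NonZeroV (α • a ⊞ β • b)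
    combination≢0 (inj₁ α≢0) e = α≢0 (proj₁ (independent e))
    combination≢0 (inj₂ β≢0) e = β≢0 (proj₂ (independent e))

    isLine : IsLine (a , b)
    isLine = (λ e → 0≢1 (sym (proj₁ (independent (trans left-combination e))))) ,
      (λ e → 0≢1 (sym (proj₂ (independent (trans right-combination e))))) ,
      λ (k , e) → 0≢1 (sym (proj₂ (injective {0#} {1#} {k} {0#} (trans right-combination
        (trans e (trans (cong (k •_) (sym left-combination)) (trans (•-combination k 1# 0#)
          (cong₂ (λ α β → α • a ⊞ β • b) (R.*-identityʳ k) (R.zeroʳ k)))))))))

    apolar-combination : ∀ α β → Apolar h (α • a ⊞ β • b)
    apolar-combination α β = vanish (axis₁ h) (proj₁ apolar-a) (proj₁ apolar-b) , vanish (axis₂ h) (proj₂ apolar-a) (proj₂ apolar-b)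
      where
      vanish : ∀ x → OnPlane a x → OnPlane b x → OnPlane (α • a ⊞ β • b) x
      vanish x e e′ = trans (dot-combination α β a b x) (trans (cong₂ (λ y z → α * y + β * z) e e′)
        (solve 2 (λ α β → α :* :0 :+ β :* :0 := :0) refl α β))

    -- The two spanning points `axis₁ h` and `axis₂ h` lie on the line. `LineInPlane` speaks of
    -- points only, so the zero vector is treated apart.
    inPlane⇒apolar : ∀ {p} → LineInPlane (a , b) p → Apolar h p
    inPlane⇒apolar {p} inc = at (axis₁ h) (proj₁ apolar-a) (proj₁ apolar-b) , at (axis₂ h) (proj₂ apolar-a) (proj₂ apolar-b)
      where
      dot-zeroV : ∀ p → dot p zeroV ≡ 0#
      dot-zeroV ⟨ c₀ , c₁ , c₂ , c₃ ⟩ = solve 4 (λ c₀ c₁ c₂ c₃ → :dot c₀ c₁ c₂ c₃ :0 :0 :0 :0 := :0) refl c₀ c₁ c₂ c₃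
      at : ∀ x → OnPlane a x → OnPlane b x → OnPlane p x
      at x ea eb with x ≟V zeroV
      ... | yes refl = dot-zeroV p
      ... | no x≢0   = inc x x≢0 (ea , eb)

    apolar⇒inPlane : ∀ {p} → Apolar h p → LineInPlane (a , b) p
    apolar⇒inPlane ap x _ (ea , eb) = let (α , β , e) = span ap in
      trans (cong (λ p → dot p x) e) (trans (dot-combination α β a b x) (trans (cong₂ (λ y z → α * y + β * z) ea eb)
        (solve 2 (λ α β → α :* :0 :+ β :* :0 := :0) refl α β)))

    normal : ∀ {p α β} → α ≢ 0# → p ≡ α • a ⊞ β • b → SamePlane p (1# • a ⊞ (α ⁻¹ * β) • b)
    normal {α = α} {β} α≢0 refl = α ⁻¹ , sym (trans (•-combination (α ⁻¹) α β)
      (cong (λ z → z • a ⊞ (α ⁻¹ * β) • b) (trans (R.*-comm _ α) (*-inverse α≢0))))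

    normal-injective : ∀ {l l′} → SamePlane (1# • a ⊞ l • b) (1# • a ⊞ l′ • b) → l ≡ l′
    normal-injective {l} {l′} (k , e) = let (p , r) = injective {1#} {l′} {k * 1#} {k * l} (trans e (•-combination k 1# l)) in
      sym (trans r (trans (cong (_* l) (sym (trans p (R.*-identityʳ k)))) (R.*-identityˡ l)))

    member : Maybe 𝔽 → V
    member x = val b (hom x) • a ⊞ (- val a (hom x)) • b

    member-root : ∀ x → Root (member x) x
    member-root x = trans (dot-combination _ _ a b (ν (hom x)))
      (solve 2 (λ y z → z :* y :+ (:- y) :* z := :0) refl (val a (hom x)) (val b (hom x)))

    private
      zero? : ∀ α β → (α ≢ 0# ⊎ β ≢ 0#) ⊎ (α ≡ 0# × β ≡ 0#)
      zero? α β with α ≟ 0# | β ≟ 0#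
      ... | no n  | _     = inj₁ (inj₁ n)
      ... | yes _ | no n  = inj₁ (inj₂ n)
      ... | yes p | yes r = inj₂ (p , r)

      -‿≡0 : ∀ y → - y ≡ 0# → y ≡ 0#
      -‿≡0 y e = modulo₁ (- 1#) e (solve 1 (λ y → y := :0 :+ (:- :1) :* (:- y)) refl y)

    apolar⇒nondegenerate : ∀ {p} x → NonZeroV p → Apolar h p → Root p x → qval h (hom x) ≢ 0# → Nondegenerate p
    apolar⇒nondegenerate {p} x p≢0 ap r h≢0 = p≢0 , λ hess≡0 →
      let (w , _ , only , e) = degenerate⇒base-root {h} {p} p≢0 ap hess≡0
      in h≢0 (trans (cong (λ u → qval h (hom u)) (only x r)) e)

    member-good : ∀ x → qval h (hom x) ≢ 0# → Good h (member x)
    member-good x h≢0 = apolar⇒nondegenerate x (combination≢0 nz) (apolar-combination _ _) (member-root x) h≢0 , apolar-combination _ _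
      where
      nz : val b (hom x) ≢ 0# ⊎ - val a (hom x) ≢ 0#
      nz = [ id , (λ (eb , ea) → contradiction (base-point-free x (-‿≡0 _ ea) eb) h≢0) ]′ (zero? _ _)

    -- Off the roots of h the pair `(A , B)` is nonzero; the coefficient pairs of both planes are
    -- orthogonal to it, hence parallel.
    member-unique : ∀ x {p p′} → qval h (hom x) ≢ 0# → Good h p → Good h p′ → Root p x → Root p′ x → SamePlane p p′
    member-unique x {p} {p′} h≢0 ((p≢0 , _) , ap) (_ , ap′) r r′ = same (zero? α β)
      where
      α β α′ β′ A B : 𝔽
      α  = proj₁ (span ap)
      β  = proj₁ (proj₂ (span ap))
      α′ = proj₁ (span ap′)
      β′ = proj₁ (proj₂ (span ap′))
      A = val a (hom x)
      B = val b (hom x)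
      p≡ : p ≡ α • a ⊞ β • b
      p≡ = proj₂ (proj₂ (span ap))
      p′≡ : p′ ≡ α′ • a ⊞ β′ • b
      p′≡ = proj₂ (proj₂ (span ap′))
      eq : α * A + β * B ≡ 0#
      eq = trans (sym (dot-combination α β a b _)) (trans (cong (λ c → val c (hom x)) (sym p≡)) r)
      eq′ : α′ * A + β′ * B ≡ 0#
      eq′ = trans (sym (dot-combination α′ β′ a b _)) (trans (cong (λ c → val c (hom x)) (sym p′≡)) r′)
      parallel : α * β′ + - (β * α′) ≡ 0#
      parallel with zero? A B
      ... | inj₂ (ea , eb)  = contradiction (base-point-free x ea eb) h≢0
      ... | inj₁ (inj₁ A≢0) = *-cancel-≡0 A≢0 (modulo₂ β′ (- β) eq eq′ (solve 6 (λ α β α′ β′ A B →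
        A :* (α :* β′ :+ :- (β :* α′)) := :0 :+ β′ :* (α :* A :+ β :* B) :+ (:- β) :* (α′ :* A :+ β′ :* B)) refl α β α′ β′ A B))
      ... | inj₁ (inj₂ B≢0) = *-cancel-≡0 B≢0 (modulo₂ (- α′) α eq eq′ (solve 6 (λ α β α′ β′ A B →
        B :* (α :* β′ :+ :- (β :* α′)) := :0 :+ (:- α′) :* (α :* A :+ β :* B) :+ α :* (α′ :* A :+ β′ :* B)) refl α β α′ β′ A B))
      same : (α ≢ 0# ⊎ β ≢ 0#) ⊎ (α ≡ 0# × β ≡ 0#) → SamePlane p p′
      same (inj₂ (eα , eβ)) = contradiction (trans p≡ (trans (cong₂ (λ y z → y • a ⊞ z • b) eα eβ) combination-zero)) p≢0
      same (inj₁ (inj₁ α≢0)) = α′ * α ⁻¹ , trans p′≡ (trans (cong₂ (λ y z → y • a ⊞ z • b)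
        (modulo₁ (- α′) (≡⇒-≡0 (*-inverse α≢0)) (solve 3 (λ α α′ i → α′ := α′ :* i :* α :+ (:- α′) :* (α :* i :+ :- :1)) refl α α′ (α ⁻¹)))
        (modulo₂ (α ⁻¹) (- β′) parallel (≡⇒-≡0 (*-inverse α≢0)) (solve 5 (λ α β α′ β′ i → β′ := α′ :* i :* β
          :+ i :* (α :* β′ :+ :- (β :* α′)) :+ (:- β′) :* (α :* i :+ :- :1)) refl α β α′ β′ (α ⁻¹))))
        (sym (trans (cong ((α′ * α ⁻¹) •_) p≡) (•-combination _ α β))))
      same (inj₁ (inj₂ β≢0)) = β′ * β ⁻¹ , trans p′≡ (trans (cong₂ (λ y z → y • a ⊞ z • b)
        (modulo₂ (- (β ⁻¹)) (- α′) parallel (≡⇒-≡0 (*-inverse β≢0)) (solve 5 (λ α β α′ β′ i → α′ := β′ :* i :* α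
          :+ (:- i) :* (α :* β′ :+ :- (β :* α′)) :+ (:- α′) :* (β :* i :+ :- :1)) refl α β α′ β′ (β ⁻¹)))
        (modulo₁ (- β′) (≡⇒-≡0 (*-inverse β≢0)) (solve 3 (λ β β′ i → β′ := β′ :* i :* β :+ (:- β′) :* (β :* i :+ :- :1)) refl β β′ (β ⁻¹))))
        (sym (trans (cong ((β′ * β ⁻¹) •_) p≡) (•-combination _ α β))))

  -- The square of `det P Q` is the discriminant `h₁² − 4 h₀ h₂` of the chord.
  chord≢0 : ∀ P Q → det P Q ≢ 0# → chord P Q ≢ zeroQ
  chord≢0 (t , w) (t′ , w′) d≢0 e = *-≢0 d≢0 d≢0 (modulo₂ (- (w * t′ + t * w′)) (- (1# + 1# + 1# + 1#) * (t * t′)) (cong (proj₁ ∘ proj₂) e) (cong proj₁ e)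
    (solve 4 (λ t w t′ w′ → :det t w t′ w′ :* :det t w t′ w′ := :0
      :+ (:- (w :* t′ :+ t :* w′)) :* (:- (w :* t′ :+ t :* w′)) :+ (:- :4 :* (t :* t′)) :* (w :* w′)) refl t w t′ w′))

  dot-zeroˡ : ∀ x → dot zeroV x ≡ 0#
  dot-zeroˡ ⟨ x₀ , x₁ , x₂ , x₃ ⟩ = solve 4 (λ x₀ x₁ x₂ x₃ → :dot :0 :0 :0 :0 x₀ x₁ x₂ x₃ := :0) refl x₀ x₁ x₂ x₃

  Γ-independent : ∀ {u v} → u ≢ v → ∀ {α β} → α • Γ u ⊞ β • Γ v ≡ zeroV → α ≡ 0# × β ≡ 0#
  Γ-independent {u} {v} u≢v {α} {β} e =
    *-cancel-≡0 (u≢v ∘ sym ∘ Γ-root u v) (modulo₂ 1# (- β) (vanish v) (Γ-self-root v)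
      (solve 4 (λ α β x y → x :* α := :0 :+ :1 :* (α :* x :+ β :* y) :+ (:- β) :* y) refl α β (val (Γ u) (hom v)) (val (Γ v) (hom v)))) ,
    *-cancel-≡0 (u≢v ∘ Γ-root v u) (modulo₂ 1# (- α) (vanish u) (Γ-self-root u)
      (solve 4 (λ α β x y → y :* β := :0 :+ :1 :* (α :* x :+ β :* y) :+ (:- α) :* x) refl α β (val (Γ u) (hom u)) (val (Γ v) (hom u))))
    where
    vanish : ∀ x → α * val (Γ u) (hom x) + β * val (Γ v) (hom x) ≡ 0#
    vanish x = trans (sym (dot-combination α β (Γ u) (Γ v) (ν (hom x)))) (trans (cong (λ c → val c (hom x)) e) (dot-zeroˡ (ν (hom x))))

  chord-root : ∀ u v x → qval (chord (hom u) (hom v)) (hom x) ≡ 0# → x ≡ u ⊎ x ≡ v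
  chord-root u v x e = [ inj₁ ∘ det-hom x u , inj₂ ∘ det-hom x v ]′
    (*-≡0 (det (hom x) (hom u)) (trans (sym (chord-val (hom u) (hom v) (hom x))) e))

  chord-rootˡ : ∀ u v → qval (chord (hom u) (hom v)) (hom u) ≡ 0#
  chord-rootˡ u v = trans (chord-val (hom u) (hom v) (hom u)) (trans (cong (_* det (hom u) (hom v)) (det-self (hom u))) (R.zeroˡ _))

  chord-rootʳ : ∀ u v → qval (chord (hom u) (hom v)) (hom v) ≡ 0#
  chord-rootʳ u v = trans (chord-val (hom u) (hom v) (hom v)) (trans (cong (det (hom v) (hom u) *_) (det-self (hom v))) (R.zeroʳ _))

  realPencil : ∀ {u v} → u ≢ v → Pencil (chord (hom u) (hom v))
  realPencil {u} {v} u≢v = record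
    { a = Γ u
    ; b = Γ v
    ; apolar-a = subst (Apolar h) (sym (Γ-hom u)) (root⇒apolar-γ {h} {hom u} (chord-rootˡ u v))
    ; apolar-b = subst (Apolar h) (sym (Γ-hom v)) (root⇒apolar-γ {h} {hom v} (chord-rootʳ u v))
    ; independent = Γ-independent u≢v
    ; span = λ {p} ap → - val p (hom v) * D³ ⁻¹ , val p (hom u) * D³ ⁻¹ , dot-ext (λ x → *-cancel D³≢0
        (trans (chord-span (hom u) (hom v) ap x) (trans (cong₂ (λ y z → - val p (hom v) * dot y x + val p (hom u) * dot z x) (sym (Γ-hom u)) (sym (Γ-hom v)))
          (sym (trans (cong (D³ *_) (dot-combination _ _ (Γ u) (Γ v) x))
            (modulo₁ (- val p (hom v) * dot (Γ u) x + val p (hom u) * dot (Γ v) x) (≡⇒-≡0 (*-inverse D³≢0))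
              (solve 6 (λ D i s r y z → D :* (:- s :* i :* y :+ r :* i :* z)
                := :- s :* y :+ r :* z :+ (:- s :* y :+ r :* z) :* (D :* i :+ :- :1)) refl D³ (D³ ⁻¹) (val p (hom v)) (val p (hom u)) (dot (Γ u) x) (dot (Γ v) x))))))))
    ; base-point-free = λ x e _ → subst (λ x → qval h (hom x) ≡ 0#) (sym (Γ-root u x e)) (chord-rootˡ u v)
    }
    where
    h : Quadratic
    h = chord (hom u) (hom v)
    D³ : 𝔽
    D³ = det (hom u) (hom v) * det (hom u) (hom v) * det (hom u) (hom v)
    D³≢0 : D³ ≢ 0#
    D³≢0 = *-≢0 (*-≢0 (det-hom≢0 u≢v) (det-hom≢0 u≢v)) (det-hom≢0 u≢v)

  -- The parts of the coefficients of (X - s Y)³ at 1 and at s, after reduction by s² = c s - d.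
  -- They are planes over F.
  imaginary-a imaginary-b : 𝔽 → 𝔽 → V
  imaginary-a c d = ⟨ 1# , 0# , - (three * d) , c * d ⟩
  imaginary-b c d = ⟨ 0# , - three , three * c , - (c * c + - d) ⟩

  imaginaryPencil : ∀ c d → Pencil (monic c d)
  imaginaryPencil c d = record
    { a = imaginary-a c d
    ; b = imaginary-b c d
    ; apolar-a = solve 2 (λ c d → :a₁ :1 :0 (:- (:3 :* d)) (c :* d) :1 (:- c) d := :0) refl c d
               , solve 2 (λ c d → :a₂ :1 :0 (:- (:3 :* d)) (c :* d) :1 (:- c) d := :0) refl c d
    ; apolar-b = solve 2 (λ c d → :a₁ :0 (:- :3) (:3 :* c) (:- (c :* c :+ :- d)) :1 (:- c) d := :0) refl c d
               , solve 2 (λ c d → :a₂ :0 (:- :3) (:3 :* c) (:- (c :* c :+ :- d)) :1 (:- c) d := :0) refl c d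
    ; independent = λ {α} {β} e →
        trans (solve 2 (λ α β → α := α :* :1 :+ β :* :0) refl α β) (cong Quad.x₀ e) ,
        *-cancel-≡0 (-‿≢0 three≢0) (trans (solve 2 (λ α β → :- :3 :* β := α :* :0 :+ β :* (:- :3)) refl α β) (cong Quad.x₁ e))
    ; span = spans
    ; base-point-free = λ x ea eb → [ (λ e → [ id , id ]′ (*-≡0 _ e)) , id ]′ (*-≡0 _ (trans (norm (hom x)) (trans
        (cong₂ (λ A B → A * A + c * (A * B) + d * (B * B)) ea eb)
        (solve 2 (λ c d → :0 :* :0 :+ c :* (:0 :* :0) :+ d :* (:0 :* :0) := :0) refl c d))))
    }
    where
    -- The norm of (X - s Y)³ = A + s B, computed in two ways. It shows that A and B vanish together
    -- only where Q does.
    norm : ∀ P → let Q = qval (monic c d) P ; A = val (imaginary-a c d) P ; B = val (imaginary-b c d) P in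
      Q * Q * Q ≡ A * A + c * (A * B) + d * (B * B)
    norm (x , y) = solve 4 (λ c d x y →
      let Q = :qval :1 (:- c) d x y
          A = :val :1 :0 (:- (:3 :* d)) (c :* d) x y
          B = :val :0 (:- :3) (:3 :* c) (:- (c :* c :+ :- d)) x y
      in Q :* Q :* Q := A :* A :+ c :* (A :* B) :+ d :* (B :* B)) refl c d x y
    spans : ∀ {p} → Apolar (monic c d) p → ∃ λ α → ∃ λ β → p ≡ α • imaginary-a c d ⊞ β • imaginary-b c d
    spans {⟨ p₀ , p₁ , p₂ , p₃ ⟩} (e₁ , e₂) = p₀ , - (p₁ * three ⁻¹) , quad-≡
      (solve 2 (λ p₀ β → p₀ := p₀ :* :1 :+ β :* :0) refl p₀ (- (p₁ * three ⁻¹)))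
      (modulo₁ (- p₁) inv (solve 3 (λ p₀ p₁ j → p₁ := p₀ :* :0 :+ (:- (p₁ :* j)) :* (:- :3) :+ (:- p₁) :* (:3 :* j :+ :- :1)) refl p₀ p₁ (three ⁻¹)))
      (modulo₂ 1# (p₁ * c) e₁ inv (solve 7 (λ p₀ p₁ p₂ p₃ c d j → p₂ := p₀ :* (:- (:3 :* d)) :+ (:- (p₁ :* j)) :* (:3 :* c)
        :+ :1 :* :a₁ p₀ p₁ p₂ p₃ :1 (:- c) d :+ p₁ :* c :* (:3 :* j :+ :- :1)) refl p₀ p₁ p₂ p₃ c d (three ⁻¹)))
      (*-cancel three≢0 (modulo₂ 1# (- c) e₂ e₁ (modulo₁ (- ((c * c + - d) * p₁)) inv (solve 7 (λ p₀ p₁ p₂ p₃ c d j →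
        :3 :* p₃ := :3 :* (p₀ :* (c :* d) :+ (:- (p₁ :* j)) :* (:- (c :* c :+ :- d)))
        :+ :1 :* :a₂ p₀ p₁ p₂ p₃ :1 (:- c) d :+ (:- c) :* :a₁ p₀ p₁ p₂ p₃ :1 (:- c) d
        :+ (:- ((c :* c :+ :- d) :* p₁)) :* (:3 :* j :+ :- :1)) refl p₀ p₁ p₂ p₃ c d (three ⁻¹)))))
      where
      inv : three * three ⁻¹ + - 1# ≡ 0#
      inv = ≡⇒-≡0 (*-inverse three≢0)

  -- Planes through an axis

  nonroots : Quadratic → List (Maybe 𝔽)
  nonroots h = filter (λ x → ¬? (qval h (hom x) ≟ 0#)) points

  -- The same `N` counts the nondegenerate planes through the axis and the points of the cubic that
  -- are not roots of h. This coincidence is what lets the double count decide the number of roots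
  -- on each plane.
  record Axis (h : Quadratic) (N : ℕ) : Set where
    field
      pencil : Pencil h
      planes : Card SamePlane (Good h) N
      nonroots-length : length (nonroots h) ≡ N
      root⇒nonroot : ∀ {p} x → Good h p → Root p x → qval h (hom x) ≢ 0#

    open Pencil pencil public

    private
      ps : List V
      ps = proj₁ planes
      ps-good : ∀ {p} → p ∈ ps → Good h p
      ps-good = All.lookup (proj₁ (proj₂ (proj₂ planes)))
      ps-separated : AllPairs (λ p p′ → ¬ SamePlane p p′) ps
      ps-separated = proj₁ (proj₂ (proj₂ (proj₂ planes)))
      ps-cover : ∀ p → Good h p → Any (SamePlane p) ps
      ps-cover = proj₂ (proj₂ (proj₂ (proj₂ planes)))

      total : ∑ ps #roots ≡ N
      total = begin
        ∑ ps #roots                                            ≡⟨ ∑-cong ps (λ {p} i → roots-in-nonroots p (ps-good i)) ⟩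
        ∑ ps (λ p → count (root? p) (nonroots h))              ≡⟨ ∑-count-swap root? ps (nonroots h) ⟩
        ∑ (nonroots h) (λ x → count (λ p → root? p x) ps)      ≡⟨ ∑-ones (nonroots h) (λ {x} i → one-plane x (proj₂ (∈-filter⁻ nonroot? {xs = points} i))) ⟩
        length (nonroots h)                                    ≡⟨ nonroots-length ⟩
        N                                                      ∎
        where
        open ≡-Reasoning
        nonroot? : ∀ x → Dec (¬ qval h (hom x) ≡ 0#)
        nonroot? x = ¬? (qval h (hom x) ≟ 0#)
        roots-in-nonroots : ∀ p → Good h p → #roots p ≡ count (root? p) (nonroots h)
        roots-in-nonroots p good = #roots-exactly p
          (Uniqueₚ.filter⁺ (root? p) (Uniqueₚ.filter⁺ nonroot? points-unique))
          (λ i → proj₂ (∈-filter⁻ (root? p) {xs = nonroots h} i))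
          (λ x r → ∈-filter⁺ (root? p) (∈-filter⁺ nonroot? (points-complete x) (root⇒nonroot x good r)) r)
        one-plane : ∀ x → qval h (hom x) ≢ 0# → count (λ p → root? p x) ps ≡ 1
        one-plane x h≢0 = count-one (λ p → root? p x) ps-separated
          (Any.map (λ {p} same → Proportional-OnPlane (ν (hom x)) same (member-root x)) (ps-cover (member x) (member-good x h≢0)))
          (λ i j → member-unique x h≢0 (ps-good i) (ps-good j))

      same⇒#roots : ∀ {p p′} → NonZeroV p′ → SamePlane p p′ → #roots p ≡ #roots p′
      same⇒#roots {p} {p′} p′≢0 same = #roots-exactly p (Uniqueₚ.filter⁺ (root? p′) points-unique)
        (λ {x} i → Proportional-OnPlane (ν (hom x)) (Proportional-sym p′≢0 same) (proj₂ (∈-filter⁻ (root? p′) {xs = points} i)))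
        (λ x r → ∈-filter⁺ (root? p′) (points-complete x) (Proportional-OnPlane (ν (hom x)) same r))

      in-list : ∀ {p} → Good h p → ∃ λ p′ → p′ ∈ ps × #roots p ≡ #roots p′
      in-list {p} good = let (p′ , i , same) = find (ps-cover p good) in
        p′ , i , same⇒#roots (proj₁ (proj₁ (ps-good i))) same

    all-one : (∀ {p} → Good h p → ∀ {x y} → Root p x → Root p y → x ≡ y) → ∀ {p} → Good h p → #roots p ≡ 1
    all-one single good = let (p′ , i , e) = in-list good in
      trans e (∑-≤1-tight ps (λ {p} i → at-most-one p (ps-good i)) (trans total (sym (proj₁ (proj₂ planes)))) i)
      where
      at-most-one : ∀ p → Good h p → #roots p ≤ 1
      at-most-one p good = go (filter (root? p) points) (Uniqueₚ.filter⁺ (root? p) points-unique)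
          (λ i → proj₂ (∈-filter⁻ (root? p) {xs = points} i))
        where
        go : ∀ us → Unique us → (∀ {u} → u ∈ us → Root p u) → length us ≤ 1
        go [] _ _ = z≤n
        go (_ ∷ []) _ _ = s≤s z≤n
        go (u ∷ v ∷ _) ((u≢v ∷ _) ∷ _) root = contradiction (single good (root (here refl)) (root (there (here refl)))) u≢v

    module _ (zero-or-three : ∀ {p} → Good h p → #roots p ≡ 0 ⊎ #roots p ≡ 3) where

      private
        k : ℕ
        k = count (λ p → #roots p ℕ.≟ 3) ps
        3k≡N : 3 ℕ.* k ≡ N
        3k≡N = trans (sym (∑-0or3 ps (zero-or-three ∘ ps-good))) total

      three-planes : ∃ λ k → Card SamePlane (λ p → Good h p × #roots p ≡ 3) k × 3 ℕ.* k ≡ N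
      three-planes = k , Card-filter (λ p → #roots p ℕ.≟ 3)
        (λ { _ ((p≢0 , _) , _) same e → trans (sym (same⇒#roots p≢0 same)) e }) planes , 3k≡N

      zero-planes : ∃ λ k → Card SamePlane (λ p → Good h p × #roots p ≡ 0) k × 3 ℕ.* k ≡ 2 ℕ.* N
      zero-planes = k′ , Card-resp
          (λ _ (good , ≢3) → good , [ id , (λ e → contradiction e ≢3) ]′ (zero-or-three good))
          (λ _ (good , e) → good , λ e′ → contradiction (trans (sym e) e′) λ ())
          (Card-filter (λ p → ¬? (#roots p ℕ.≟ 3))
            (λ { _ ((p≢0 , _) , _) same ≢3 e → ≢3 (trans (same⇒#roots p≢0 same) e) }) planes) ,
          ℕ.+-cancelˡ-≡ N _ _ (begin
            N ℕ.+ 3 ℕ.* k′            ≡⟨ cong (ℕ._+ 3 ℕ.* k′) 3k≡N ⟨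
            3 ℕ.* k ℕ.+ 3 ℕ.* k′      ≡⟨ ℕ.*-distribˡ-+ 3 k k′ ⟨
            3 ℕ.* (k ℕ.+ k′)          ≡⟨ cong (3 ℕ.*_) (trans (count-split (λ p → #roots p ℕ.≟ 3) ps) (proj₁ (proj₂ planes))) ⟩
            3 ℕ.* N                   ∎)
        where
        open ≡-Reasoning
        k′ : ℕ
        k′ = count (λ p → ¬? (#roots p ℕ.≟ 3)) ps

  count-nonroots : ∀ h {us} → Unique us → (∀ {x} → x ∈ us → qval h (hom x) ≡ 0#) → (∀ x → qval h (hom x) ≡ 0# → x ∈ us) →
    length us ℕ.+ length (nonroots h) ≡ suc q
  count-nonroots h uniq into onto = trans
    (cong (ℕ._+ length (nonroots h)) (sym (count-exactly (λ x → qval h (hom x) ≟ 0#) points-unique uniq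
      (λ i → points-complete _ , into i) (λ {x} _ → onto x))))
    (trans (count-split (λ x → qval h (hom x) ≟ 0#) points) points-length)

  scaled-Γ : ∀ {p α u v} → p ≡ α • Γ u ⊞ 0# • Γ v → p ≡ α • Γ u
  scaled-Γ {α = α} {u} {v} refl = dot-ext λ x → trans (dot-combination α 0# (Γ u) (Γ v) x)
    (trans (solve 2 (λ y z → y :+ :0 :* z := y) refl (α * dot (Γ u) x) (dot (Γ v) x)) (sym (dot-• α (Γ u) x)))

  scaled-Γ′ : ∀ {p β u v} → p ≡ 0# • Γ u ⊞ β • Γ v → p ≡ β • Γ v
  scaled-Γ′ {β = β} {u} {v} refl = dot-ext λ x → trans (dot-combination 0# β (Γ u) (Γ v) x)
    (trans (solve 2 (λ y z → :0 :* z :+ y := y) refl (β * dot (Γ v) x) (dot (Γ u) x)) (sym (dot-• β (Γ v) x)))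

  -- In the pencil spanned by `Γ u` and `Γ v` only these two planes are degenerate. On every other
  -- plane both coefficients are nonzero, so neither `u` nor `v` is a root.
  realAxis : ∀ {u v} → u ≢ v → Axis (chord (hom u) (hom v)) (q ℕ.∸ 1)
  realAxis {u} {v} u≢v = record
    { pencil = realPencil u≢v
    ; planes = map plane scalars , trans (length-map plane scalars) scalars-length
             , Allₚ.map⁺ (All.tabulate λ {l} i → plane-good l (proj₂ (∈-filter⁻ (λ l → ¬? (l ≟ 0#)) {xs = elements} i)))
             , AllPairsₚ.map⁺ (AllPairs.map (λ l≢l′ same → l≢l′ (normal-injective same)) (Uniqueₚ.filter⁺ (λ l → ¬? (l ≟ 0#)) elements-unique))
             , cover
    ; nonroots-length = cong (ℕ._∸ 2) (count-nonroots h {u ∷ v ∷ []} ((u≢v ∷ []) ∷ [] ∷ [])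
        (λ { (here refl) → chord-rootˡ u v ; (there (here refl)) → chord-rootʳ u v })
        (λ x e → [ here , there ∘ here ]′ (chord-root u v x e)))
    ; root⇒nonroot = λ x good r e → root-values good x (chord-root u v x e) r
    }
    where
    h : Quadratic
    h = chord (hom u) (hom v)
    open Pencil (realPencil u≢v)
    scalars : List 𝔽
    scalars = filter (λ l → ¬? (l ≟ 0#)) elements
    scalars-length : length scalars ≡ q ℕ.∸ 1
    scalars-length = cong (ℕ._∸ 1) (trans (cong (ℕ._+ length scalars) (sym (count-exactly (_≟ 0#) {elements} {0# ∷ []} elements-unique ([] ∷ [])
        (λ { (here refl) → elements-complete 0# , refl }) (λ _ → here))))
      (trans (count-split (_≟ 0#) elements) elements-length))
    plane : 𝔽 → V
    plane l = 1# • Γ u ⊞ l • Γ v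
    value-u : ∀ α β → val (α • Γ u ⊞ β • Γ v) (hom u) ≡ β * val (Γ v) (hom u)
    value-u α β = trans (dot-combination α β (Γ u) (Γ v) _) (trans (cong (λ z → α * z + β * val (Γ v) (hom u)) (Γ-self-root u))
      (solve 2 (λ α y → α :* :0 :+ y := y) refl α (β * val (Γ v) (hom u))))
    value-v : ∀ α β → val (α • Γ u ⊞ β • Γ v) (hom v) ≡ α * val (Γ u) (hom v)
    value-v α β = trans (dot-combination α β (Γ u) (Γ v) _) (trans (cong (λ z → α * val (Γ u) (hom v) + β * z) (Γ-self-root v))
      (solve 2 (λ β y → y :+ β :* :0 := y) refl β (α * val (Γ u) (hom v))))
    coefficients≢0 : ∀ {p α β} → Nondegenerate p → p ≡ α • Γ u ⊞ β • Γ v → α ≢ 0# × β ≢ 0#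
    coefficients≢0 {α = α} {β} (_ , hess≢0) e =
      (λ { refl → hess≢0 (hess-multiple-of-Γ β v (scaled-Γ′ {u = u} {v} e)) }) ,
      (λ { refl → hess≢0 (hess-multiple-of-Γ α u (scaled-Γ {u = u} {v} e)) })
    nonzero : ∀ {α β x} → α ≢ 0# → β ≢ 0# → x ≡ u ⊎ x ≡ v → ¬ Root (α • Γ u ⊞ β • Γ v) x
    nonzero {α} {β} α≢0 β≢0 (inj₁ refl) r = *-≢0 β≢0 (u≢v ∘ Γ-root v u) (trans (sym (value-u α β)) r)
    nonzero {α} {β} α≢0 β≢0 (inj₂ refl) r = *-≢0 α≢0 (u≢v ∘ sym ∘ Γ-root u v) (trans (sym (value-v α β)) r)
    root-values : ∀ {p} → Good h p → ∀ x → x ≡ u ⊎ x ≡ v → ¬ Root p x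
    root-values {p} (nd , ap) x at r = let (α , β , e) = span ap ; (α≢0 , β≢0) = coefficients≢0 nd e in
      nonzero α≢0 β≢0 at (trans (cong (λ p → val p (hom x)) (sym e)) r)
    plane-good : ∀ l → l ≢ 0# → Good h (plane l)
    plane-good l l≢0 = (p≢0 , nondegenerate) , apolar-combination 1# l
      where
      p≢0 : NonZeroV (plane l)
      p≢0 = combination≢0 (inj₁ (0≢1 ∘ sym))
      nondegenerate : hess (plane l) ≢ zeroQ
      nondegenerate hess≡0 = let (w , r , _ , e) = degenerate⇒base-root {h} {plane l} p≢0 (apolar-combination 1# l) hess≡0 in
        nonzero {1#} {l} {w} (0≢1 ∘ sym) l≢0 (chord-root u v w e) r
    cover : ∀ p → Good h p → Any (SamePlane p) (map plane scalars)
    cover p (nd , ap) = let (α , β , e) = span ap ; (α≢0 , β≢0) = coefficients≢0 nd e in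
      Anyₚ.map⁺ (lose (∈-filter⁺ (λ l → ¬? (l ≟ 0#)) (elements-complete (α ⁻¹ * β)) (*-≢0 (⁻¹-≢0 α≢0) β≢0)) (normal α≢0 e))

  monic-rootless : ∀ {c d} → Rootless c d → ∀ x → qval (monic c d) (hom x) ≢ 0#
  monic-rootless {c} {d} none (just t) e = none t (trans (solve 3 (λ c d t → t :* t :+ :- (c :* t) :+ d := :qval :1 (:- c) d t :1) refl c d t) e)
  monic-rootless {c} {d} none nothing e = 0≢1 (trans (sym e) (solve 2 (λ c d → :qval :1 (:- c) d (:- :1) :0 := :1) refl c d))

  -- All q + 1 planes of the pencil are nondegenerate: a cube among them would give h a root over F.
  imaginaryAxis : ∀ {c d} → Rootless c d → Axis (monic c d) (q ℕ.+ 1)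
  imaginaryAxis {c} {d} none = record
    { pencil = imaginaryPencil c d
    ; planes = imaginary-b c d ∷ map plane elements , trans (cong suc (trans (length-map plane elements) elements-length)) (ℕ.+-comm 1 q)
             , good right-combination (inj₂ (0≢1 ∘ sym)) ∷ Allₚ.map⁺ (All.tabulate λ {l} _ → good refl (inj₁ (0≢1 ∘ sym)))
             , Allₚ.map⁺ (All.tabulate λ {l} _ → b≢plane l) ∷ AllPairsₚ.map⁺ (AllPairs.map (λ l≢l′ same → l≢l′ (normal-injective same)) elements-unique)
             , λ p (nd , ap) → cover nd (proj₂ (proj₂ (span ap))) (proj₁ (span ap) ≟ 0#)
    ; nonroots-length = trans (count-nonroots h [] (λ ()) (λ x e → contradiction e (monic-rootless none x))) (ℕ.+-comm 1 q)
    ; root⇒nonroot = λ x _ _ → monic-rootless none x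
    }
    where
    h : Quadratic
    h = monic c d
    open Pencil (imaginaryPencil c d)
    plane : 𝔽 → V
    plane l = 1# • a ⊞ l • b
    good : ∀ {α β p} → α • a ⊞ β • b ≡ p → α ≢ 0# ⊎ β ≢ 0# → Good h p
    good {α} {β} refl nz = (combination≢0 nz , nondegenerate) , apolar-combination α β
      where
      nondegenerate : hess (α • a ⊞ β • b) ≢ zeroQ
      nondegenerate hess≡0 = let (w , _ , _ , e) = degenerate⇒base-root {h} {α • a ⊞ β • b} (combination≢0 nz) (apolar-combination α β) hess≡0 in
        monic-rootless none w e
    b≢plane : ∀ l → ¬ SamePlane b (plane l)
    b≢plane l (k , e) = 0≢1 (sym (trans
      (proj₁ (injective {1#} {l} {k * 0#} {k * 1#} (trans e (trans (cong (k •_) (sym right-combination)) (•-combination k 0# 1#)))))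
      (R.zeroʳ k)))
    cover : ∀ {p α β} → Nondegenerate p → p ≡ α • a ⊞ β • b → Dec (α ≡ 0#) → Any (SamePlane p) (b ∷ map plane elements)
    cover nd e (no α≢0) = there (Anyₚ.map⁺ (lose (elements-complete _) (normal α≢0 e)))
    cover {p} {α} {β} (p≢0 , _) e (yes refl) = here (β ⁻¹ , sym (trans (cong ((β ⁻¹) •_) e) (trans (•-combination (β ⁻¹) 0# β)
      (trans (cong₂ (λ y z → y • a ⊞ z • b) (R.zeroʳ _) (trans (R.*-comm _ β) (*-inverse λ { refl → p≢0 (trans e combination-zero) }))) right-combination))))

  -- Lines

  SameLine-refl : ∀ ℓ → SameLine ℓ ℓ
  SameLine-refl ℓ x _ = id , id

  SameLine-sym : ∀ {ℓ m} → SameLine ℓ m → SameLine m ℓ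
  SameLine-sym e x x≢0 = proj₂ (e x x≢0) , proj₁ (e x x≢0)

  SameLine-trans : ∀ {ℓ m n} → SameLine ℓ m → SameLine m n → SameLine ℓ n
  SameLine-trans e e′ x x≢0 = proj₁ (e′ x x≢0) ∘ proj₁ (e x x≢0) , proj₂ (e x x≢0) ∘ proj₂ (e′ x x≢0)

  SameLine-resp-LineInPlane : ∀ {ℓ m p} → SameLine ℓ m → LineInPlane ℓ p → LineInPlane m p
  SameLine-resp-LineInPlane e inc x x≢0 on = inc x x≢0 (proj₂ (e x x≢0) on)

  vectors : List V
  vectors = map (λ ((a , b) , (c , d)) → ⟨ a , b , c , d ⟩) (cartesianProduct pairs pairs)

  vectors-complete : ∀ x → x ∈ vectors
  vectors-complete ⟨ a , b , c , d ⟩ = ∈-map⁺ (λ ((a , b) , (c , d)) → ⟨ a , b , c , d ⟩)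
    (∈-cartesianProduct⁺ (pairs-complete (a , b)) (pairs-complete (c , d)))

  sameLine? : ∀ ℓ m → Dec (SameLine ℓ m)
  sameLine? ℓ@(a , b) m@(a′ , b′) = map′ (λ all x x≢0 → All.lookup all (vectors-complete x) x≢0) (λ same → All.tabulate λ {x} _ → same x)
    (all? (λ x → ¬? (x ≟V zeroV) →-dec ((on ℓ x →-dec on m x) ×-dec (on m x →-dec on ℓ x))) vectors)
    where
    on : ∀ ℓ x → Dec (OnLine ℓ x)
    on (a , b) x = dot a x ≟ 0# ×-dec dot b x ≟ 0#

  -- Common interface of the real and the imaginary axes. An index carries a proof, so
  -- `indices-complete` asks for a listed index with an equal line rather than for the index itself.
  record Family (T : Line → Set) (N : ℕ) : Set₁ where
    field
      Index : Set
      indices : List Index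
      some-index : Index
      form : Index → Quadratic
      axis : ∀ i → Axis (form i) N

    line : Index → Line
    line i = Axis.a (axis i) , Axis.b (axis i)

    field
      indices-complete : ∀ i → ∃ λ j → j ∈ indices × line i ≡ line j
      T⇒line : ∀ {ℓ} → T ℓ → ∃ λ i → SameLine ℓ (line i)
      line⇒T : ∀ i → T (line i)
      unique : ∀ {p} i j → hess p ≢ zeroQ → Apolar (form i) p → Apolar (form j) p → SameLine (line i) (line j)

    HasAxis : V → Set
    HasAxis p = ∃ λ i → Apolar (form i) p

    private
      T-inPlane⇒axis : ∀ {ℓ p} → T ℓ → LineInPlane ℓ p → ∃ λ i → SameLine ℓ (line i) × Apolar (form i) p
      T-inPlane⇒axis {ℓ} {p} t inc = let (i , same) = T⇒line t in
        i , same , Axis.inPlane⇒apolar (axis i) (SameLine-resp-LineInPlane {ℓ} {line i} {p} same inc)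

    Λ-one : ∀ {π : V → Set} → (∀ p → π p → hess p ≢ zeroQ × HasAxis p) → Λ T π 1
    Λ-one has p πp = let (hess≢0 , i , ap) = has p πp in
      line i ∷ [] , refl , (line⇒T i , Axis.apolar⇒inPlane (axis i) ap) ∷ [] , [] ∷ [] ,
      λ ℓ (t , inc) → let (j , same , ap′) = T-inPlane⇒axis {ℓ} t inc in
        here (SameLine-trans {ℓ} {line j} {line i} same (unique {p} j i hess≢0 ap′ ap))

    Λ-zero : ∀ {π : V → Set} → (∀ p → π p → ¬ HasAxis p) → Λ T π 0
    Λ-zero lacks p πp = Card-empty λ ℓ (t , inc) → let (i , _ , ap) = T-inPlane⇒axis {ℓ} t inc in lacks p πp (i , ap)

    -- Only positivity of the number of lines is recorded: `Π` is a ratio, and every line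
    -- contributes the same number of planes.
    lines : ∃ λ n → Card SameLine T n × 0 ℕ.< n
    lines = count-lines (representatives sameLine? SameLine-refl (map line indices))
      where
      count-lines : (∃ λ ys → (∀ {y} → y ∈ ys → y ∈ map line indices) × AllPairs (λ ℓ m → ¬ SameLine ℓ m) ys
                      × (∀ {ℓ} → ℓ ∈ map line indices → Any (SameLine ℓ) ys)) → ∃ λ n → Card SameLine T n × 0 ℕ.< n
      count-lines (ys , sub , sep , cover) = length ys , (ys , refl , All.tabulate is-T , sep , covers) ,
          nonempty (covers (line some-index) (line⇒T some-index))
        where
        nonempty : ∀ {P : Line → Set} {ys} → Any P ys → 0 ℕ.< length ys
        nonempty (here _)  = s≤s z≤n
        nonempty (there _) = s≤s z≤n
        is-T : ∀ {y} → y ∈ ys → T y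
        is-T i with ∈-map⁻ line (sub i)
        ... | j , _ , refl = line⇒T j
        covers : ∀ ℓ → T ℓ → Any (SameLine ℓ) ys
        covers ℓ t = let (i , same) = T⇒line t ; (j , j∈ , e) = indices-complete i in
          Any.map (λ {m} → SameLine-trans {ℓ} {line i} {m} same)
            (subst (λ ℓ → Any (SameLine ℓ) ys) (sym e) (cover (∈-map⁺ line j∈)))

    Π-of : ∀ {π : V → Set} num den → (∀ i → ∃ λ k → Card SamePlane (λ p → π p × Apolar (form i) p) k × den ℕ.* k ≡ num) → Π T π num den
    Π-of {π} num den slice =
      let (n , card , 0<n) = lines
          (m , flags , eq) = Card-flags {T = LineInPlane} (λ {ℓ} {m} {p} → SameLine-resp-LineInPlane {ℓ} {m} {p}) {num = num} {den} through card
      in n , m , card , flags , 0<n , eq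
      where
      through : ∀ ℓ → T ℓ → ∃ λ k → Card SamePlane (λ p → π p × LineInPlane ℓ p) k × den ℕ.* k ≡ num
      through ℓ t = let (i , same) = T⇒line t ; (k , card , eq) = slice i in
        k , Card-resp
          (λ p (πp , ap) → πp , SameLine-resp-LineInPlane {line i} {ℓ} {p} (SameLine-sym {ℓ} {line i} same) (Axis.apolar⇒inPlane (axis i) ap))
          (λ p (πp , inc) → πp , Axis.inPlane⇒apolar (axis i) (SameLine-resp-LineInPlane {ℓ} {line i} {p} same inc)) card , eq

    Π-zero : ∀ {π : V → Set} → (∀ p → π p → ¬ HasAxis p) → Π T π 0 1
    Π-zero lacks = Π-of 0 1 λ i → 0 , Card-empty (λ p (πp , ap) → lacks p πp (i , ap)) , refl

  -- The families of real and of imaginary axes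

  private
    module K where
      open FiniteField K public
      open FieldProperties K public
    module S = CommutativeRing K.commutativeRing
  open QuadraticExtension F K E 1<q renaming (Root to ExtensionRoot)
  open Embedding E

  -- Both forms are proportional to the Hessian of p, so a root passes from h′ to the Hessian and
  -- from there to h. The points `S` and `S′`, where h′ and the Hessian do not vanish, permit the
  -- two cancellations.
  apolar-forms-share-roots : ∀ {h h′ p} → h′ ≢ zeroQ → hess p ≢ zeroQ → Apolar h p → Apolar h′ p →
    ∀ X → qval h′ X ≡ 0# → qval h X ≡ 0#
  apolar-forms-share-roots {h} {h′} {p} h′≢0 hess≢0 ap ap′ X e =
    let (S , S≢0) = qval-nonzero h′ h′≢0
        (S′ , S′≢0) = qval-nonzero (hess p) hess≢0
        hess-root = *-cancel-≡0 S≢0 (trans (apolar⇒qval-∝ {h′} {p} ap′ S X) (trans (cong (_* qval (hess p) S) e) (R.zeroˡ _)))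
    in *-cancel-≡0 S′≢0 (trans (R.*-comm _ _) (trans (apolar⇒qval-∝ {h} {p} ap X S′) (trans (cong (qval h S′ *_) hess-root) (R.zeroʳ _))))

  realFamily : Family RA (q ℕ.∸ 1)
  realFamily = record
    { Index = Σ (Maybe 𝔽 × Maybe 𝔽) λ (u , v) → u ≢ v
    ; indices = witnesses distinct? (cartesianProduct points points)
    ; some-index = (nothing , just 0#) , λ ()
    ; form = λ ((u , v) , _) → chord (hom u) (hom v)
    ; axis = λ (_ , u≢v) → realAxis u≢v
    ; indices-complete = λ ((u , v) , u≢v) →
        let (p , i) = ∈-witnesses distinct? (∈-cartesianProduct⁺ (points-complete u) (points-complete v)) u≢v in (_ , p) , i , refl
    ; T⇒line = λ (_ , u , v , ¬same , same) → ((u , v) , λ { refl → ¬same (Proportional-refl _) }) , same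
    ; line⇒T = λ ((u , v) , u≢v) → let isLine = Pencil.isLine (realPencil u≢v) in
        isLine , u , v , proj₂ (proj₂ isLine) , SameLine-refl (Γ u , Γ v)
    ; unique = λ {p} ((u , v) , u≢v) ((u′ , v′) , u′≢v′) hess≢0 ap ap′ →
        let shared = apolar-forms-share-roots {chord (hom u) (hom v)} {chord (hom u′) (hom v′)} {p}
              (chord≢0 (hom u′) (hom v′) (det-hom≢0 u′≢v′)) hess≢0 ap ap′
        in same u′≢v′ (chord-root u v u′ (shared _ (chord-rootˡ u′ v′))) (chord-root u v v′ (shared _ (chord-rootʳ u′ v′)))
    }
    where
    distinct? : Decidable {A = Maybe 𝔽 × Maybe 𝔽} (λ (u , v) → u ≢ v)
    distinct? (u , v) = ¬? (u ≟P v)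
    same : ∀ {u v u′ v′} → u′ ≢ v′ → u′ ≡ u ⊎ u′ ≡ v → v′ ≡ u ⊎ v′ ≡ v → SameLine (Γ u , Γ v) (Γ u′ , Γ v′)
    same u≢u (inj₁ refl) (inj₁ refl) = contradiction refl u≢u
    same _ (inj₁ refl) (inj₂ refl) = λ _ _ → id , id
    same _ (inj₂ refl) (inj₁ refl) = λ _ _ → (λ (e , e′) → e′ , e) , (λ (e , e′) → e′ , e)
    same v≢v (inj₂ refl) (inj₂ refl) = contradiction refl v≢v

  ι-dot : ∀ c x → ι (dot c x) ≡ dotK (ιV c) (ιV x)
  ι-dot ⟨ c₀ , c₁ , c₂ , c₃ ⟩ ⟨ x₀ , x₁ , x₂ , x₃ ⟩ = trans (ι-+ _ _) (cong₂ K._+_ (trans (ι-+ _ _) (cong₂ K._+_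
    (trans (ι-+ _ _) (cong₂ K._+_ (ι-* _ _) (ι-* _ _))) (ι-* _ _))) (ι-* _ _))

  ι-three : ∀ x → ι (three * x) ≡ threeK K.* ι x
  ι-three x = trans (ι-* _ _) (cong (K._* ι x) (trans (ι-+ _ _) (cong₂ K._+_ (trans (ι-+ _ _) (cong₂ K._+_ ι-1 ι-1)) ι-1)))

  quadK-≡ : ∀ {a b c d a′ b′ c′ d′ : K.Carrier} → a ≡ a′ → b ≡ b′ → c ≡ c′ → d ≡ d′ → ⟨ a , b , c , d ⟩ ≡ ⟨ a′ , b′ , c′ , d′ ⟩
  quadK-≡ refl refl refl refl = refl

  -- (X − s Y)³ = a + s b for the basis a, b of the pencil
  ΓK-split : ∀ {s c d} → ExtensionRoot s c d → ∀ x → dotK (ΓK s) (ιV x) ≡ ι (dot (imaginary-a c d) x) K.+ s K.* ι (dot (imaginary-b c d) x)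
  ΓK-split {s} {c} {d} root x@(⟨ x₀ , x₁ , x₂ , x₃ ⟩) = trans
    (K.modulo₁ (threeK K.* ι x₂ K.+ K.- ((s K.+ ι c) K.* ι x₃)) root
      (K.solve 7 (λ s c d x₀ x₁ x₂ x₃ →
        K.:1 K.:* x₀ K.:+ K.:- (K.:3 K.:* s) K.:* x₁ K.:+ K.:3 K.:* (s K.:* s) K.:* x₂ K.:+ K.:- (s K.:* s K.:* s) K.:* x₃
        K.:= K.:1 K.:* x₀ K.:+ K.:0 K.:* x₁ K.:+ (K.:- (K.:3 K.:* d)) K.:* x₂ K.:+ c K.:* d K.:* x₃
          K.:+ s K.:* (K.:0 K.:* x₀ K.:+ (K.:- (K.:3 K.:* K.:1)) K.:* x₁ K.:+ K.:3 K.:* c K.:* x₂ K.:+ (K.:- (c K.:* c K.:+ K.:- d)) K.:* x₃)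
          K.:+ (K.:3 K.:* x₂ K.:+ K.:- ((s K.:+ c) K.:* x₃)) K.:* (s K.:* s K.:+ K.:- (c K.:* s) K.:+ d))
        refl s (ι c) (ι d) (ι x₀) (ι x₁) (ι x₂) (ι x₃)))
    (sym (cong₂ (λ y z → y K.+ s K.* z)
      (trans (ι-dot (imaginary-a c d) x) (cong (λ a → dotK a (ιV x)) (quadK-≡ ι-1 ι-0
        (trans (ι-neg _) (cong K.-_ (ι-three d))) (ι-* c d))))
      (trans (ι-dot (imaginary-b c d) x) (cong (λ b → dotK b (ιV x)) (quadK-≡ ι-0
        (trans (cong (λ z → ι (- z)) (sym (R.*-identityʳ three))) (trans (ι-neg _) (cong K.-_ (trans (ι-three 1#) (cong (threeK K.*_) ι-1)))))
        (ι-three c) (trans (ι-neg _) (cong K.-_ (trans (ι-+ _ _) (cong₂ K._+_ (ι-* c c) (ι-neg d))))))))))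

  -- A point over F lies on the plane (X - s Y)³ = a + s b iff it lies on `a` and on `b`, because 1
  -- and s are independent over F.
  on-imaginary-line : ∀ {s c d} → Imaginary s → ExtensionRoot s c d → ∀ x →
    (OnLine (imaginary-a c d , imaginary-b c d) x → dotK (ΓK s) (ιV x) ≡ K.0#) ×
    (dotK (ΓK s) (ιV x) ≡ K.0# → OnLine (imaginary-a c d , imaginary-b c d) x)
  on-imaginary-line {s} im root x =
    (λ (ea , eb) → trans (ΓK-split root x) (trans (cong₂ (λ y z → ι y K.+ s K.* ι z) ea eb)
      (trans (cong (λ z → z K.+ s K.* z) ι-0) (trans (cong (K.0# K.+_) (S.zeroʳ s)) (S.+-identityʳ _))))) ,
    λ e → independent im _ _ (trans (sym (ΓK-split root x)) e)

  rootless? : Decidable {A = 𝔽 × 𝔽} (λ (c , d) → Rootless c d)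
  rootless? (c , d) = map′ (λ n t e → n (t , e)) (λ n (t , e) → n t e) (¬? (any-element? (λ t → (t * t + - (c * t) + d) ≟ 0#)))

  imaginaryFamily : Family IA (q ℕ.+ 1)
  imaginaryFamily = record
    { Index = Σ (𝔽 × 𝔽) λ (c , d) → Rootless c d
    ; indices = witnesses rootless? pairs
    ; some-index = let (s , im) = ∃-imaginary in proj₁ (minimal im)
    ; form = λ ((c , d) , _) → monic c d
    ; axis = λ (_ , none) → imaginaryAxis none
    ; indices-complete = λ (cd , none) → let (none′ , i) = ∈-witnesses rootless? (pairs-complete cd) none in (cd , none′) , i , refl
    ; T⇒line = λ { {ℓ} (_ , s , im , on) → let (i , root) = minimal im in
        i , λ x x≢0 → proj₂ (on-imaginary-line im root x) ∘ proj₁ (on x x≢0) , proj₂ (on x x≢0) ∘ proj₁ (on-imaginary-line im root x) }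
    -- An irreducible quadratic over F must be given a root in K before its line counts as an
    -- imaginary axis.
    ; line⇒T = λ ((c , d) , none) → let (s , root) = rootless⇒root none
                                        im = rootless⇒imaginary s none root in
        Pencil.isLine (imaginaryPencil c d) , s , im , λ x _ → on-imaginary-line im root x
    ; unique = λ {p} ((c , d) , _) ((c′ , d′) , _) hess≢0 ap ap′ →
        let (c≡ , d≡) = coefficients {p} {c} {d} {c′} {d′} hess≢0 ap ap′ in same c≡ d≡
    }
    where
    minimal : ∀ {s} → Imaginary s → ∃ λ ((cd , _) : Σ (𝔽 × 𝔽) λ (c , d) → Rootless c d) → ExtensionRoot s (proj₁ cd) (proj₂ cd)
    minimal {s} im = let (c , d , root) = imaginary⇒root s im in ((c , d) , imaginary⇒rootless s im root) , root
    -- A monic form proportional to the Hessian is determined by the ratios of the Hessian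
    -- coefficients; `H₀ = 0` would force the whole Hessian to vanish.
    coefficients : ∀ {p c d c′ d′} → hess p ≢ zeroQ → Apolar (monic c d) p → Apolar (monic c′ d′) p → c ≡ c′ × d ≡ d′
    coefficients {p} {c} {d} {c′} {d′} hess≢0 ap ap′ =
      *-cancel H₀≢0 (modulo₂ 1# (- 1#) (≡⇒-≡0 (proj₁ eqs)) (≡⇒-≡0 (proj₁ eqs′)) (solve 4 (λ c c′ H₀ H₁ →
        H₀ :* c := H₀ :* c′ :+ :1 :* (:1 :* H₁ :+ :- (:- c :* H₀)) :+ (:- :1) :* (:1 :* H₁ :+ :- (:- c′ :* H₀))) refl c c′ H₀ (proj₁ (proj₂ (hess p))))) ,
      *-cancel H₀≢0 (modulo₂ (- 1#) 1# (≡⇒-≡0 (proj₂ (proj₂ eqs))) (≡⇒-≡0 (proj₂ (proj₂ eqs′))) (solve 4 (λ d d′ H₀ H₂ →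
        H₀ :* d := H₀ :* d′ :+ (:- :1) :* (:1 :* H₂ :+ :- (d :* H₀)) :+ :1 :* (:1 :* H₂ :+ :- (d′ :* H₀))) refl d d′ H₀ (proj₂ (proj₂ (hess p)))))
      where
      H₀ : 𝔽
      H₀ = proj₁ (hess p)
      eqs : _
      eqs = apolar⇒∝-hess {monic c d} {p} ap
      eqs′ : _
      eqs′ = apolar⇒∝-hess {monic c′ d′} {p} ap′
      H₀≢0 : H₀ ≢ 0#
      H₀≢0 e = hess≢0 (cong₂ _,_ e (cong₂ _,_
        (trans (sym (R.*-identityˡ _)) (trans (proj₁ eqs) (trans (cong (- c *_) e) (R.zeroʳ _))))
        (trans (sym (R.*-identityˡ _)) (trans (proj₂ (proj₂ eqs)) (trans (cong (d *_) e) (R.zeroʳ _))))))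
    same : ∀ {c d c′ d′} → c ≡ c′ → d ≡ d′ → SameLine (imaginary-a c d , imaginary-b c d) (imaginary-a c′ d′ , imaginary-b c′ d′)
    same refl refl = λ _ _ → id , id

  -- Points on a plane through an axis

  ZeroOrThree AtMostOne : ∀ {T N} → Family T N → Set
  ZeroOrThree fam = ∀ i {p} → Good (Family.form fam i) p → #roots p ≡ 0 ⊎ #roots p ≡ 3
  AtMostOne fam = ∀ i {p} → Good (Family.form fam i) p → ∀ {x y} → Root p x → Root p y → x ≡ y

  stabiliser⇒zero-or-three : ∀ {h N} → Axis h N → (r s : 𝔽) → s ≢ 0# →
    (let (h₀ , h₁ , h₂) = h in r + r + s * h₁ + 1# ≡ 0# × r * r + r * s * h₁ + s * s * (h₀ * h₂) + - 1# ≡ 0#) →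
    ∀ {p} → Good h p → #roots p ≡ 0 ⊎ #roots p ≡ 3
  stabiliser⇒zero-or-three {h} ax r s s≢0 (trace , norm) {p} good@((p≢0 , _) , ap) = go (any? (root? p) points)
    where
    go : Dec (Any (Root p) points) → #roots p ≡ 0 ⊎ #roots p ≡ 3
    go (no none) = inj₁ (none⇒#roots≡0 p λ u root → none (lose (points-complete u) root))
    go (yes i) =
      let (u , _ , root) = find i
          (v , w , root-v , root-w , u≢v , u≢w , v≢w) = one-root⇒three-roots {h} {p} ap {r} {s} s≢0 trace norm {u} root (Axis.root⇒nonroot ax u good root)
      in inj₂ (three⇒#roots≡3 {p} {u} {v} {w} p≢0 root root-v root-w u≢v u≢w v≢w)

  sixth-root⇒real-zero-or-three : ∀ {ρ} → Φ ρ ≡ 0# → ZeroOrThree realFamily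
  sixth-root⇒real-zero-or-three {ρ} Φρ ((u , v) , u≢v) = stabiliser⇒zero-or-three (realAxis u≢v) r s s≢0 (trace , norm)
    where
    t w t′ w′ D i r s : 𝔽
    t = proj₁ (hom u)
    w = proj₂ (hom u)
    t′ = proj₁ (hom v)
    w′ = proj₂ (hom v)
    D = det (hom u) (hom v)
    i = D ⁻¹
    -- With these r and s, M has eigenvector `hom u` with eigenvalue -ρ and `hom v` with eigenvalue
    -- ρ - 1, the two primitive cube roots of unity; `s * D = 1 − 2ρ` is the difference -ρ - (ρ -
    -- 1).
    s = (1# + - (ρ + ρ)) * i
    r = - ρ + s * (w * t′)
    Di : D * i + - 1# ≡ 0#
    Di = ≡⇒-≡0 (*-inverse (det-hom≢0 u≢v))
    s≢0 : s ≢ 0#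
    s≢0 = *-≢0 (λ e → three≢0 (modulo₂ (- (1# + - (ρ + ρ))) (1# + 1# + 1# + 1#) e Φρ (solve 1 (λ ρ → :3 := :0
      :+ (:- (:1 :+ :- (ρ :+ ρ))) :* (:1 :+ :- (ρ :+ ρ)) :+ :4 :* (ρ :* ρ :+ :- ρ :+ :1)) refl ρ))) (⁻¹-≢0 (det-hom≢0 u≢v))
    trace : r + r + s * (- (w * t′ + t * w′)) + 1# ≡ 0#
    trace = modulo₁ (- (1# + - (ρ + ρ))) Di (solve 6 (λ t w t′ w′ i ρ →
      let s = (:1 :+ :- (ρ :+ ρ)) :* i
          r = :- ρ :+ s :* (w :* t′)
      in r :+ r :+ s :* (:- (w :* t′ :+ t :* w′)) :+ :1 := :0 :+ (:- (:1 :+ :- (ρ :+ ρ))) :* (:det t w t′ w′ :* i :+ :- :1)) refl t w t′ w′ i ρ)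
    norm : r * r + r * s * (- (w * t′ + t * w′)) + s * s * (w * w′ * (t * t′)) + - 1# ≡ 0#
    norm = modulo₂ (ρ * (1# + - (ρ + ρ))) (- 1#) Di Φρ (solve 6 (λ t w t′ w′ i ρ →
      let s = (:1 :+ :- (ρ :+ ρ)) :* i
          r = :- ρ :+ s :* (w :* t′)
      in r :* r :+ r :* s :* (:- (w :* t′ :+ t :* w′)) :+ s :* s :* (w :* w′ :* (t :* t′)) :+ :- :1
        := :0 :+ ρ :* (:1 :+ :- (ρ :+ ρ)) :* (:det t w t′ w′ :* i :+ :- :1) :+ (:- :1) :* (ρ :* ρ :+ :- ρ :+ :1)) refl t w t′ w′ i ρ)

  no-sixth-root⇒imaginary-zero-or-three : (∀ ρ → Φ ρ ≢ 0#) → ZeroOrThree imaginaryFamily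
  -- The pair stands for t² + t + 1. It does not split over F, so it is the characteristic
  -- polynomial of some x + y ε, a cube root of unity in F[ε].
  no-sixth-root⇒imaginary-zero-or-three no-root ((c , d) , none) = go (split-surjective (- 1# , 1#))
    where
    open Norm c d none
    go : (∃ λ z → split z ≡ (- 1# , 1#)) → ∀ {p} → Good (monic c d) p → #roots p ≡ 0 ⊎ #roots p ≡ 3
    go (inj₂ (u , v) , e) = contradiction (modulo₂ u (- 1#) (≡⇒-≡0 (cong proj₁ e)) (≡⇒-≡0 (cong proj₂ e))
      (solve 2 (λ u v → (:- u) :* (:- u) :+ :- (:- u) :+ :1 := :0 :+ u :* (u :+ v :+ :- (:- :1)) :+ (:- :1) :* (u :* v :+ :- :1)) refl u v)) (no-root (- u))
    -- With r = x and s = -y, M is multiplication by x + y ε when the vector (p, q) is read as p - q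
    -- ε.
    go (inj₁ (x , y) , e) = stabiliser⇒zero-or-three (imaginaryAxis none) x (- y) -y≢0 (trace , norm)
      where
      tr≡ : x + x + c * y + - - 1# ≡ 0#
      tr≡ = ≡⇒-≡0 (cong proj₁ e)
      nm≡ : x * x + c * (x * y) + d * (y * y) + - 1# ≡ 0#
      nm≡ = ≡⇒-≡0 (cong proj₂ e)
      -- If y = 0 then 2x + 1 = 0 and x² = 1, whereas 3 = (2x - 1)(2x + 1) - 4(x² - 1).
      -y≢0 : - y ≢ 0#
      -y≢0 z = three≢0 (modulo₂ (x + x + - 1#) (- (1# + 1# + 1# + 1#))
        (modulo₂ 1# c tr≡ z (solve 3 (λ x y c → x :+ x :+ :1 := :0 :+ :1 :* (x :+ x :+ c :* y :+ :- (:- :1)) :+ c :* (:- y)) refl x y c))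
        (modulo₂ 1# (c * x + d * y) nm≡ z (solve 4 (λ x y c d → x :* x :+ :- :1 := :0 :+ :1 :* (x :* x :+ c :* (x :* y) :+ d :* (y :* y) :+ :- :1)
          :+ (c :* x :+ d :* y) :* (:- y)) refl x y c d))
        (solve 1 (λ x → :3 := :0 :+ (x :+ x :+ :- :1) :* (x :+ x :+ :1) :+ (:- :4) :* (x :* x :+ :- :1)) refl x))
      trace : x + x + - y * (- c) + 1# ≡ 0#
      trace = trans (solve 3 (λ x y c → x :+ x :+ :- y :* (:- c) :+ :1 := x :+ x :+ c :* y :+ :- (:- :1)) refl x y c) tr≡
      norm : x * x + x * (- y) * (- c) + - y * - y * (1# * d) + - 1# ≡ 0#
      norm = trans (solve 4 (λ x y c d → x :* x :+ x :* (:- y) :* (:- c) :+ :- y :* :- y :* (:1 :* d) :+ :- :1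
        := x :* x :+ c :* (x :* y) :+ d :* (y :* y) :+ :- :1) refl x y c d) nm≡

  -- The Hessian vanishes at the two distinct roots of h; by `no-sixth-root⇒hess-one-root` this is
  -- impossible for a plane with two distinct roots.
  no-sixth-root⇒real-at-most-one : (∀ ρ → Φ ρ ≢ 0#) → AtMostOne realFamily
  no-sixth-root⇒real-at-most-one no-root ((u , v) , u≢v) {p} ((p≢0 , hess≢0) , ap) {x} {y} root-x root-y = go (x ≟P y)
    where
    hess-root : ∀ w → qval (chord (hom u) (hom v)) (hom w) ≡ 0# → qval (hess p) (hom w) ≡ 0#
    hess-root w = apolar-forms-share-roots {hess p} {chord (hom u) (hom v)} {p}
      (chord≢0 (hom u) (hom v) (det-hom≢0 u≢v)) hess≢0 (hess-apolar p) ap (hom w)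
    go : Dec (x ≡ y) → x ≡ y
    go (yes x≡y) = x≡y
    go (no x≢y)  = contradiction (no-sixth-root⇒hess-one-root {p} p≢0 {x} {y} x≢y root-x root-y no-root {u} {v}
      (hess-root u (chord-rootˡ u v)) (hess-root v (chord-rootʳ u v))) u≢v

  -- Two distinct roots would give the Hessian a zero over F, and h, being proportional to it, would
  -- vanish there too.
  sixth-root⇒imaginary-at-most-one : ∀ {ρ} → Φ ρ ≡ 0# → AtMostOne imaginaryFamily
  sixth-root⇒imaginary-at-most-one {ρ} Φρ ((c , d) , none) {p} ((p≢0 , hess≢0) , ap) {x} {y} root-x root-y = go (x ≟P y)
    where
    anisotropic : ∀ X → X ≢ (0# , 0#) → qval (monic c d) X ≢ 0#
    anisotropic X X≢0 e = let (u , k , k≢0 , X≡) = hom-surjective X X≢0 in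
      monic-rootless none u (*-cancel-≡0 (*-≢0 k≢0 k≢0) (trans (sym (qval-scale k (hom u))) (trans (cong (qval (monic c d)) (sym X≡)) e)))
      where
      qval-scale : ∀ k P → qval (monic c d) (scale k P) ≡ k * k * qval (monic c d) P
      qval-scale k (x , y) = solve 5 (λ c d k x y → :qval :1 (:- c) d (k :* x) (k :* y) := k :* k :* :qval :1 (:- c) d x y) refl c d k x y
    go : Dec (x ≡ y) → x ≡ y
    go (yes x≡y) = x≡y
    go (no x≢y)  = let (X , X≢0 , e) = sixth-root⇒hess-root {p} p≢0 {x} {y} x≢y root-x root-y Φρ in
      contradiction (apolar-forms-share-roots {monic c d} {hess p} {p} hess≢0 hess≢0 ap (hess-apolar p) X e) (anisotropic X X≢0)

  -- Plane types and incidence numbers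

  Plane[]⇒nondegenerate : ∀ {n p} → n ≢ 1 → Plane[ n ]𝒞 p → Nondegenerate p
  Plane[]⇒nondegenerate {n} {p} n≢1 (p≢0 , on) = p≢0 , λ hess≡0 → n≢1 (trans (sym (CPointsOn⇒#roots {p} on)) (hess≡0⇒#roots≡1 p≢0 hess≡0))

  Plane1̄⇒nondegenerate : ∀ {p} → Plane1̄𝒞 p → Nondegenerate p
  Plane1̄⇒nondegenerate (p≢0 , ¬Γ , _) = p≢0 , ¬Γ ∘ hess≡0⇒IsΓPlane p≢0

  #roots⇒Plane[] : ∀ {n p} → NonZeroV p → #roots p ≡ n → Plane[ n ]𝒞 p
  #roots⇒Plane[] {p = p} p≢0 refl = p≢0 , #roots⇒CPointsOn p

  #roots⇒Plane1̄ : ∀ {p} → Nondegenerate p → #roots p ≡ 1 → Plane1̄𝒞 p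
  #roots⇒Plane1̄ {p} (p≢0 , hess≢0) e = p≢0 , hess≢0 ∘ IsΓPlane⇒hess≡0 , subst (CPointsOn p) e (#roots⇒CPointsOn p)

  module _ {T₁ T₂ N₁ N₂} (fam₁ : Family T₁ N₁) (fam₂ : Family T₂ N₂)
           (zero-or-three : ZeroOrThree fam₁) (at-most-one : AtMostOne fam₂)
           (some-axis : ∀ {p} → Nondegenerate p → Family.HasAxis fam₁ p ⊎ Family.HasAxis fam₂ p ⊎ #roots p ≡ 2) where
    private
      module F₁ = Family fam₁
      module F₂ = Family fam₂

      exactly-one : ∀ {p} → Nondegenerate p → F₂.HasAxis p → #roots p ≡ 1
      exactly-one nd (i , ap) = Axis.all-one (F₂.axis i) (at-most-one i) (nd , ap)

      zero-or-three′ : ∀ {p} → Nondegenerate p → F₁.HasAxis p → #roots p ≡ 0 ⊎ #roots p ≡ 3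
      zero-or-three′ nd (i , ap) = zero-or-three i (nd , ap)

      lacks-axis₂ : ∀ {n} → n ≢ 1 → ∀ p → Plane[ n ]𝒞 p → ¬ F₂.HasAxis p
      lacks-axis₂ n≢1 p πp ax = n≢1 (trans (sym (CPointsOn⇒#roots {p} (proj₂ πp))) (exactly-one (Plane[]⇒nondegenerate n≢1 πp) ax))

      -- An axis of the second kind would leave exactly one point of the cubic on the plane, and a
      -- square Hessian exactly two; only an axis of the first kind remains.
      has-axis₁ : ∀ {n} → n ≢ 1 → n ≢ 2 → ∀ p → Plane[ n ]𝒞 p → hess p ≢ zeroQ × F₁.HasAxis p
      has-axis₁ n≢1 n≢2 p πp = let nd = Plane[]⇒nondegenerate n≢1 πp in proj₂ nd ,
        [ id , [ (λ ax → contradiction ax (lacks-axis₂ n≢1 p πp)) , (λ e → contradiction (trans (sym (CPointsOn⇒#roots {p} (proj₂ πp))) e) n≢2) ]′ ]′ (some-axis nd)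

      lacks-axis₁ : ∀ p → Plane1̄𝒞 p → ¬ F₁.HasAxis p
      lacks-axis₁ p πp@(_ , _ , on) ax =
        [ (λ e → contradiction (trans (sym e) (CPointsOn⇒#roots {p} on)) λ ())
        , (λ e → contradiction (trans (sym e) (CPointsOn⇒#roots {p} on)) λ ()) ]′
        (zero-or-three′ (Plane1̄⇒nondegenerate πp) ax)

      has-axis₂ : ∀ p → Plane1̄𝒞 p → hess p ≢ zeroQ × F₂.HasAxis p
      has-axis₂ p πp@(_ , _ , on) = let nd = Plane1̄⇒nondegenerate πp in proj₂ nd ,
        [ (λ ax → contradiction ax (lacks-axis₁ p πp)) , [ id , (λ e → contradiction (trans (sym (CPointsOn⇒#roots {p} on)) e) λ ()) ]′ ]′ (some-axis nd)

      slice : ∀ {n} i {k} → n ≢ 1 → Card SamePlane (λ p → Good (F₁.form i) p × #roots p ≡ n) k → Card SamePlane (λ p → Plane[ n ]𝒞 p × Apolar (F₁.form i) p) k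
      slice i n≢1 = Card-resp
        (λ p (((p≢0 , _) , ap) , e) → #roots⇒Plane[] p≢0 e , ap)
        (λ p (πp , ap) → (Plane[]⇒nondegenerate n≢1 πp , ap) , CPointsOn⇒#roots {p} (proj₂ πp))

    -- The first family consists of the axes whose stabiliser has an element of order 3. Both
    -- congruence classes are instances, with the real and the imaginary axes in exchanged roles.
    incidence-numbers :
      Λ T₁ (Plane[ 3 ]𝒞) 1 × Λ T₁ (Plane[ 0 ]𝒞) 1 × Λ T₂ Plane1̄𝒞 1 ×
      Π T₁ (Plane[ 3 ]𝒞) N₁ 3 × Π T₁ (Plane[ 0 ]𝒞) (2 ℕ.* N₁) 3 × Π T₂ Plane1̄𝒞 N₂ 1 ×
      Λ T₂ (Plane[ 3 ]𝒞) 0 × Π T₂ (Plane[ 3 ]𝒞) 0 1 × Λ T₂ (Plane[ 0 ]𝒞) 0 × Π T₂ (Plane[ 0 ]𝒞) 0 1 ×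
      Λ T₁ Plane1̄𝒞 0 × Π T₁ Plane1̄𝒞 0 1
    incidence-numbers =
      F₁.Λ-one (has-axis₁ (λ ()) (λ ())) , F₁.Λ-one (has-axis₁ (λ ()) (λ ())) , F₂.Λ-one has-axis₂ ,
      F₁.Π-of N₁ 3 (λ i → let (k , card , eq) = Axis.three-planes (F₁.axis i) (zero-or-three i) in k , slice i (λ ()) card , eq) ,
      F₁.Π-of (2 ℕ.* N₁) 3 (λ i → let (k , card , eq) = Axis.zero-planes (F₁.axis i) (zero-or-three i) in k , slice i (λ ()) card , eq) ,
      F₂.Π-of N₂ 1 (λ i → N₂ , Card-resp
        (λ p good → #roots⇒Plane1̄ (proj₁ good) (exactly-one (proj₁ good) (i , proj₂ good)) , proj₂ good)
        (λ p (πp , ap) → Plane1̄⇒nondegenerate πp , ap) (Axis.planes (F₂.axis i)) , ℕ.*-identityˡ N₂) ,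
      F₂.Λ-zero (lacks-axis₂ λ ()) , F₂.Π-zero (lacks-axis₂ λ ()) , F₂.Λ-zero (lacks-axis₂ λ ()) , F₂.Π-zero (lacks-axis₂ λ ()) ,
      F₁.Λ-zero lacks-axis₁ , F₁.Π-zero lacks-axis₁

  real-or-imaginary : ∀ {p} → Nondegenerate p → Family.HasAxis realFamily p ⊎ Family.HasAxis imaginaryFamily p ⊎ #roots p ≡ 2
  real-or-imaginary nd = [ (λ (u , v , u≢v , ap) → inj₁ (((u , v) , u≢v) , ap)) ,
    [ (λ (c , d , none , ap) → inj₂ (inj₁ (((c , d) , none) , ap))) , inj₂ ∘ inj₂ ]′ ]′ (axis-in-plane nd)

  imaginary-or-real : ∀ {p} → Nondegenerate p → Family.HasAxis imaginaryFamily p ⊎ Family.HasAxis realFamily p ⊎ #roots p ≡ 2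
  imaginary-or-real nd = [ inj₂ ∘ inj₁ , [ inj₁ , inj₂ ∘ inj₂ ]′ ]′ (real-or-imaginary nd)

open import Data.Nat using (_≤_; _+_; _*_; _∸_; _%_)

theorem5p8 : {q : ℕ} (F : FiniteField q) (K : FiniteField (q * q)) (E : Embedding F K) →
    5 ≤ q → ¬ (q % 3 ≡ 0) →
    let open Geometry F K E in
    (q % 3 ≡ 1 →
    Λ RA (Plane[ 3 ]𝒞) 1 × Λ RA (Plane[ 0 ]𝒞) 1 × Λ IA Plane1̄𝒞 1 ×
    Π RA (Plane[ 3 ]𝒞) (q ∸ 1) 3 × Π RA (Plane[ 0 ]𝒞) (2 * (q ∸ 1)) 3 ×
    Π IA Plane1̄𝒞 (q + 1) 1 ×
    Λ IA (Plane[ 3 ]𝒞) 0 × Π IA (Plane[ 3 ]𝒞) 0 1 ×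
    Λ IA (Plane[ 0 ]𝒞) 0 × Π IA (Plane[ 0 ]𝒞) 0 1 ×
    Λ RA Plane1̄𝒞 0 × Π RA Plane1̄𝒞 0 1)
    ×
    (q % 3 ≡ 2 →
    Λ IA (Plane[ 3 ]𝒞) 1 × Λ IA (Plane[ 0 ]𝒞) 1 × Λ RA Plane1̄𝒞 1 ×
    Π IA (Plane[ 3 ]𝒞) (q + 1) 3 × Π IA (Plane[ 0 ]𝒞) (2 * (q + 1)) 3 ×
    Π RA Plane1̄𝒞 (q ∸ 1) 1 ×
    Λ RA (Plane[ 3 ]𝒞) 0 × Π RA (Plane[ 3 ]𝒞) 0 1 ×
    Λ RA (Plane[ 0 ]𝒞) 0 × Π RA (Plane[ 0 ]𝒞) 0 1 ×
    Λ IA Plane1̄𝒞 0 × Π IA Plane1̄𝒞 0 1)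
theorem5p8 {q} F K E 5≤q 3∤q =
  (λ q≡1 → let (ρ , Φρ) = q≡1⇒sixth-root q≡1 in
    incidence-numbers realFamily imaginaryFamily (sixth-root⇒real-zero-or-three Φρ) (sixth-root⇒imaginary-at-most-one Φρ) real-or-imaginary) ,
  (λ q≡2 → let none = q≡2⇒no-sixth-root q≡2 in
    incidence-numbers imaginaryFamily realFamily (no-sixth-root⇒imaginary-zero-or-three none) (no-sixth-root⇒real-at-most-one none) imaginary-or-real)
  where
  open SixthRoots F 3∤q
  open Incidence F K E three≢0 (ℕ.<-≤-trans (s≤s (s≤s z≤n)) 5≤q)
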